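{- For integers $s\ge2r\ge2$, the $q$-Zeta numerator of the trapezoidal poset $T_{r,s}$ with rank $\rho(i,c)=c-i$ satisfies $$\mathbb{H}_{T_{r,s},\rho}(1,t)=\sum_{k=0}^{r-1}\binom{r-1}{k}\binom{s-r-1}{k}t^k.$$ In particular, this polynomial in $t$ is real-rooted with simple negative zeros. More precisely, writing $A=r-1$ and $B=s-r-1$, one has $$\mathbb{H}_{T_{r,s},\rho}(1,t)=(1-t)^A\,P_A^{(0,B-A)}\!\left(\frac{1+t}{1-t}\right),$$ where $P_A^{(\alpha,\beta)}$ is the Jacobi polynomial of degree $A$.
   Context: $q$-Zeta numerator: let $P$ be a finite graded poset with a unique maximum and rank function $\rho:P\to\{0,\dots,H\}$, where $H$ is the maximal rank. For $m\ge 0$ put $A_m(P,\rho;q)=\sum_{x_1\le\cdots\le x_m}q^{\rho(x_1)+\cdots+\rho(x_m)}$ (sum over weak chains in $P$; $A_0=1$). The numerator $\mathbb{H}_{P,\rho}(q,t)$ is the polynomial determined by $\sum_{m\ge 0}A_m(P,\rho;q)t^m=\mathbb{H}_{P,\rho}(q,t)/\prod_{a=0}^{H}(1-q^at)$. Trapezoidal poset: $T_{r,s}=\{(i,c):1\le i\le r,\ i\le c\le s-i\}$, ordered by $(i,c)\le(j,d)\iff i\ge j$ and $c\le d$. Jacobi polynomials have the standard normalization $P_n^{(\alpha,\beta)}(1)=\binom{n+\alpha}{n}$. -}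

module Defs where

open import Level using (0ℓ)
open import Algebra.Bundles using (CommutativeMonoid)
open import Algebra.Bundles.Raw using (RawRing)
import Algebra.Definitions.RawSemiring as RawSemiringDefs
import Algebra.Properties.CommutativeSemigroup as CommutativeSemigroupProperties
open import Data.Empty using (⊥-elim)
open import Data.Integer.Base as ℤ using (ℤ; +_)
open import Data.List.Base
  using (List; []; _∷_; map; foldr; upTo; filter; cartesianProduct; cartesianProductWith; mapMaybe)
open import Data.List.Membership.Propositional using (_∈_)
open import Data.List.Membership.Propositional.Properties using (∈-cartesianProduct⁺; ∈-upTo⁺)
open import Data.List.Relation.Unary.All as All using (All; []; _∷_)
open import Data.List.Relation.Unary.AllPairs using (AllPairs; []; _∷_)
open import Data.List.Relation.Unary.Any using (here; there)
open import Data.List.Relation.Unary.Linked using (Linked; linked?)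
open import Data.List.Relation.Unary.Unique.Propositional using (Unique)
open import Data.List.Relation.Unary.Unique.Propositional.Properties using (upTo⁺; cartesianProduct⁺)
open import Data.Maybe.Base as Maybe using (Maybe; just; nothing)
open import Data.Nat.Base as ℕ using (ℕ; zero; suc; s≤s; _∸_; _!)
open import Data.Nat.ListAction using (sum)
import Data.Nat.Properties as ℕₚ
open import Data.Product.Base using (_×_; _,_; ∃-syntax)
open import Data.Rational.Base as ℚ using (ℚ; 0ℚ; 1ℚ; ½; ∣_∣)
import Data.Rational.Properties as ℚₚ
open import Data.Sum.Base using (_⊎_; inj₁; inj₂)
open import Function.Base using (_∘_)
open import Relation.Binary.Core using (Rel)
open import Relation.Binary.Definitions using (Maximum)
open import Relation.Binary.PropositionalEquality
  using (_≡_; _≢_; refl; sym; trans; cong; cong₂; subst; isEquivalence; module ≡-Reasoning)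
open import Relation.Binary.Structures using (IsDecPartialOrder)
open import Relation.Nullary using (Dec; yes; no)
open import Relation.Nullary.Decidable using (_×-dec_; dec⇒maybe; map′)

-- A polynomial is its list of coefficients, constant term first.  Equality
-- is coefficientwise, so trailing zeros do not matter.

module _ (R : RawRing 0ℓ 0ℓ) where
  open RawRing R

  Poly : Set
  Poly = List Carrier

  coeff : Poly → ℕ → Carrier
  coeff []      _       = 0#
  coeff (a ∷ p) zero    = a
  coeff (a ∷ p) (suc n) = coeff p n

  addPoly : Poly → Poly → Poly
  addPoly []      q       = q
  addPoly p       []      = p
  addPoly (a ∷ p) (b ∷ q) = a + b ∷ addPoly p q

  mulPoly : Poly → Poly → Poly
  mulPoly []      q = []
  mulPoly (a ∷ p) q = addPoly (map (a *_) q) (0# ∷ mulPoly p q)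

  polyRing : RawRing 0ℓ 0ℓ
  polyRing = record
    { Carrier = Poly
    ; _≈_     = λ p q → ∀ n → coeff p n ≈ coeff q n
    ; _+_     = addPoly
    ; _*_     = mulPoly
    ; -_      = map (-_)
    ; 0#      = []
    ; 1#      = 1# ∷ []
    }

  eval : Poly → Carrier → Carrier
  eval p x = foldr (λ a v → a + x * v) 0# p

  sumOf : List Carrier → Carrier
  sumOf = foldr _+_ 0#

  productOf : List Carrier → Carrier
  productOf = foldr _*_ 1#

  open RawSemiringDefs rawSemiring public using () renaming (_^_ to power)

  cauchyProduct : (ℕ → Carrier) → (ℕ → Carrier) → ℕ → Carrier
  cauchyProduct f g n = sumOf (map (λ k → f k * g (n ∸ k)) (upTo (suc n)))

ℤ[q] : RawRing 0ℓ 0ℓ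
ℤ[q] = polyRing ℤ.+-*-rawRing

ℤ[q][t] : RawRing 0ℓ 0ℓ
ℤ[q][t] = polyRing ℤ[q]

ℤ[t] : RawRing 0ℓ 0ℓ
ℤ[t] = polyRing ℤ.+-*-rawRing

q^ : ℕ → RawRing.Carrier ℤ[q]
q^ n = power ℤ[q] (+ 0 ∷ + 1 ∷ []) n

atq=1 : RawRing.Carrier ℤ[q][t] → RawRing.Carrier ℤ[t]
atq=1 = map (λ a → eval ℤ.+-*-rawRing a (+ 1))

record GradedPoset : Set₁ where
  infix 4 _≤_ _⋖_
  field
    Carrier           : Set
    _≤_               : Rel Carrier 0ℓ
    isDecPartialOrder : IsDecPartialOrder _≡_ _≤_
    elements          : List Carrier
    complete          : ∀ x → x ∈ elements
    unique            : Unique elements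
    top               : Carrier
    maximum           : Maximum _≤_ top
    ρ                 : Carrier → ℕ

  open IsDecPartialOrder isDecPartialOrder public using (_≤?_)

  _⋖_ : Rel Carrier 0ℓ
  x ⋖ y = (x ≤ y × x ≢ y) × (∀ z → x ≤ z → z ≤ y → z ≡ x ⊎ z ≡ y)

  field
    graded : ∀ {x y} → x ⋖ y → ρ y ≡ suc (ρ x)

module _ (P : GradedPoset) where
  open GradedPoset P

  maxRank : ℕ
  maxRank = foldr ℕ._⊔_ 0 (map ρ elements)

  tuples : ℕ → List (List Carrier)
  tuples zero    = [] ∷ []
  tuples (suc m) = cartesianProductWith _∷_ elements (tuples m)

  weakChains : ℕ → List (List Carrier)
  weakChains m = filter (linked? _≤?_) (tuples m)

  A[_] : ℕ → RawRing.Carrier ℤ[q]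
  A[ m ] = sumOf ℤ[q] (map (λ xs → q^ (sum (map ρ xs))) (weakChains m))

  -- ∏_{a=0}^{H} (1 - q^a t)
  denominator : RawRing.Carrier ℤ[q][t]
  denominator = productOf ℤ[q][t] (map (λ a → 1# ∷ (- q^ a) ∷ []) (upTo (suc maxRank)))
    where open RawRing ℤ[q]

  -- The defining identity, multiplied out in ℤ[q][[t]]; the denominator has
  -- constant term 1, hence is invertible there.
  IsNumerator : RawRing.Carrier ℤ[q][t] → Set
  IsNumerator h = ∀ n → cauchyProduct ℤ[q] A[_] (coeff ℤ[q] denominator) n ≈ coeff ℤ[q] h n
    where open RawRing ℤ[q]

module _ (r s : ℕ) where
  InTrapezoid : ℕ → ℕ → Set
  InTrapezoid i c = 1 ℕ.≤ i × i ℕ.≤ r × i ℕ.≤ c × c ℕ.≤ s ∸ i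

  record Trapezoid : Set where
    constructor ⟨_,_∣_⟩
    field
      row    : ℕ
      col    : ℕ
      inside : InTrapezoid row col

  open Trapezoid

  _⊑_ : Rel Trapezoid 0ℓ
  x ⊑ y = row x ℕ.≥ row y × col x ℕ.≤ col y

  rankT : Trapezoid → ℕ
  rankT x = col x ∸ row x

  InTrapezoid? : ∀ i c → Dec (InTrapezoid i c)
  InTrapezoid? i c = (1 ℕₚ.≤? i) ×-dec (i ℕₚ.≤? r) ×-dec (i ℕₚ.≤? c) ×-dec (c ℕₚ.≤? (s ∸ i))

  toTrapezoid : ℕ × ℕ → Maybe Trapezoid
  toTrapezoid (i , c) = Maybe.map (λ v → ⟨ i , c ∣ v ⟩) (dec⇒maybe (InTrapezoid? i c))

  listT : List Trapezoid
  listT = mapMaybe toTrapezoid (cartesianProduct (upTo (suc r)) (upTo (suc s)))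

  InTrapezoid-irrelevant : ∀ {i c} (v w : InTrapezoid i c) → v ≡ w
  InTrapezoid-irrelevant (a , b , c , d) (a′ , b′ , c′ , d′) =
    cong₂ _,_ (irr a a′) (cong₂ _,_ (irr b b′) (cong₂ _,_ (irr c c′) (irr d d′)))
    where irr = ℕₚ.≤-irrelevant

  Trapezoid-≡ : ∀ {x y} → row x ≡ row y → col x ≡ col y → x ≡ y
  Trapezoid-≡ {⟨ i , c ∣ v ⟩} {⟨ _ , _ ∣ w ⟩} refl refl =
    cong (λ u → ⟨ i , c ∣ u ⟩) (InTrapezoid-irrelevant v w)

  toTrapezoid-complete : ∀ x → toTrapezoid (row x , col x) ≡ just x
  toTrapezoid-complete x with InTrapezoid? (row x) (col x)
  ... | yes v = cong just (Trapezoid-≡ refl refl)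
  ... | no ¬v = ⊥-elim (¬v (inside x))

  toTrapezoid-sound : ∀ p {x} → toTrapezoid p ≡ just x → p ≡ (row x , col x)
  toTrapezoid-sound (i , c) eq with InTrapezoid? i c
  toTrapezoid-sound (i , c) refl | yes v = refl

  ∈-listT : ∀ x → x ∈ listT
  ∈-listT x@(⟨ i , c ∣ _ , i≤r , _ , c≤s∸i ⟩) =
    go _ (∈-cartesianProduct⁺ (∈-upTo⁺ (s≤s i≤r)) (∈-upTo⁺ (s≤s (ℕₚ.≤-trans c≤s∸i (ℕₚ.m∸n≤m s i)))))
    where
    go : ∀ ps → (i , c) ∈ ps → x ∈ mapMaybe toTrapezoid ps
    go (p ∷ ps) (here refl) rewrite toTrapezoid-complete x = here refl
    go (p ∷ ps) (there ∈ps) with toTrapezoid p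
    ... | just _  = there (go ps ∈ps)
    ... | nothing = go ps ∈ps

  unique-listT : Unique listT
  unique-listT = go _ (cartesianProduct⁺ (upTo⁺ (suc r)) (upTo⁺ (suc s)))
    where
    fresh : ∀ {p x} ps → toTrapezoid p ≡ just x → All (p ≢_) ps → All (x ≢_) (mapMaybe toTrapezoid ps)
    fresh []       eq []         = []
    fresh (p′ ∷ ps) eq (p≢ ∷ all) with toTrapezoid p′ in eq′
    ... | nothing = fresh ps eq all
    ... | just x′ =
      (λ { refl → p≢ (trans (toTrapezoid-sound _ eq) (sym (toTrapezoid-sound p′ eq′))) }) ∷ fresh ps eq all

    go : ∀ ps → Unique ps → Unique (mapMaybe toTrapezoid ps)
    go []       []        = []
    go (p ∷ ps) (p∉ ∷ u) with toTrapezoid p in eq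
    ... | nothing = go ps u
    ... | just x  = fresh ps eq p∉ ∷ go ps u

  ⊑-isDecPartialOrder : IsDecPartialOrder _≡_ _⊑_
  ⊑-isDecPartialOrder = record
    { isPartialOrder = record
      { isPreorder = record
        { isEquivalence = isEquivalence
        ; reflexive     = λ { refl → ℕₚ.≤-refl , ℕₚ.≤-refl }
        ; trans         = λ { (a , b) (a′ , b′) → ℕₚ.≤-trans a′ a , ℕₚ.≤-trans b b′ }
        }
      ; antisym = λ { (a , b) (a′ , b′) → Trapezoid-≡ (ℕₚ.≤-antisym a′ a) (ℕₚ.≤-antisym b b′) }
      }
    ; _≟_  = λ x y → map′ (λ { (e , f) → Trapezoid-≡ e f }) (λ { refl → refl , refl })
                          ((row x ℕₚ.≟ row y) ×-dec (col x ℕₚ.≟ col y))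
    ; _≤?_ = λ x y → (row y ℕₚ.≤? row x) ×-dec (col x ℕₚ.≤? col y)
    }

  rankT-graded : ∀ {x y} → (x ⊑ y × x ≢ y) × (∀ z → x ⊑ z → z ⊑ y → z ≡ x ⊎ z ≡ y) →
                 rankT y ≡ suc (rankT x)
  rankT-graded {x@(⟨ i , c ∣ 1≤i , i≤r , i≤c , c≤s∸i ⟩)} {y@(⟨ j , d ∣ 1≤j , j≤r , j≤d , d≤s∸j ⟩)}
               (((j≤i , c≤d) , x≢y) , between) with ℕₚ.m≤n⇒m<n∨m≡n j≤i
  ... | inj₂ refl with ℕₚ.m≤n⇒m<n∨m≡n c≤d
  ...   | inj₂ refl = ⊥-elim (x≢y (Trapezoid-≡ refl refl))
  ...   | inj₁ c<d = step (between z (ℕₚ.≤-refl , ℕₚ.n≤1+n c) (ℕₚ.≤-refl , c<d))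
    where
    z : Trapezoid
    z = ⟨ i , suc c ∣ 1≤i , i≤r , ℕₚ.m≤n⇒m≤1+n i≤c , ℕₚ.≤-trans c<d d≤s∸j ⟩
    step : z ≡ x ⊎ z ≡ y → d ∸ i ≡ suc (c ∸ i)
    step (inj₁ e) = ⊥-elim (ℕₚ.1+n≢n (cong col e))
    step (inj₂ e) = trans (cong (_∸ i) (sym (cong col e))) (ℕₚ.+-∸-assoc 1 i≤c)
  rankT-graded {x@(⟨ suc i , c ∣ 1≤i , i≤r , i≤c , c≤s∸i ⟩)} {y@(⟨ j , d ∣ 1≤j , j≤r , j≤d , d≤s∸j ⟩)}
               (((j≤i , c≤d) , x≢y) , between) | inj₁ (s≤s j≤i′) =
    step (between z (ℕₚ.n≤1+n i , ℕₚ.≤-refl) (j≤i′ , c≤d))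
    where
    z : Trapezoid
    z = ⟨ i , c ∣ ℕₚ.≤-trans 1≤j j≤i′ , ℕₚ.≤-trans (ℕₚ.n≤1+n i) i≤r , ℕₚ.≤-trans (ℕₚ.n≤1+n i) i≤c
               , ℕₚ.≤-trans c≤s∸i (ℕₚ.∸-monoʳ-≤ s (ℕₚ.n≤1+n i)) ⟩
    step : z ≡ x ⊎ z ≡ y → d ∸ j ≡ suc (c ∸ suc i)
    step (inj₁ e) = ⊥-elim (ℕₚ.1+n≢n (sym (cong row e)))
    step (inj₂ e) = trans (cong₂ _∸_ (sym (cong col e)) (sym (cong row e))) (ℕₚ.+-∸-assoc 1 i≤c)

  trapezoidal : 2 ℕ.≤ 2 ℕ.* r → 2 ℕ.* r ℕ.≤ s → GradedPoset
  trapezoidal 2≤2r 2r≤s = record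
    { Carrier           = Trapezoid
    ; _≤_               = _⊑_
    ; isDecPartialOrder = ⊑-isDecPartialOrder
    ; elements          = listT
    ; complete          = ∈-listT
    ; unique            = unique-listT
    ; top               = ⟨ 1 , s ∸ 1 ∣ ℕₚ.≤-refl , 1≤r , ℕₚ.∸-monoˡ-≤ 1 (ℕₚ.≤-trans 2≤2r 2r≤s) , ℕₚ.≤-refl ⟩
    ; maximum           = λ { ⟨ i , c ∣ 1≤i , _ , _ , c≤s∸i ⟩ →
                              1≤i , ℕₚ.≤-trans c≤s∸i (ℕₚ.∸-monoʳ-≤ s 1≤i) }
    ; ρ                 = rankT
    ; graded            = rankT-graded
    }
    where
    1≤r : 1 ℕ.≤ r
    1≤r = ℕₚ.*-cancelˡ-≤ 2 2≤2r

-- A real number is a Cauchy sequence of rationals; the modulus of convergence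
-- is part of the data.
record ℝ : Set where
  constructor mkℝ
  field
    seq    : ℕ → ℚ
    cauchy : ∀ ε → 0ℚ ℚ.< ε → ∃[ N ] ∀ m n → N ℕ.≤ m → N ℕ.≤ n → ∣ seq m ℚ.- seq n ∣ ℚ.< ε

open ℝ public

infix 4 _≃_ _<ℝ_ _#_

_≃_ : Rel ℝ 0ℓ
x ≃ y = ∀ ε → 0ℚ ℚ.< ε → ∃[ N ] ∀ n → N ℕ.≤ n → ∣ seq x n ℚ.- seq y n ∣ ℚ.< ε

-- The gap ε must be uniform in n.
_<ℝ_ : Rel ℝ 0ℓ
x <ℝ y = ∃[ ε ] 0ℚ ℚ.< ε × ∃[ N ] ∀ n → N ℕ.≤ n → seq x n ℚ.+ ε ℚ.< seq y n

-- Apartness, the constructive form of x ≠ y.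
_#_ : Rel ℝ 0ℓ
x # y = x <ℝ y ⊎ y <ℝ x

open CommutativeSemigroupProperties (CommutativeMonoid.commutativeSemigroup ℚₚ.+-0-commutativeMonoid)
  using (interchange)

half-pos : ∀ {ε} → 0ℚ ℚ.< ε → 0ℚ ℚ.< ½ ℚ.* ε
half-pos {ε} 0<ε = subst (ℚ._< ½ ℚ.* ε) (ℚₚ.*-zeroʳ ½) (ℚₚ.*-monoʳ-<-pos ½ 0<ε)

halves : ∀ ε → ½ ℚ.* ε ℚ.+ ½ ℚ.* ε ≡ ε
halves ε = trans (sym (ℚₚ.*-distribʳ-+ ε ½ ½)) (ℚₚ.*-identityˡ ε)

0≤∣_∣ : ∀ p → 0ℚ ℚ.≤ ∣ p ∣
0≤∣ p ∣ = ℚₚ.0≤∣p∣ p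

constℝ : ℚ → ℝ
constℝ p .seq    _     = p
constℝ p .cauchy ε 0<ε = 0 , λ _ _ _ _ → subst (λ z → ∣ z ∣ ℚ.< ε) (sym (ℚₚ.+-inverseʳ p)) 0<ε

negℝ : ℝ → ℝ
negℝ x .seq n = ℚ.- seq x n
negℝ x .cauchy ε 0<ε with cauchy x ε 0<ε
... | N , close = N , λ m n N≤m N≤n →
  subst (ℚ._< ε) (trans (sym (ℚₚ.∣-p∣≡∣p∣ _)) (cong ∣_∣ (ℚₚ.neg-distrib-+ (seq x m) (ℚ.- seq x n)))) (close m n N≤m N≤n)

addℝ : ℝ → ℝ → ℝ
addℝ x y .seq n = seq x n ℚ.+ seq y n
addℝ x y .cauchy ε 0<ε with cauchy x _ (half-pos 0<ε) | cauchy y _ (half-pos 0<ε)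
... | M , closeˣ | N , closeʸ = M ℕ.⊔ N , λ m n ≤m ≤n → let
    a = seq x m ; b = seq x n ; c = seq y m ; d = seq y n
    open ℚₚ.≤-Reasoning
  in begin-strict
    ∣ (a ℚ.+ c) ℚ.- (b ℚ.+ d) ∣     ≡⟨ cong ∣_∣ (rearrange a b c d) ⟩
    ∣ (a ℚ.- b) ℚ.+ (c ℚ.- d) ∣     ≤⟨ ℚₚ.∣p+q∣≤∣p∣+∣q∣ (a ℚ.- b) (c ℚ.- d) ⟩
    ∣ a ℚ.- b ∣ ℚ.+ ∣ c ℚ.- d ∣     <⟨ ℚₚ.+-mono-< (closeˣ m n (ℕₚ.m⊔n≤o⇒m≤o M N ≤m) (ℕₚ.m⊔n≤o⇒m≤o M N ≤n))
                                                  (closeʸ m n (ℕₚ.m⊔n≤o⇒n≤o M N ≤m) (ℕₚ.m⊔n≤o⇒n≤o M N ≤n)) ⟩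
    ½ ℚ.* ε ℚ.+ ½ ℚ.* ε             ≡⟨ halves ε ⟩
    ε                               ∎
  where
  rearrange : ∀ a b c d → (a ℚ.+ c) ℚ.- (b ℚ.+ d) ≡ (a ℚ.- b) ℚ.+ (c ℚ.- d)
  rearrange a b c d = trans (cong (a ℚ.+ c ℚ.+_) (ℚₚ.neg-distrib-+ b d)) (interchange a c (ℚ.- b) (ℚ.- d))

bounded : ∀ x → ∃[ K ] 0ℚ ℚ.< K × ∃[ N ] ∀ n → N ℕ.≤ n → ∣ seq x n ∣ ℚ.≤ K
bounded x with cauchy x 1ℚ (ℚₚ.positive⁻¹ 1ℚ)
... | N , close = 1ℚ ℚ.+ ∣ seq x N ∣ , ℚₚ.+-mono-<-≤ (ℚₚ.positive⁻¹ 1ℚ) 0≤∣ seq x N ∣ , N , λ n N≤n → let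
    a = seq x n ; b = seq x N
    open ℚₚ.≤-Reasoning
  in begin
    ∣ a ∣                   ≡⟨ cong ∣_∣ (split a b) ⟩
    ∣ (a ℚ.- b) ℚ.+ b ∣     ≤⟨ ℚₚ.∣p+q∣≤∣p∣+∣q∣ (a ℚ.- b) b ⟩
    ∣ a ℚ.- b ∣ ℚ.+ ∣ b ∣   ≤⟨ ℚₚ.+-monoˡ-≤ ∣ b ∣ (ℚₚ.<⇒≤ (close n N N≤n ℕₚ.≤-refl)) ⟩
    1ℚ ℚ.+ ∣ b ∣            ∎
  where
  split : ∀ a b → a ≡ (a ℚ.- b) ℚ.+ b
  split a b = sym (trans (ℚₚ.+-assoc a (ℚ.- b) b)
                         (trans (cong (a ℚ.+_) (ℚₚ.+-inverseˡ b)) (ℚₚ.+-identityʳ a)))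

shrink : ∀ K ε → 0ℚ ℚ.< K → 0ℚ ℚ.< ε → ∃[ δ ] 0ℚ ℚ.< δ × K ℚ.* δ ≡ ½ ℚ.* ε
shrink K ε 0<K 0<ε = δ , 0<δ , eq
  where
  instance
    posK : ℚ.Positive K
    posK = ℚ.positive 0<K
    nzK : ℚ.NonZero K
    nzK = ℚₚ.pos⇒nonZero K
    posK⁻¹ : ℚ.Positive (ℚ.1/ K)
    posK⁻¹ = ℚₚ.1/pos⇒pos K
  δ = ℚ.1/ K ℚ.* (½ ℚ.* ε)
  0<δ : 0ℚ ℚ.< δ
  0<δ = subst (ℚ._< δ) (ℚₚ.*-zeroʳ (ℚ.1/ K)) (ℚₚ.*-monoʳ-<-pos (ℚ.1/ K) (half-pos 0<ε))
  eq : K ℚ.* δ ≡ ½ ℚ.* ε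
  eq = trans (sym (ℚₚ.*-assoc K (ℚ.1/ K) _))
             (trans (cong (ℚ._* (½ ℚ.* ε)) (ℚₚ.*-inverseʳ K)) (ℚₚ.*-identityˡ _))

mul-bound : ∀ {K δ} a b → 0ℚ ℚ.< K → ∣ a ∣ ℚ.≤ K → ∣ b ∣ ℚ.< δ → ∣ a ℚ.* b ∣ ℚ.< K ℚ.* δ
mul-bound {K} {δ} a b 0<K ∣a∣≤K ∣b∣<δ = begin-strict
  ∣ a ℚ.* b ∣         ≡⟨ ℚₚ.∣p*q∣≡∣p∣*∣q∣ a b ⟩
  ∣ a ∣ ℚ.* ∣ b ∣     ≤⟨ ℚₚ.*-monoʳ-≤-nonNeg ∣ b ∣ {{ℚₚ.∣-∣-nonNeg b}} ∣a∣≤K ⟩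
  K ℚ.* ∣ b ∣         <⟨ ℚₚ.*-monoʳ-<-pos K {{ℚ.positive 0<K}} ∣b∣<δ ⟩
  K ℚ.* δ             ∎
  where open ℚₚ.≤-Reasoning

mulℝ : ℝ → ℝ → ℝ
mulℝ x y .seq n = seq x n ℚ.* seq y n
mulℝ x y .cauchy ε 0<ε with bounded x | bounded y
... | K , 0<K , M₁ , ∣x∣≤K | L , 0<L , M₂ , ∣y∣≤L with shrink K ε 0<K 0<ε | shrink L ε 0<L 0<ε
... | δ , 0<δ , Kδ≡ | η , 0<η , Lη≡ with cauchy y δ 0<δ | cauchy x η 0<η
... | N₁ , closeʸ | N₂ , closeˣ = (M₁ ℕ.⊔ M₂) ℕ.⊔ (N₁ ℕ.⊔ N₂) , λ m n ≤m ≤n → let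
    a = seq x m ; b = seq x n ; c = seq y m ; d = seq y n
    ≤mM = ℕₚ.m⊔n≤o⇒m≤o (M₁ ℕ.⊔ M₂) (N₁ ℕ.⊔ N₂) ≤m
    ≤nM = ℕₚ.m⊔n≤o⇒m≤o (M₁ ℕ.⊔ M₂) (N₁ ℕ.⊔ N₂) ≤n
    ≤mN = ℕₚ.m⊔n≤o⇒n≤o (M₁ ℕ.⊔ M₂) (N₁ ℕ.⊔ N₂) ≤m
    ≤nN = ℕₚ.m⊔n≤o⇒n≤o (M₁ ℕ.⊔ M₂) (N₁ ℕ.⊔ N₂) ≤n
    open ℚₚ.≤-Reasoning
  in begin-strict
    ∣ a ℚ.* c ℚ.- b ℚ.* d ∣                             ≡⟨ cong ∣_∣ (rearrange a b c d) ⟩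
    ∣ a ℚ.* (c ℚ.- d) ℚ.+ d ℚ.* (a ℚ.- b) ∣             ≤⟨ ℚₚ.∣p+q∣≤∣p∣+∣q∣ (a ℚ.* (c ℚ.- d)) (d ℚ.* (a ℚ.- b)) ⟩
    ∣ a ℚ.* (c ℚ.- d) ∣ ℚ.+ ∣ d ℚ.* (a ℚ.- b) ∣         <⟨ ℚₚ.+-mono-<
        (mul-bound a (c ℚ.- d) 0<K (∣x∣≤K m (ℕₚ.m⊔n≤o⇒m≤o M₁ M₂ ≤mM))
          (closeʸ m n (ℕₚ.m⊔n≤o⇒m≤o N₁ N₂ ≤mN) (ℕₚ.m⊔n≤o⇒m≤o N₁ N₂ ≤nN)))
        (mul-bound d (a ℚ.- b) 0<L (∣y∣≤L n (ℕₚ.m⊔n≤o⇒n≤o M₁ M₂ ≤nM))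
          (closeˣ m n (ℕₚ.m⊔n≤o⇒n≤o N₁ N₂ ≤mN) (ℕₚ.m⊔n≤o⇒n≤o N₁ N₂ ≤nN))) ⟩
    K ℚ.* δ ℚ.+ L ℚ.* η                                 ≡⟨ cong₂ ℚ._+_ Kδ≡ Lη≡ ⟩
    ½ ℚ.* ε ℚ.+ ½ ℚ.* ε                                 ≡⟨ halves ε ⟩
    ε                                                   ∎
  where
  rearrange : ∀ a b c d → a ℚ.* c ℚ.- b ℚ.* d ≡ a ℚ.* (c ℚ.- d) ℚ.+ d ℚ.* (a ℚ.- b)
  rearrange a b c d = sym (begin
    a ℚ.* (c ℚ.- d) ℚ.+ d ℚ.* (a ℚ.- b)                   ≡⟨ cong₂ ℚ._+_ (expand a c d) (expand d a b) ⟩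
    (a ℚ.* c ℚ.- a ℚ.* d) ℚ.+ (d ℚ.* a ℚ.- d ℚ.* b)       ≡⟨ ℚₚ.+-assoc (a ℚ.* c) (ℚ.- (a ℚ.* d)) _ ⟩
    a ℚ.* c ℚ.+ (ℚ.- (a ℚ.* d) ℚ.+ (d ℚ.* a ℚ.- d ℚ.* b)) ≡⟨ cong (a ℚ.* c ℚ.+_) (cancel (ℚₚ.*-comm d a) (ℚₚ.*-comm d b)) ⟩
    a ℚ.* c ℚ.- b ℚ.* d                                   ∎)
    where
    open ≡-Reasoning
    expand : ∀ x y z → x ℚ.* (y ℚ.- z) ≡ x ℚ.* y ℚ.- x ℚ.* z
    expand x y z = trans (ℚₚ.*-distribˡ-+ x y (ℚ.- z)) (cong (x ℚ.* y ℚ.+_) (sym (ℚₚ.neg-distribʳ-* x z)))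
    cancel : ∀ {w x y z} → w ≡ x → y ≡ z → ℚ.- x ℚ.+ (w ℚ.- y) ≡ ℚ.- z
    cancel {w} {_} {y} refl refl = trans (sym (ℚₚ.+-assoc (ℚ.- w) w (ℚ.- y)))
      (trans (cong (ℚ._- y) (ℚₚ.+-inverseˡ w)) (ℚₚ.+-identityˡ (ℚ.- y)))

ℝ-ring : RawRing 0ℓ 0ℓ
ℝ-ring = record
  { Carrier = ℝ
  ; _≈_     = _≃_
  ; _+_     = addℝ
  ; _*_     = mulℝ
  ; -_      = negℝ
  ; 0#      = constℝ 0ℚ
  ; 1#      = constℝ 1ℚ
  }

ℝ[t] : RawRing 0ℓ 0ℓ
ℝ[t] = polyRing ℝ-ring

ℤ→ℚ : ℤ → ℚ
ℤ→ℚ z = z ℚ./ 1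

ℤ[t]→ℝ[t] : RawRing.Carrier ℤ[t] → RawRing.Carrier ℝ[t]
ℤ[t]→ℝ[t] = map (constℝ ∘ ℤ→ℚ)

-- p = lead · ∏ (t - z) in ℝ[t], with lead ≠ 0 and pairwise distinct negative
-- z: all zeros of p, counted with multiplicity, are real, and each of them is
-- negative and simple.
record RealRootedSimpleNegative (p : RawRing.Carrier ℝ[t]) : Set where
  open RawRing ℝ[t]
  field
    lead          : ℝ
    zeros         : List ℝ
    lead-nonzero  : lead # constℝ 0ℚ
    factorisation : p ≈ (lead ∷ []) * productOf ℝ[t] (map (λ z → negℝ z ∷ constℝ 1ℚ ∷ []) zeros)
    simple        : AllPairs _#_ zeros
    negative      : All (_<ℝ constℝ 0ℚ) zeros

ℕ→ℚ : ℕ → ℚ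
ℕ→ℚ n = ℤ→ℚ (+ n)

ℚ[x] : RawRing 0ℓ 0ℓ
ℚ[x] = polyRing ℚ.+-*-rawRing

-- (a)_n = a (a+1) ⋯ (a+n-1)
rising : ℚ → ℕ → ℚ
rising a zero    = 1ℚ
rising a (suc n) = rising a n ℚ.* (a ℚ.+ ℕ→ℚ n)

-- P_n^{(α,β)}(x) = (α+1)_n / n! · ₂F₁(-n, n+α+β+1; α+1; (1-x)/2)
--   = ∑_{k=0}^{n} (n+α+β+1)_k (α+k+1)_{n-k} / (k! (n-k)!) · ((x-1)/2)^k.
-- The second form needs no division by (α+1)_k.  At x = 1 only the term k = 0
-- survives, giving (α+1)_n / n! = binom(n+α, n).
jacobi : ℕ → ℚ → ℚ → RawRing.Carrier ℚ[x]
jacobi n α β = sumOf ℚ[x] (map term (upTo (suc n)))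
  where
  open RawRing ℚ[x]

  coefficient : ℕ → ℚ
  coefficient k =
    rising (ℕ→ℚ n ℚ.+ α ℚ.+ β ℚ.+ 1ℚ) k ℚ.* rising (α ℚ.+ ℕ→ℚ k ℚ.+ 1ℚ) (n ∸ k)
      ℚ.* ((+ 1) ℚ./ (k ! ℕ.* (n ∸ k) !)) {{k ℕₚ.!* (n ∸ k) !≢0}}

  term : ℕ → Carrier
  term k = (coefficient k ∷ []) * power ℚ[x] (ℚ.- ½ ∷ ½ ∷ []) k

evalℝ : RawRing.Carrier ℚ[x] → ℝ → ℝ
evalℝ p = eval ℝ-ring (map constℝ p)

{-# OPTIONS --safe #-}

-- Splitting a weak chain at its first element, Σ_m A_m t^m = 1 + Σ_x F_x with
-- (1 - q^ρ(x) t) F_x = q^ρ(x) t (1 + Σ_{y > x} F_y).  As ρ increases strictly,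
-- downward induction on the rank shows that ∏_a (1 - q^a t) turns every F_x into
-- a polynomial.
--
-- At q = 1 the number of weak chains in T_{r,s} starting at a given point is a
-- difference of two products of binomials.  Its sums over rows and columns
-- telescope, the row sums being antisymmetric in the row and the reversed column, so
-- that A_m(1) = C(A+m, m) C(B+m, m).  This sequence, the numerator Σ C(A,k) C(B,k) t^k and
-- the Jacobi expansion Σ C(A,k) C(B+k,k) t^k (1-t)^(A-k) all satisfy
-- the recurrence X(A+1,B+1) = X(A,B+1) + X(A+1,B) - (1-t) X(A,B), up to the factor
-- (1-t)^(A+B+1).
--
-- For h_A = Σ C(A,k) C(B,k) t^k one has
-- (A+1) h_{A+1} = (A+1+Bt) h_A + t (1-t) h_A'.  Hence h_{A+1} changes sign
-- between consecutive zeros of h_A, and also to the right and to the left of all of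
-- them: by induction all zeros are real, simple and negative.  They are computed by
-- bisection between rational points of opposite sign.

module Submission where

open import Defs
open import Algebra.Bundles using (CommutativeRing)
open import Algebra.Bundles.Raw using (RawRing)
import Algebra.Properties.Ring as RingProperties
import Algebra.Solver.Ring.NaturalCoefficients.Default as NatSolver
open import Data.Empty using (⊥-elim)
import Data.Integer.Properties as ℤₚ
open import Data.List.Base
  using ([]; _∷_; map; applyUpTo; length; List; foldr; upTo; _++_; filter; cartesianProductWith; replicate; cartesianProduct; mapMaybe)
open import Data.List.Membership.Propositional using (_∈_)
open import Data.List.Properties
  using (map-applyUpTo; filter-++; map-++; map-∘; applyUpTo-∷ʳ; map-cong; length-upTo; length-applyUpTo; length-map; length-++)
open import Data.List.Relation.Unary.All as All using (All; []; _∷_)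
import Data.List.Relation.Unary.All.Properties as Allₚ
open import Data.List.Relation.Unary.AllPairs as AllPairs using ([]; _∷_; AllPairs)
import Data.List.Relation.Unary.AllPairs.Properties as AllPairsₚ
open import Data.List.Relation.Unary.Any using (here; there)
open import Data.Maybe.Base using (Maybe; just; nothing; maybe′)
open import Data.Nat.Base as ℕ using (ℕ; zero; suc; s≤s; z≤n; _⊔_; pred; _∸_; _!; NonZero)
open import Data.Nat.ListAction using (sum)
import Data.Nat.Properties as ℕₚ
open import Data.Product.Base using (_,_; ∃-syntax; proj₁; proj₂; _×_)
open import Data.Sum.Base as Sum using (inj₁; inj₂)
open import Function.Base using (_∘_)
open import Level using (0ℓ)
import Relation.Binary.Reasoning.Setoid as SetoidReasoning
open import Relation.Binary.Structures using (IsDecPartialOrder)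
open import Relation.Nullary using (yes; no; ¬_; ¬?; Dec; does)

-- The order of the constructive reals is undecidable, so no sign can be tested at a zero of h_A.
-- What can be proved there is a strict inequality with a positive rational margin, and it passes to
-- all late rational approximations of that zero. Hence the zeros of h_{A+1} are bracketed by such
-- approximations, together with 0 and a rational point far to the left, and bisection tests
-- rational values only. For the same reason distinct zeros are apart: a difference of apart reals
-- can be cancelled, and this is all that the factor theorem asks for.
--
-- The sign of h_A' at a zero z comes from the factorisation of h_A, as the leading coefficient
-- times the product of the differences z - z' to the other zeros. The hypothesis 2r ≤ s says A ≤ B,
-- so the leading coefficient C(B,A) is at least 1.
--
-- The count of chains is shaped so that the induction on their length closes: summing the row sums
-- over the rows reproduces the same expression for chains with one more element.

-- Coefficient lists as a commutative ring; evaluation and synthetic division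

module PolynomialRing where

  open import Relation.Binary.PropositionalEquality as ≡ using (_≡_)

  module PolyProperties (R : CommutativeRing 0ℓ 0ℓ) where
    open CommutativeRing R hiding (zero; sym; trans)
    open CommutativeRing R public using (sym; trans)
    open RingProperties ring using (-0#≈0#)
    open SetoidReasoning setoid
    open NatSolver commutativeSemiring using (solve; _:=_; _:+_; _:*_)

    R₀ : RawRing 0ℓ 0ℓ
    R₀ = rawRing

    private
      P = Poly R₀
      co = coeff R₀
      add = addPoly R₀
      mul = mulPoly R₀

    infix 4 _≋_
    _≋_ : P → P → Set
    p ≋ q = ∀ n → co p n ≈ co q n

    coeff-add : ∀ p q n → co (add p q) n ≈ co p n + co q n
    coeff-add []      q       n       = sym (+-identityˡ _)
    coeff-add (a ∷ p) []      n       = sym (+-identityʳ _)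
    coeff-add (a ∷ p) (b ∷ q) zero    = refl
    coeff-add (a ∷ p) (b ∷ q) (suc n) = coeff-add p q n

    coeff-scale : ∀ a p n → co (map (a *_) p) n ≈ a * co p n
    coeff-scale a []      n       = sym (zeroʳ a)
    coeff-scale a (b ∷ p) zero    = refl
    coeff-scale a (b ∷ p) (suc n) = coeff-scale a p n

    coeff-neg : ∀ p n → co (map (-_) p) n ≈ - co p n
    coeff-neg []      n       = sym -0#≈0#
    coeff-neg (a ∷ p) zero    = refl
    coeff-neg (a ∷ p) (suc n) = coeff-neg p n

    coeff-mul-zero : ∀ a p q → co (mul (a ∷ p) q) 0 ≈ a * co q 0
    coeff-mul-zero a p q = begin
      co (add (map (a *_) q) (0# ∷ mul p q)) 0  ≈⟨ coeff-add (map (a *_) q) _ 0 ⟩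
      co (map (a *_) q) 0 + 0#  ≈⟨ +-identityʳ _ ⟩
      co (map (a *_) q) 0  ≈⟨ coeff-scale a q 0 ⟩
      a * co q 0  ∎

    coeff-mul-suc : ∀ a p q n → co (mul (a ∷ p) q) (suc n) ≈ a * co q (suc n) + co (mul p q) n
    coeff-mul-suc a p q n = begin
      co (add (map (a *_) q) (0# ∷ mul p q)) (suc n)  ≈⟨ coeff-add (map (a *_) q) _ (suc n) ⟩
      co (map (a *_) q) (suc n) + co (mul p q) n  ≈⟨ +-congʳ (coeff-scale a q (suc n)) ⟩
      a * co q (suc n) + co (mul p q) n  ∎

    coeff-linear : ∀ c q n → co (mul (1# ∷ c ∷ []) q) (suc n) ≈ co q (suc n) + c * co q n
    coeff-linear c q n = trans (coeff-mul-suc 1# (c ∷ []) q n) (+-cong (*-identityˡ _) (lemma n))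
      where
      lemma : ∀ n → co (mul (c ∷ []) q) n ≈ c * co q n
      lemma zero    = coeff-mul-zero c [] q
      lemma (suc n) = trans (coeff-mul-suc c [] q n) (+-identityʳ _)

    coeff-const : ∀ c q n → co (mul (c ∷ []) q) n ≈ c * co q n
    coeff-const c q zero    = coeff-mul-zero c [] q
    coeff-const c q (suc n) = trans (coeff-mul-suc c [] q n) (+-identityʳ _)

    mul-zeroˡ : ∀ p q → (∀ n → co p n ≈ 0#) → ∀ n → co (mul p q) n ≈ 0#
    mul-zeroˡ []      q p≈0 n       = refl
    mul-zeroˡ (a ∷ p) q p≈0 zero    = begin
      co (mul (a ∷ p) q) 0  ≈⟨ coeff-mul-zero a p q ⟩
      a * co q 0  ≈⟨ *-congʳ (p≈0 0) ⟩
      0# * co q 0  ≈⟨ zeroˡ _ ⟩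
      0#  ∎
    mul-zeroˡ (a ∷ p) q p≈0 (suc n) = begin
      co (mul (a ∷ p) q) (suc n)  ≈⟨ coeff-mul-suc a p q n ⟩
      a * co q (suc n) + co (mul p q) n  ≈⟨ +-cong (*-congʳ (p≈0 0)) (mul-zeroˡ p q (λ n → p≈0 (suc n)) n) ⟩
      0# * co q (suc n) + 0#  ≈⟨ trans (+-identityʳ _) (zeroˡ _) ⟩
      0#  ∎

    mul-congʳ : ∀ p q q′ → q ≋ q′ → mul p q ≋ mul p q′
    mul-congʳ []      q q′ e n = refl
    mul-congʳ (a ∷ p) q q′ e zero = begin
      co (mul (a ∷ p) q) 0  ≈⟨ coeff-mul-zero a p q ⟩
      a * co q 0  ≈⟨ *-congˡ (e 0) ⟩
      a * co q′ 0  ≈⟨ coeff-mul-zero a p q′ ⟨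
      co (mul (a ∷ p) q′) 0  ∎
    mul-congʳ (a ∷ p) q q′ e (suc n) = begin
      co (mul (a ∷ p) q) (suc n)  ≈⟨ coeff-mul-suc a p q n ⟩
      a * co q (suc n) + co (mul p q) n  ≈⟨ +-cong (*-congˡ (e (suc n))) (mul-congʳ p q q′ e n) ⟩
      a * co q′ (suc n) + co (mul p q′) n  ≈⟨ coeff-mul-suc a p q′ n ⟨
      co (mul (a ∷ p) q′) (suc n)  ∎

    -- `mulPoly` recurses on its left factor. This lemma and the next give the matching recursion on
    -- the right factor, which turns commutativity into an induction on that factor.
    mul-consʳ-zero : ∀ p b q → co (mul p (b ∷ q)) 0 ≈ co p 0 * b
    mul-consʳ-zero []      b q = sym (zeroˡ b)
    mul-consʳ-zero (a ∷ p) b q = coeff-mul-zero a p (b ∷ q)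

    mul-consʳ-suc : ∀ p b q n → co (mul p (b ∷ q)) (suc n) ≈ co p (suc n) * b + co (mul p q) n
    mul-consʳ-suc []      b q n       = sym (trans (+-identityʳ _) (zeroˡ b))
    mul-consʳ-suc (a ∷ p) b q zero    = begin
      co (mul (a ∷ p) (b ∷ q)) 1  ≈⟨ coeff-mul-suc a p (b ∷ q) 0 ⟩
      a * co q 0 + co (mul p (b ∷ q)) 0  ≈⟨ +-cong (coeff-mul-zero a p q) (sym (mul-consʳ-zero p b q)) ⟨
      co (mul (a ∷ p) q) 0 + co p 0 * b  ≈⟨ +-comm _ _ ⟩
      co p 0 * b + co (mul (a ∷ p) q) 0  ∎
    mul-consʳ-suc (a ∷ p) b q (suc n) = begin
      co (mul (a ∷ p) (b ∷ q)) (suc (suc n))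
        ≈⟨ coeff-mul-suc a p (b ∷ q) (suc n) ⟩
      a * co q (suc n) + co (mul p (b ∷ q)) (suc n)
        ≈⟨ +-congˡ (mul-consʳ-suc p b q n) ⟩
      a * co q (suc n) + (co p (suc n) * b + co (mul p q) n)
        ≈⟨ solve 3 (λ x y z → x :+ (y :+ z) := y :+ (x :+ z)) refl _ _ _ ⟩
      co p (suc n) * b + (a * co q (suc n) + co (mul p q) n)
        ≈⟨ +-congˡ (coeff-mul-suc a p q n) ⟨
      co p (suc n) * b + co (mul (a ∷ p) q) (suc n) ∎

    mul-comm : ∀ p q → mul p q ≋ mul q p
    mul-comm p []      n       = lemma p n
      where
      lemma : ∀ p n → co (mul p []) n ≈ 0#
      lemma []      n       = refl
      lemma (a ∷ p) zero    = refl
      lemma (a ∷ p) (suc n) = lemma p n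
    mul-comm p (b ∷ q) zero    = begin
      co (mul p (b ∷ q)) 0  ≈⟨ mul-consʳ-zero p b q ⟩
      co p 0 * b  ≈⟨ *-comm _ b ⟩
      b * co p 0  ≈⟨ coeff-mul-zero b q p ⟨
      co (mul (b ∷ q) p) 0  ∎
    mul-comm p (b ∷ q) (suc n) = begin
      co (mul p (b ∷ q)) (suc n)  ≈⟨ mul-consʳ-suc p b q n ⟩
      co p (suc n) * b + co (mul p q) n  ≈⟨ +-cong (*-comm _ b) (mul-comm p q n) ⟩
      b * co p (suc n) + co (mul q p) n  ≈⟨ coeff-mul-suc b q p n ⟨
      co (mul (b ∷ q) p) (suc n)  ∎

    mul-cong : ∀ p p′ q q′ → p ≋ p′ → q ≋ q′ → mul p q ≋ mul p′ q′
    mul-cong p p′ q q′ e f n = begin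
      co (mul p q) n  ≈⟨ mul-congʳ p q q′ f n ⟩
      co (mul p q′) n  ≈⟨ mul-comm p q′ n ⟩
      co (mul q′ p) n  ≈⟨ mul-congʳ q′ p p′ e n ⟩
      co (mul q′ p′) n  ≈⟨ mul-comm q′ p′ n ⟩
      co (mul p′ q′) n  ∎

    mul-distribˡ : ∀ p q r → mul p (add q r) ≋ add (mul p q) (mul p r)
    mul-distribˡ []      q r n       = refl
    mul-distribˡ (a ∷ p) q r zero    = begin
      co (mul (a ∷ p) (add q r)) 0  ≈⟨ coeff-mul-zero a p (add q r) ⟩
      a * co (add q r) 0  ≈⟨ *-congˡ (coeff-add q r 0) ⟩
      a * (co q 0 + co r 0)  ≈⟨ distribˡ a _ _ ⟩
      a * co q 0 + a * co r 0  ≈⟨ +-cong (coeff-mul-zero a p q) (coeff-mul-zero a p r) ⟨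
      co (mul (a ∷ p) q) 0 + co (mul (a ∷ p) r) 0  ≈⟨ coeff-add (mul (a ∷ p) q) _ 0 ⟨
      co (add (mul (a ∷ p) q) (mul (a ∷ p) r)) 0  ∎
    mul-distribˡ (a ∷ p) q r (suc n) = begin
      co (mul (a ∷ p) (add q r)) (suc n)
        ≈⟨ coeff-mul-suc a p (add q r) n ⟩
      a * co (add q r) (suc n) + co (mul p (add q r)) n
        ≈⟨ +-cong (*-congˡ (coeff-add q r (suc n))) (trans (mul-distribˡ p q r n) (coeff-add (mul p q) _ n)) ⟩
      a * (co q (suc n) + co r (suc n)) + (co (mul p q) n + co (mul p r) n)
        ≈⟨ solve 5 (λ a x y z w → a :* (x :+ y) :+ (z :+ w) := (a :* x :+ z) :+ (a :* y :+ w)) refl _ _ _ _ _ ⟩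
      (a * co q (suc n) + co (mul p q) n) + (a * co r (suc n) + co (mul p r) n)
        ≈⟨ +-cong (coeff-mul-suc a p q n) (coeff-mul-suc a p r n) ⟨
      co (mul (a ∷ p) q) (suc n) + co (mul (a ∷ p) r) (suc n)
        ≈⟨ coeff-add (mul (a ∷ p) q) _ (suc n) ⟨
      co (add (mul (a ∷ p) q) (mul (a ∷ p) r)) (suc n) ∎

    add-cong : ∀ p p′ q q′ → p ≋ p′ → q ≋ q′ → add p q ≋ add p′ q′
    add-cong p p′ q q′ e f n =
      trans (coeff-add p q n) (trans (+-cong (e n) (f n)) (sym (coeff-add p′ q′ n)))

    mul-distribʳ : ∀ p q r → mul (add q r) p ≋ add (mul q p) (mul r p)
    mul-distribʳ p q r n = begin
      co (mul (add q r) p) n  ≈⟨ mul-comm (add q r) p n ⟩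
      co (mul p (add q r)) n  ≈⟨ mul-distribˡ p q r n ⟩
      co (add (mul p q) (mul p r)) n  ≈⟨ add-cong (mul p q) (mul q p) (mul p r) (mul r p) (mul-comm p q) (mul-comm p r) n ⟩
      co (add (mul q p) (mul r p)) n  ∎

    mul-scaleˡ : ∀ a p q n → co (mul (map (a *_) p) q) n ≈ a * co (mul p q) n
    mul-scaleˡ a []      q n       = sym (zeroʳ a)
    mul-scaleˡ a (b ∷ p) q zero    = begin
      co (mul (a * b ∷ map (a *_) p) q) 0  ≈⟨ coeff-mul-zero (a * b) (map (a *_) p) q ⟩
      a * b * co q 0  ≈⟨ *-assoc a b _ ⟩
      a * (b * co q 0)  ≈⟨ *-congˡ (coeff-mul-zero b p q) ⟨
      a * co (mul (b ∷ p) q) 0  ∎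
    mul-scaleˡ a (b ∷ p) q (suc n) = begin
      co (mul (a * b ∷ map (a *_) p) q) (suc n)
        ≈⟨ coeff-mul-suc (a * b) (map (a *_) p) q n ⟩
      a * b * co q (suc n) + co (mul (map (a *_) p) q) n
        ≈⟨ +-congˡ (mul-scaleˡ a p q n) ⟩
      a * b * co q (suc n) + a * co (mul p q) n
        ≈⟨ solve 4 (λ a b x y → a :* b :* x :+ a :* y := a :* (b :* x :+ y)) refl _ _ _ _ ⟩
      a * (b * co q (suc n) + co (mul p q) n)
        ≈⟨ *-congˡ (coeff-mul-suc b p q n) ⟨
      a * co (mul (b ∷ p) q) (suc n) ∎

    mul-assoc : ∀ p q r → mul (mul p q) r ≋ mul p (mul q r)
    mul-assoc []      q r n       = refl
    mul-assoc (a ∷ p) q r n = begin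
      co (mul (add (map (a *_) q) (0# ∷ mul p q)) r) n
        ≈⟨ mul-distribʳ r (map (a *_) q) (0# ∷ mul p q) n ⟩
      co (add (mul (map (a *_) q) r) (mul (0# ∷ mul p q) r)) n
        ≈⟨ coeff-add (mul (map (a *_) q) r) _ n ⟩
      co (mul (map (a *_) q) r) n + co (mul (0# ∷ mul p q) r) n
        ≈⟨ +-cong (mul-scaleˡ a q r n) (shift n) ⟩
      a * co (mul q r) n + co (0# ∷ mul p (mul q r)) n
        ≈⟨ +-congʳ (coeff-scale a (mul q r) n) ⟨
      co (map (a *_) (mul q r)) n + co (0# ∷ mul p (mul q r)) n
        ≈⟨ coeff-add (map (a *_) (mul q r)) _ n ⟨
      co (mul (a ∷ p) (mul q r)) n ∎
      where
      shift : ∀ n → co (mul (0# ∷ mul p q) r) n ≈ co (0# ∷ mul p (mul q r)) n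
      shift zero    = trans (coeff-mul-zero 0# (mul p q) r) (zeroˡ _)
      shift (suc n) = trans (coeff-mul-suc 0# (mul p q) r n)
                            (trans (+-cong (zeroˡ _) (mul-assoc p q r n)) (+-identityˡ _))

    mul-identityˡ : ∀ q → mul (1# ∷ []) q ≋ q
    mul-identityˡ q n = trans (coeff-const 1# q n) (*-identityˡ _)

    polyCommutativeRing : CommutativeRing 0ℓ 0ℓ
    polyCommutativeRing = record
      { RawRing (polyRing R₀)
      ; isCommutativeRing = record
        { isRing = record
          { +-isAbelianGroup = record
            { isGroup = record
              { isMonoid = record
                { isSemigroup = record
                  { isMagma = record
                    { isEquivalence = record
                      { refl = λ n → refl ; sym = λ e n → sym (e n) ; trans = λ e f n → trans (e n) (f n) }
                    ; ∙-cong = λ {p} {p′} {q} {q′} → add-cong p p′ q q′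
                    }
                  ; assoc = λ p q r n → trans (coeff-add (add p q) r n)
                      (trans (+-congʳ (coeff-add p q n)) (trans (+-assoc _ _ _)
                      (trans (+-congˡ (sym (coeff-add q r n))) (sym (coeff-add p (add q r) n)))))
                  }
                ; identity = (λ p n → refl) , (λ p n → trans (coeff-add p [] n) (+-identityʳ _))
                }
              ; inverse = (λ p n → trans (coeff-add (map (-_) p) p n) (trans (+-congʳ (coeff-neg p n)) (-‿inverseˡ _)))
                        , (λ p n → trans (coeff-add p (map (-_) p) n) (trans (+-congˡ (coeff-neg p n)) (-‿inverseʳ _)))
              ; ⁻¹-cong = λ {p} {q} e n → trans (coeff-neg p n) (trans (-‿cong (e n)) (sym (coeff-neg q n)))
              }
            ; comm = λ p q n → trans (coeff-add p q n) (trans (+-comm _ _) (sym (coeff-add q p n)))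
            }
          ; *-cong = λ {p} {p′} {q} {q′} → mul-cong p p′ q q′
          ; *-assoc = mul-assoc
          ; *-identity = mul-identityˡ , λ p n → trans (mul-comm p (1# ∷ []) n) (mul-identityˡ p n)
          ; distrib = mul-distribˡ , mul-distribʳ
          }
        ; *-comm = mul-comm
        }
      }

    private
      ev = eval R₀

    eval-zero : ∀ p x → (∀ n → co p n ≈ 0#) → ev p x ≈ 0#
    eval-zero []      x p≈0 = refl
    eval-zero (a ∷ p) x p≈0 =
      trans (+-cong (p≈0 0) (trans (*-congˡ (eval-zero p x (λ n → p≈0 (suc n)))) (zeroʳ x))) (+-identityʳ 0#)

    eval-cong : ∀ p q x → p ≋ q → ev p x ≈ ev q x
    eval-cong []      q       x e = sym (eval-zero q x (λ n → sym (e n)))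
    eval-cong (a ∷ p) []      x e = eval-zero (a ∷ p) x e
    eval-cong (a ∷ p) (b ∷ q) x e = +-cong (e 0) (*-congˡ (eval-cong p q x (λ n → e (suc n))))

    eval-add : ∀ p q x → ev (add p q) x ≈ ev p x + ev q x
    eval-add []      q       x = sym (+-identityˡ _)
    eval-add (a ∷ p) []      x = sym (+-identityʳ _)
    eval-add (a ∷ p) (b ∷ q) x = trans (+-congˡ (*-congˡ (eval-add p q x)))
      (solve 5 (λ a b x y z → (a :+ b) :+ x :* (y :+ z) := (a :+ x :* y) :+ (b :+ x :* z)) refl _ _ _ _ _)

    eval-scale : ∀ a p x → ev (map (a *_) p) x ≈ a * ev p x
    eval-scale a []      x = sym (zeroʳ a)
    eval-scale a (b ∷ p) x = trans (+-congˡ (*-congˡ (eval-scale a p x)))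
      (solve 4 (λ a b x y → a :* b :+ x :* (a :* y) := a :* (b :+ x :* y)) refl _ _ _ _)

    eval-mul : ∀ p q x → ev (mul p q) x ≈ ev p x * ev q x
    eval-mul []      q x = sym (zeroˡ _)
    eval-mul (a ∷ p) q x = begin
      ev (add (map (a *_) q) (0# ∷ mul p q)) x  ≈⟨ eval-add (map (a *_) q) _ x ⟩
      ev (map (a *_) q) x + (0# + x * ev (mul p q) x)
        ≈⟨ +-cong (eval-scale a q x) (trans (+-identityˡ _) (*-congˡ (eval-mul p q x))) ⟩
      a * ev q x + x * (ev p x * ev q x)
        ≈⟨ solve 4 (λ a x y z → a :* y :+ x :* (z :* y) := (a :+ x :* z) :* y) refl _ _ _ _ ⟩
      (a + x * ev p x) * ev q x  ∎

    eval-const : ∀ a x → ev (a ∷ []) x ≈ a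
    eval-const a x = trans (+-congˡ (zeroʳ x)) (+-identityʳ a)

    eval-neg : ∀ p x → ev (map (-_) p) x ≈ - ev p x
    eval-neg p x = trans (+-cancel-neg) refl
      where
      open RingProperties ring using (+-inverseˡ-unique)
      +-cancel-neg : ev (map (-_) p) x ≈ - ev p x
      +-cancel-neg = +-inverseˡ-unique _ _ (trans (sym (eval-add (map (-_) p) p x))
        (eval-zero (add (map (-_) p) p) x λ n → trans (coeff-add (map (-_) p) p n)
          (trans (+-congʳ (coeff-neg p n)) (-‿inverseˡ _))))

    eval-power : ∀ p x n → ev (power (polyRing R₀) p n) x ≈ power R₀ (ev p x) n
    eval-power p x zero    = eval-const 1# x
    eval-power p x (suc n) = trans (eval-mul p (power (polyRing R₀) p n) x) (*-congˡ (eval-power p x n))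

    eval-sumOf : ∀ ps x → ev (sumOf (polyRing R₀) ps) x ≈ sumOf R₀ (map (λ p → ev p x) ps)
    eval-sumOf []       x = refl
    eval-sumOf (p ∷ ps) x = trans (eval-add p _ x) (+-congˡ (eval-sumOf ps x))

    coeff-beyond : ∀ p {n} → length p ℕ.≤ n → co p n ≡ 0#
    coeff-beyond []      _         = ≡.refl
    coeff-beyond (a ∷ p) (s≤s l)   = coeff-beyond p l

    coeff-applyUpTo-< : ∀ (f : ℕ → Carrier) {N n} → n ℕ.< N → co (applyUpTo f N) n ≡ f n
    coeff-applyUpTo-< f {suc N} {zero}  _       = ≡.refl
    coeff-applyUpTo-< f {suc N} {suc n} (s≤s l) = coeff-applyUpTo-< (f ∘ suc) l

    coeff-applyUpTo-≥ : ∀ (f : ℕ → Carrier) {N n} → N ℕ.≤ n → co (applyUpTo f N) n ≡ 0#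
    coeff-applyUpTo-≥ f {zero}  {n}     _       = ≡.refl
    coeff-applyUpTo-≥ f {suc N} {suc n} (s≤s l) = coeff-applyUpTo-≥ (f ∘ suc) l

    -- Division of a ∷ p by t − z: the quotient does not depend on a.
    quotient : Carrier → P → P
    quotient z []      = []
    quotient z (a ∷ p) = ev (a ∷ p) z ∷ quotient z p

    length-quotient : ∀ z p → length (quotient z p) ≡ length p
    length-quotient z []      = ≡.refl
    length-quotient z (a ∷ p) = ≡.cong suc (length-quotient z p)

    -- Coefficient n of the quotient is the value at z of the tail of p from degree n on, and
    -- Horner's rule relates consecutive tails.
    coeff-quotient : ∀ z p n → co (quotient z p) n ≈ co p n + z * co (quotient z p) (suc n)
    coeff-quotient z []          n       = sym (trans (+-identityˡ _) (zeroʳ z))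
    coeff-quotient z (a ∷ [])    zero    = refl
    coeff-quotient z (a ∷ b ∷ p) zero    = refl
    coeff-quotient z (a ∷ p)     (suc n) = coeff-quotient z p n

    factor : ∀ a p z → ev (a ∷ p) z ≈ 0# → (a ∷ p) ≋ mul (- z ∷ 1# ∷ []) (quotient z p)
    factor a p z e zero = sym (begin
      co (mul (- z ∷ 1# ∷ []) (quotient z p)) 0  ≈⟨ coeff-mul-zero (- z) (1# ∷ []) (quotient z p) ⟩
      - z * co (quotient z p) 0  ≈⟨ *-congˡ (head p) ⟩
      - z * ev p z  ≈⟨ +-identityˡ _ ⟨
      0# + - z * ev p z  ≈⟨ +-congʳ e ⟨
      a + z * ev p z + - z * ev p z  ≈⟨ +-assoc _ _ _ ⟩
      a + (z * ev p z + - z * ev p z)  ≈⟨ +-congˡ (distribʳ _ _ _) ⟨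
      a + (z + - z) * ev p z  ≈⟨ +-congˡ (trans (*-congʳ (-‿inverseʳ z)) (zeroˡ _)) ⟩
      a + 0#  ≈⟨ +-identityʳ a ⟩
      a  ∎)
      where
      head : ∀ p → co (quotient z p) 0 ≈ ev p z
      head []      = refl
      head (b ∷ p) = refl
    factor a p z e (suc n) = sym (begin
      co (mul (- z ∷ 1# ∷ []) q) (suc n)  ≈⟨ coeff-mul-suc (- z) (1# ∷ []) q n ⟩
      - z * co q (suc n) + co (mul (1# ∷ []) q) n ≈⟨ +-congˡ (trans (mul-identityˡ q n) (coeff-quotient z p n)) ⟩
      - z * co q (suc n) + (co p n + z * co q (suc n))
        -- `- z` enters as an independent variable `z′`; the one fact about negation, that z and
        -- `- z` cancel, is applied in the next step.
        ≈⟨ solve 4 (λ z z′ x y → z′ :* y :+ (x :+ z :* y) := x :+ (z :+ z′) :* y) refl z (- z) _ _ ⟩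
      co p n + (z + - z) * co q (suc n)  ≈⟨ +-congˡ (trans (*-congʳ (-‿inverseʳ z)) (zeroˡ _)) ⟩
      co p n + 0#  ≈⟨ +-identityʳ _ ⟩
      co p n  ∎)
      where q = quotient z p

-- Power series multiplied by linear factors; rationality of the chain series

module PowerSeriesFactors where

  open PolynomialRing
  open import Relation.Binary.PropositionalEquality as ≡ using (_≡_)

  module PowerSeries (R : CommutativeRing 0ℓ 0ℓ) where
    open CommutativeRing R hiding (zero)
    open SetoidReasoning setoid
    open NatSolver commutativeSemiring using (solve; _:=_; _:+_; _:*_; con)
    open PolyProperties R using (R₀; coeff-mul-zero; coeff-linear)

    -- Multiplication of the series Σ f n tⁿ by 1 + c t.
    Δ : Carrier → (ℕ → Carrier) → ℕ → Carrier
    Δ c f zero    = f 0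
    Δ c f (suc n) = f (suc n) + c * f n

    Δs : List Carrier → (ℕ → Carrier) → ℕ → Carrier
    Δs cs f = foldr Δ f cs

    cauchyProduct-suc : ∀ f g n →
      cauchyProduct R₀ f g (suc n) ≡ f 0 * g (suc n) + cauchyProduct R₀ (f ∘ suc) g n
    cauchyProduct-suc f g n = ≡.cong (λ xs → f 0 * g (suc n) + sumOf R₀ xs)
      (≡.trans (map-applyUpTo suc _ (suc n)) (≡.sym (map-applyUpTo (λ k → k) _ (suc n))))

    cauchyProduct-identity : ∀ f n → cauchyProduct R₀ f (coeff R₀ (1# ∷ [])) n ≈ f n
    cauchyProduct-identity f zero    = trans (+-identityʳ _) (*-identityʳ _)
    cauchyProduct-identity f (suc n) = begin
      cauchyProduct R₀ f (coeff R₀ (1# ∷ [])) (suc n)  ≡⟨ cauchyProduct-suc f (coeff R₀ (1# ∷ [])) n ⟩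
      f 0 * 0# + cauchyProduct R₀ (f ∘ suc) (coeff R₀ (1# ∷ [])) n  ≈⟨ +-cong (zeroʳ _) (cauchyProduct-identity (f ∘ suc) n) ⟩
      0# + f (suc n)  ≈⟨ +-identityˡ _ ⟩
      f (suc n)  ∎

    cauchyProduct-linear : ∀ c p f n →
      cauchyProduct R₀ f (coeff R₀ (mulPoly R₀ (1# ∷ c ∷ []) p)) n ≈ Δ c (cauchyProduct R₀ f (coeff R₀ p)) n
    cauchyProduct-linear c p f zero = +-congʳ (*-congˡ (trans (coeff-mul-zero 1# (c ∷ []) p) (*-identityˡ _)))
    -- Index 1 is separate: once `f 0` is split off, the remaining product has index 0, where `Δ`
    -- has no lower term.
    cauchyProduct-linear c p f (suc zero) = begin
      f 0 * g′ 1 + (f 1 * g′ 0 + 0#)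
        ≈⟨ +-cong (*-congˡ (coeff-linear c p 0))
                  (+-congʳ (*-congˡ (trans (coeff-mul-zero 1# (c ∷ []) p) (*-identityˡ _)))) ⟩
      f 0 * (g 1 + c * g 0) + (f 1 * g 0 + 0#)
        ≈⟨ solve 5 (λ x y c u v → x :* (u :+ c :* v) :+ (y :* v :+ con 0)
                     := (x :* u :+ (y :* v :+ con 0)) :+ c :* (x :* v :+ con 0)) refl (f 0) (f 1) c (g 1) (g 0) ⟩
      (f 0 * g 1 + (f 1 * g 0 + 0#)) + c * (f 0 * g 0 + 0#) ∎
      where
      g  = coeff R₀ p
      g′ = coeff R₀ (mulPoly R₀ (1# ∷ c ∷ []) p)
    cauchyProduct-linear c p f (suc (suc n)) = begin
      cauchyProduct R₀ f g′ (suc (suc n))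
        ≡⟨ cauchyProduct-suc f g′ (suc n) ⟩
      f 0 * g′ (suc (suc n)) + cauchyProduct R₀ (f ∘ suc) g′ (suc n)
        ≈⟨ +-cong (*-congˡ (coeff-linear c p (suc n))) (cauchyProduct-linear c p (f ∘ suc) (suc n)) ⟩
      f 0 * (g (suc (suc n)) + c * g (suc n)) + (C (suc n) + c * C n)
        ≈⟨ solve 6 (λ x c u v y z → x :* (u :+ c :* v) :+ (y :+ c :* z)
                     := (x :* u :+ y) :+ c :* (x :* v :+ z)) refl (f 0) c _ _ _ _ ⟩
      (f 0 * g (suc (suc n)) + C (suc n)) + c * (f 0 * g (suc n) + C n)
        ≡⟨ ≡.cong₂ (λ u v → u + c * v) (cauchyProduct-suc f g (suc n)) (cauchyProduct-suc f g n) ⟨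
      cauchyProduct R₀ f g (suc (suc n)) + c * cauchyProduct R₀ f g (suc n) ∎
      where
      g  = coeff R₀ p
      g′ = coeff R₀ (mulPoly R₀ (1# ∷ c ∷ []) p)
      C  = cauchyProduct R₀ (f ∘ suc) g

    infix 4 _≗_
    _≗_ : (f g : ℕ → Carrier) → Set
    f ≗ g = ∀ n → f n ≈ g n

    Δ-cong : ∀ c {f g} → f ≗ g → Δ c f ≗ Δ c g
    Δ-cong c e zero    = e 0
    Δ-cong c e (suc n) = +-cong (e (suc n)) (*-congˡ (e n))

    Δs-cong : ∀ cs {f g} → f ≗ g → Δs cs f ≗ Δs cs g
    Δs-cong []       e = e
    Δs-cong (c ∷ cs) e = Δ-cong c (Δs-cong cs e)

    Δ-comm : ∀ a b f → Δ a (Δ b f) ≗ Δ b (Δ a f)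
    Δ-comm a b f zero          = refl
    Δ-comm a b f (suc zero)    =
      solve 4 (λ a b x y → x :+ b :* y :+ a :* y := x :+ a :* y :+ b :* y) refl a b (f 1) (f 0)
    Δ-comm a b f (suc (suc n)) =
      solve 5 (λ a b x y z → x :+ b :* y :+ a :* (y :+ b :* z) := x :+ a :* y :+ b :* (y :+ a :* z)) refl
        a b (f (suc (suc n))) (f (suc n)) (f n)

    -- Multiplications commute, so the one factor that simplifies a given series may be applied to
    -- it first.
    Δ-Δs : ∀ c cs f → Δ c (Δs cs f) ≗ Δs cs (Δ c f)
    Δ-Δs c []       f n = refl
    Δ-Δs c (d ∷ cs) f n = trans (Δ-comm c d (Δs cs f) n) (Δ-cong d (Δ-Δs c cs f) n)

    Δs-zero : ∀ cs → Δs cs (λ _ → 0#) ≗ (λ _ → 0#)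
    Δs-zero []       n       = refl
    Δs-zero (c ∷ cs) zero    = Δs-zero cs 0
    Δs-zero (c ∷ cs) (suc n) =
      trans (+-cong (Δs-zero cs (suc n)) (trans (*-congˡ (Δs-zero cs n)) (zeroʳ c))) (+-identityʳ 0#)

    Δs-+ : ∀ cs f g → Δs cs (λ n → f n + g n) ≗ (λ n → Δs cs f n + Δs cs g n)
    Δs-+ []       f g n       = refl
    Δs-+ (c ∷ cs) f g zero    = Δs-+ cs f g 0
    Δs-+ (c ∷ cs) f g (suc n) = trans (+-cong (Δs-+ cs f g (suc n)) (*-congˡ (Δs-+ cs f g n)))
      (solve 5 (λ c x y u v → (x :+ y) :+ c :* (u :+ v) := (x :+ c :* u) :+ (y :+ c :* v)) refl c _ _ _ _)

    Δs-* : ∀ cs a f → Δs cs (λ n → a * f n) ≗ (λ n → a * Δs cs f n)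
    Δs-* []       a f n       = refl
    Δs-* (c ∷ cs) a f zero    = Δs-* cs a f 0
    Δs-* (c ∷ cs) a f (suc n) = trans (+-cong (Δs-* cs a f (suc n)) (*-congˡ (Δs-* cs a f n)))
      (solve 4 (λ c a x y → a :* x :+ c :* (a :* y) := a :* (x :+ c :* y)) refl c a _ _)

    shift : (ℕ → Carrier) → ℕ → Carrier
    shift f zero    = 0#
    shift f (suc n) = f n

    Δs-shift : ∀ cs f → Δs cs (shift f) ≗ shift (Δs cs f)
    Δs-shift []       f n             = refl
    Δs-shift (c ∷ cs) f zero          = Δs-shift cs f 0
    Δs-shift (c ∷ cs) f (suc zero)    =
      trans (+-cong (Δs-shift cs f 1) (trans (*-congˡ (Δs-shift cs f 0)) (zeroʳ c))) (+-identityʳ _)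
    Δs-shift (c ∷ cs) f (suc (suc n)) = +-cong (Δs-shift cs f (suc (suc n))) (*-congˡ (Δs-shift cs f (suc n)))

    cauchyProduct-product : ∀ {X : Set} (c : X → Carrier) f xs →
      cauchyProduct R₀ f (coeff R₀ (productOf (polyRing R₀) (map (λ x → 1# ∷ c x ∷ []) xs))) ≗ Δs (map c xs) f
    cauchyProduct-product c f []       n = cauchyProduct-identity f n
    cauchyProduct-product c f (x ∷ xs) n =
      trans (cauchyProduct-linear (c x) (productOf (polyRing R₀) (map (λ x → 1# ∷ c x ∷ []) xs)) f n)
            (Δ-cong (c x) (cauchyProduct-product c f xs) n)

    EventuallyZero : (ℕ → Carrier) → Set
    EventuallyZero f = ∃[ N ] ∀ n → N ℕ.≤ n → f n ≈ 0#

    eventuallyZero-cong : ∀ {f g} → f ≗ g → EventuallyZero f → EventuallyZero g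
    eventuallyZero-cong e (N , z) = N , λ n N≤n → trans (sym (e n)) (z n N≤n)

    eventuallyZero-+ : ∀ {f g} → EventuallyZero f → EventuallyZero g → EventuallyZero (λ n → f n + g n)
    eventuallyZero-+ (M , y) (N , z) = M ⊔ N , λ n le →
      trans (+-cong (y n (ℕₚ.m⊔n≤o⇒m≤o M N le)) (z n (ℕₚ.m⊔n≤o⇒n≤o M N le))) (+-identityʳ 0#)

    eventuallyZero-* : ∀ a {f} → EventuallyZero f → EventuallyZero (λ n → a * f n)
    eventuallyZero-* a (N , z) = N , λ n le → trans (*-congˡ (z n le)) (zeroʳ a)

    eventuallyZero-shift : ∀ {f} → EventuallyZero f → EventuallyZero (shift f)
    eventuallyZero-shift (N , z) = suc N , λ { (suc n) (s≤s le) → z n le }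

    eventuallyZero-Δ : ∀ c {f} → EventuallyZero f → EventuallyZero (Δ c f)
    eventuallyZero-Δ c (N , z) = suc N , λ { (suc n) (s≤s le) →
      trans (+-cong (z (suc n) (ℕₚ.m≤n⇒m≤1+n le)) (trans (*-congˡ (z n le)) (zeroʳ c))) (+-identityʳ 0#) }

    eventuallyZero-Δs : ∀ cs {f} → EventuallyZero f → EventuallyZero (Δs cs f)
    eventuallyZero-Δs []       z = z
    eventuallyZero-Δs (c ∷ cs) z = eventuallyZero-Δ c (eventuallyZero-Δs cs z)

    eventuallyZero-sum : ∀ {X : Set} cs (F : X → ℕ → Carrier) xs → All (λ x → EventuallyZero (Δs cs (F x))) xs →
                         EventuallyZero (Δs cs (λ n → sumOf R₀ (map (λ x → F x n) xs)))
    eventuallyZero-sum cs F []       []       = eventuallyZero-cong (λ n → sym (Δs-zero cs n)) (0 , λ _ _ → refl)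
    eventuallyZero-sum cs F (x ∷ xs) (z ∷ zs) =
      eventuallyZero-cong (λ n → sym (Δs-+ cs (F x) _ n)) (eventuallyZero-+ z (eventuallyZero-sum cs F xs zs))

    range : ℕ → ℕ → List ℕ
    range j zero    = []
    range j (suc k) = j ∷ range (suc j) k

    upTo≡range : ∀ n → upTo n ≡ range 0 n
    upTo≡range = go (λ k → k) 0 (λ _ → ≡.refl)
      where
      go : ∀ f j → (∀ k → f k ≡ j ℕ.+ k) → ∀ n → applyUpTo f n ≡ range j n
      go f j e zero    = ≡.refl
      go f j e (suc n) = ≡.cong₂ _∷_ (≡.trans (e 0) (ℕₚ.+-identityʳ j))
        (go (f ∘ suc) (suc j) (λ k → ≡.trans (e (suc k)) (ℕₚ.+-suc j k)) n)

    -- S m x is the weight of the weak chains with m + 1 elements starting at x.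
    module ChainSeries {X : Set} (ρ : X → ℕ) (H : ℕ) (ρ≤H : ∀ x → ρ x ℕ.≤ H)
      (w : ℕ → Carrier) (above : X → List X) (above-ρ : ∀ x → All (λ y → ρ x ℕ.< ρ y) (above x))
      (S : ℕ → X → Carrier) (S-zero : ∀ x → S 0 x ≈ w (ρ x))
      (S-suc : ∀ m x → S (suc m) x ≈ w (ρ x) * (S m x + sumOf R₀ (map (S m) (above x))))
      where

      δ₀ : ℕ → Carrier
      δ₀ zero    = 1#
      δ₀ (suc n) = 0#

      F : X → ℕ → Carrier
      F x = shift (λ m → S m x)

      ΣF : List X → ℕ → Carrier
      ΣF ys n = sumOf R₀ (map (λ y → F y n) ys)

      ΣF-zero : ∀ ys → ΣF ys 0 ≈ 0#
      ΣF-zero []       = refl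
      ΣF-zero (y ∷ ys) = trans (+-identityˡ _) (ΣF-zero ys)

      -- A chain starting at x repeats x some number of times and then stops or leaves for a
      -- strictly larger element. The repetitions form a geometric series in w(ρ x) t, and this
      -- factor removes it.
      Δ-F : ∀ x → Δ (- w (ρ x)) (F x) ≗ shift (λ n → w (ρ x) * (δ₀ n + ΣF (above x) n))
      Δ-F x zero          = refl
      Δ-F x (suc zero)    = begin
        S 0 x + - w (ρ x) * 0#  ≈⟨ +-cong (S-zero x) (zeroʳ _) ⟩
        w (ρ x) + 0#  ≈⟨ +-identityʳ _ ⟩
        w (ρ x)  ≈⟨ *-identityʳ _ ⟨
        w (ρ x) * 1#  ≈⟨ *-congˡ (trans (+-congˡ (ΣF-zero (above x))) (+-identityʳ 1#)) ⟨
        w (ρ x) * (1# + ΣF (above x) 0)  ∎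
      Δ-F x (suc (suc n)) = begin
        S (suc n) x + - w (ρ x) * S n x
          ≈⟨ +-congʳ (S-suc n x) ⟩
        w (ρ x) * (S n x + Σn) + - w (ρ x) * S n x
          ≈⟨ solve 4 (λ w w′ s t → w :* (s :+ t) :+ w′ :* s := (w :+ w′) :* s :+ w :* t) refl (w (ρ x)) (- w (ρ x)) _ _ ⟩
        (w (ρ x) + - w (ρ x)) * S n x + w (ρ x) * Σn
          ≈⟨ +-cong (trans (*-congʳ (-‿inverseʳ _)) (zeroˡ _)) (*-congˡ (sym (+-identityˡ Σn))) ⟩
        0# + w (ρ x) * (0# + Σn)
          ≈⟨ +-identityˡ _ ⟩
        w (ρ x) * (0# + Σn) ∎
        where Σn = sumOf R₀ (map (S n) (above x))

      factors : ℕ → ℕ → List Carrier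
      factors j k = map (λ a → - w a) (range j k)

      δ₀-eventuallyZero : EventuallyZero δ₀
      δ₀-eventuallyZero = 1 , λ { (suc n) _ → refl }

      -- The list holds the factors with indices j, ..., H, and the induction is on their number k.
      -- If j < ρ x, the factor j multiplies a series that is already a polynomial. If j = ρ x, it
      -- is moved innermost, where `Δ-F` leaves only elements of larger rank, which the other
      -- factors handle. No factor left would mean ρ x > H.
      F-eventuallyZero : ∀ k j → j ℕ.+ k ≡ suc H → ∀ x → j ℕ.≤ ρ x → EventuallyZero (Δs (factors j k) (F x))
      F-eventuallyZero zero    j e x j≤ρ =
        ⊥-elim (ℕₚ.1+n≰n (ℕₚ.≤-trans (ℕₚ.≤-reflexive (≡.trans (≡.sym e) (ℕₚ.+-identityʳ j))) (ℕₚ.≤-trans j≤ρ (ρ≤H x))))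
      F-eventuallyZero (suc k) j e x j≤ρ with ℕₚ.m≤n⇒m<n∨m≡n j≤ρ
      ... | inj₁ j<ρ = eventuallyZero-Δ _ (F-eventuallyZero k (suc j) (≡.trans (≡.sym (ℕₚ.+-suc j k)) e) x j<ρ)
      ... | inj₂ ≡.refl = eventuallyZero-cong
          (λ n → sym (trans (Δ-Δs (- w (ρ x)) cs (F x) n)
                     (trans (Δs-cong cs (Δ-F x) n) (Δs-shift cs _ n))))
          (eventuallyZero-shift (eventuallyZero-cong (λ n → sym (Δs-* cs (w (ρ x)) _ n)) (eventuallyZero-* _
            (eventuallyZero-cong (λ n → sym (Δs-+ cs δ₀ (ΣF (above x)) n)) (eventuallyZero-+
              (eventuallyZero-Δs cs δ₀-eventuallyZero)
              (eventuallyZero-sum cs F (above x) (all (above x) (above-ρ x))))))))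
        where
        cs = factors (suc j) k
        all : ∀ ys → All (λ y → ρ x ℕ.< ρ y) ys → All (λ y → EventuallyZero (Δs cs (F y))) ys
        all []       []       = []
        all (y ∷ ys) (l ∷ ls) = F-eventuallyZero k (suc j) (≡.trans (≡.sym (ℕₚ.+-suc j k)) e) y l ∷ all ys ls

      total-eventuallyZero : ∀ (A : ℕ → Carrier) xs → A 0 ≈ 1# → (∀ m → A (suc m) ≈ sumOf R₀ (map (S m) xs)) →
        EventuallyZero (Δs (map (λ a → - w a) (upTo (suc H))) A)
      total-eventuallyZero A xs A-zero A-suc =
        ≡.subst (λ js → EventuallyZero (Δs (map (λ a → - w a) js) A)) (≡.sym (upTo≡range (suc H)))
          (eventuallyZero-cong
            (λ n → sym (trans (Δs-cong cs total n) (Δs-+ cs δ₀ (ΣF xs) n)))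
            (eventuallyZero-+ (eventuallyZero-Δs cs δ₀-eventuallyZero)
              (eventuallyZero-sum cs F xs (all xs))))
        where
        cs = factors 0 (suc H)
        total : A ≗ (λ n → δ₀ n + ΣF xs n)
        total zero    = trans A-zero (sym (trans (+-congˡ (ΣF-zero xs)) (+-identityʳ 1#)))
        total (suc m) = trans (A-suc m) (sym (+-identityˡ _))
        all : ∀ ys → All (λ y → EventuallyZero (Δs cs (F y))) ys
        all []       = []
        all (y ∷ ys) = F-eventuallyZero (suc H) 0 ≡.refl y z≤n ∷ all ys

-- From weak chains to series; existence and uniqueness of the numerator

module WeakChains where

  open PolynomialRing
  open PowerSeriesFactors
  import Algebra.Properties.Semiring.Exp as Exp
  open import Data.Integer.Base using (+_)
  open import Data.List.Relation.Unary.Linked using (linked?)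
  open import Data.List.Relation.Unary.Unique.Propositional using (Unique)
  open import Data.Product using (∃!)
  open import Relation.Binary.PropositionalEquality as ≡ using (_≡_; _≢_)

  module ℤPoly = PolyProperties ℤₚ.+-*-commutativeRing

  ℤ[q]-ring : CommutativeRing _ _
  ℤ[q]-ring = ℤPoly.polyCommutativeRing

  -- Stated for any ring and any q because two instances are needed: over ℤ[q] with q the variable
  -- it unfolds to the series in `IsNumerator`, and over ℤ with q = 1 its `A` counts weak chains.
  module WeightedChains (R : RawRing 0ℓ 0ℓ) (q : RawRing.Carrier R) (P : GradedPoset) where
    open RawRing R
    open GradedPoset P using (ρ)

    weight : List (GradedPoset.Carrier P) → Carrier
    weight xs = power R q (sum (map ρ xs))

    A : ℕ → Carrier
    A m = sumOf R (map weight (weakChains P m))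

    D : List Carrier
    D = productOf (polyRing R) (map (λ a → 1# ∷ - power R q a ∷ []) (upTo (suc (maxRank P))))

    series : ℕ → Carrier
    series = cauchyProduct R A (coeff R D)

  module WeakChainSeries (R : CommutativeRing 0ℓ 0ℓ) (q : CommutativeRing.Carrier R) (P : GradedPoset)
    (ρ-mono : ∀ x y → GradedPoset._≤_ P x y → x ≢ y → GradedPoset.ρ P x ℕ.< GradedPoset.ρ P y) where

    open GradedPoset P using (elements; complete; unique; _≤_; _≤?_; isDecPartialOrder; ρ) renaming (Carrier to X)
    open IsDecPartialOrder isDecPartialOrder using (_≟_) renaming (refl to ≤-refl)
    open CommutativeRing R hiding (zero)
    open Exp semiring using (^-homo-*)
    open SetoidReasoning setoid
    open PowerSeries R
    open PolyProperties R using (R₀; coeff-applyUpTo-<; coeff-applyUpTo-≥)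
    open WeightedChains R₀ q P

    pow : ℕ → Carrier
    pow n = power R₀ q n

    Σ[_] : List Carrier → Carrier
    Σ[_] = sumOf R₀

    Σ-++ : ∀ xs ys → Σ[ xs ++ ys ] ≈ Σ[ xs ] + Σ[ ys ]
    Σ-++ []       ys = sym (+-identityˡ _)
    Σ-++ (x ∷ xs) ys = trans (+-congˡ (Σ-++ xs ys)) (sym (+-assoc x Σ[ xs ] Σ[ ys ]))

    weight-∷ : ∀ x xs → weight (x ∷ xs) ≈ pow (ρ x) * weight xs
    weight-∷ x xs = ^-homo-* _ (ρ x) (sum (map ρ xs))

    W : List (List X) → Carrier
    W xss = Σ[ map weight (filter (linked? _≤?_) xss) ]

    W-++ : ∀ xss yss → W (xss ++ yss) ≈ W xss + W yss
    W-++ xss yss = trans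
      (reflexive (≡.cong (Σ[_]) (≡.trans (≡.cong (map weight) (filter-++ (linked? _≤?_) xss yss))
                                         (map-++ weight (filter (linked? _≤?_) xss) _))))
      (Σ-++ (map weight (filter (linked? _≤?_) xss)) _)

    S : ℕ → X → Carrier
    S zero    x = pow (ρ x)
    S (suc m) x = pow (ρ x) * Σ[ map (S m) (filter (x ≤?_) elements) ]

    -- The filter tests neighbouring pairs. With x ≤ y known, `x ∷ y ∷ zs` passes exactly when
    -- `y ∷ zs` does, and the new head only contributes its own weight.
    W-linked : ∀ {x y} → x ≤ y → ∀ yss → W (map (x ∷_) (map (y ∷_) yss)) ≈ pow (ρ x) * W (map (y ∷_) yss)
    W-linked {x} {y} x≤y [] = sym (zeroʳ (pow (ρ x)))
    W-linked {x} {y} x≤y (zs ∷ yss) with x ≤? y | linked? _≤?_ (y ∷ zs)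
    ... | no x≰y | _     = ⊥-elim (x≰y x≤y)
    ... | yes _  | no _  = W-linked x≤y yss
    ... | yes _  | yes _ = trans (+-cong (weight-∷ x (y ∷ zs)) (W-linked x≤y yss))
                                 (sym (distribˡ (pow (ρ x)) (weight (y ∷ zs)) (W (map (y ∷_) yss))))

    W-unlinked : ∀ {x y} → ¬ (x ≤ y) → ∀ yss → W (map (x ∷_) (map (y ∷_) yss)) ≈ 0#
    W-unlinked {x} {y} x≰y [] = refl
    W-unlinked {x} {y} x≰y (zs ∷ yss) with x ≤? y | linked? _≤?_ (y ∷ zs)
    ... | yes x≤y | _     = ⊥-elim (x≰y x≤y)
    ... | no _    | no _  = W-unlinked x≰y yss
    ... | no _    | yes _ = W-unlinked x≰y yss

    W≈S : ∀ m x → W (map (x ∷_) (tuples P m)) ≈ S m x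
    W≈S zero    x = trans (+-identityʳ (weight (x ∷ []))) (reflexive (≡.cong pow (ℕₚ.+-identityʳ (ρ x))))
    W≈S (suc m) x = go elements
      where
      go : ∀ ys → W (map (x ∷_) (cartesianProductWith _∷_ ys (tuples P m))) ≈
                  pow (ρ x) * Σ[ map (S m) (filter (x ≤?_) ys) ]
      go []       = sym (zeroʳ (pow (ρ x)))
      go (y ∷ ys) = trans (reflexive (≡.cong W (map-++ (x ∷_) (map (y ∷_) (tuples P m)) _)))
                   (trans (W-++ (map (x ∷_) (map (y ∷_) (tuples P m))) _) step)
        where
        rest = W (map (x ∷_) (cartesianProductWith _∷_ ys (tuples P m)))
        step : W (map (x ∷_) (map (y ∷_) (tuples P m))) + rest ≈
               pow (ρ x) * Σ[ map (S m) (filter (x ≤?_) (y ∷ ys)) ]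
        step with x ≤? y
        ... | yes x≤y = trans
                (+-cong (trans (W-linked x≤y (tuples P m)) (*-congˡ (W≈S m y))) (go ys))
                (sym (distribˡ (pow (ρ x)) (S m y) Σ[ map (S m) (filter (x ≤?_) ys) ]))
        ... | no x≰y  = trans (+-cong (W-unlinked x≰y (tuples P m)) (go ys)) (+-identityˡ _)

    A-zero : A 0 ≈ 1#
    A-zero = +-identityʳ 1#

    A-suc : ∀ m → A (suc m) ≈ Σ[ map (S m) elements ]
    A-suc m = go elements
      where
      go : ∀ ys → W (cartesianProductWith _∷_ ys (tuples P m)) ≈ Σ[ map (S m) ys ]
      go []       = refl
      go (y ∷ ys) = trans (W-++ (map (y ∷_) (tuples P m)) _) (+-cong (W≈S m y) (go ys))

    above : X → List X
    above x = filter (¬? ∘ (x ≟_)) (filter (x ≤?_) elements)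

    above-ρ : ∀ x → All (λ y → ρ x ℕ.< ρ y) (above x)
    above-ρ x = All.zipWith (λ { (x≤y , x≢y) → ρ-mono x _ x≤y x≢y })
      ( Allₚ.filter⁺ (¬? ∘ (x ≟_)) (Allₚ.all-filter (x ≤?_) elements)
      , Allₚ.all-filter (¬? ∘ (x ≟_)) (filter (x ≤?_) elements))

    -- `S (suc m) x` sums over all y ≥ x, while `ChainSeries` treats y = x apart. Since the
    -- enumeration has no repetitions, exactly one term is split off.
    S-split : ∀ m x ys → x ∈ ys → Unique ys →
      Σ[ map (S m) (filter (x ≤?_) ys) ] ≈ S m x + Σ[ map (S m) (filter (¬? ∘ (x ≟_)) (filter (x ≤?_) ys)) ]
    S-split m x (y ∷ ys) (here ≡.refl) (y∉ ∷ u) with x ≤? x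
    ... | no x≰x = ⊥-elim (x≰x ≤-refl)
    ... | yes _ with x ≟ x
    ...   | no x≢x = ⊥-elim (x≢x ≡.refl)
    ...   | yes _ = +-congˡ (reflexive (≡.cong (Σ[_] ∘ map (S m)) (absent ys y∉)))
      where
      absent : ∀ zs → All (x ≢_) zs → filter (x ≤?_) zs ≡ filter (¬? ∘ (x ≟_)) (filter (x ≤?_) zs)
      absent []       []         = ≡.refl
      absent (z ∷ zs) (x≢z ∷ x∉) with x ≤? z
      ... | no _  = absent zs x∉
      ... | yes _ with x ≟ z
      ...   | yes x≡z = ⊥-elim (x≢z x≡z)
      ...   | no _    = ≡.cong (z ∷_) (absent zs x∉)
    S-split m x (y ∷ ys) (there x∈) (y∉ ∷ u) with x ≤? y
    ... | no _  = S-split m x ys x∈ u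
    ... | yes _ with x ≟ y
    ...   | yes ≡.refl = ⊥-elim (All.lookup y∉ x∈ ≡.refl)
    ...   | no _ = trans (+-congˡ (S-split m x ys x∈ u)) (begin
      S m y + (S m x + R′)  ≈⟨ +-assoc (S m y) (S m x) R′ ⟨
      (S m y + S m x) + R′  ≈⟨ +-congʳ (+-comm (S m y) (S m x)) ⟩
      (S m x + S m y) + R′  ≈⟨ +-assoc (S m x) (S m y) R′ ⟩
      S m x + (S m y + R′)  ∎)
      where R′ = Σ[ map (S m) (filter (¬? ∘ (x ≟_)) (filter (x ≤?_) ys)) ]

    ρ≤maxRank : ∀ x → ρ x ℕ.≤ maxRank P
    ρ≤maxRank x = go elements (complete x)
      where
      go : ∀ ys → x ∈ ys → ρ x ℕ.≤ foldr _⊔_ 0 (map ρ ys)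
      go (y ∷ ys) (here ≡.refl) = ℕₚ.m≤m⊔n (ρ x) _
      go (y ∷ ys) (there x∈)    = ℕₚ.≤-trans (go ys x∈) (ℕₚ.m≤n⊔m (ρ y) _)

    factors : List Carrier
    factors = map (λ a → - pow a) (upTo (suc (maxRank P)))

    series-Δs : ∀ n → series n ≈ Δs factors A n
    series-Δs = cauchyProduct-product (λ a → - pow a) A (upTo (suc (maxRank P)))

    series-eventuallyZero : EventuallyZero series
    series-eventuallyZero = eventuallyZero-cong (λ n → sym (series-Δs n))
      (total-eventuallyZero A elements A-zero A-suc)
      where open ChainSeries ρ (maxRank P) ρ≤maxRank pow above above-ρ S (λ x → refl)
                  (λ m x → *-congˡ (S-split m x elements (complete x) unique))

    numerator : ∃[ h ] ∀ n → series n ≈ coeff R₀ h n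
    numerator with series-eventuallyZero
    ... | N , vanish = applyUpTo series N , isNumerator
      where
      isNumerator : ∀ n → series n ≈ coeff R₀ (applyUpTo series N) n
      isNumerator n with n ℕₚ.<? N
      ... | yes n<N = reflexive (≡.sym (coeff-applyUpTo-< series n<N))
      ... | no n≮N  = trans (vanish n (ℕₚ.≮⇒≥ n≮N)) (reflexive (≡.sym (coeff-applyUpTo-≥ series (ℕₚ.≮⇒≥ n≮N))))

  weighted-series : ∀ P h → (∀ n → RawRing._≈_ ℤ[q] (WeightedChains.series ℤ[q] (+ 0 ∷ + 1 ∷ []) P n) (coeff ℤ[q] h n)) →
                    IsNumerator P h
  weighted-series P h e = e

  numerator-unique : ∀ P h h′ → IsNumerator P h → IsNumerator P h′ → RawRing._≈_ ℤ[q][t] h h′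
  numerator-unique P h h′ e e′ n = CommutativeRing.trans ℤ[q]-ring {coeff ℤ[q] h n} {s} {coeff ℤ[q] h′ n}
    (CommutativeRing.sym ℤ[q]-ring {s} {coeff ℤ[q] h n} (e n)) (e′ n)
    where s = cauchyProduct ℤ[q] (A[_] P) (coeff ℤ[q] (denominator P)) n

  module _ (P : GradedPoset) (ρ-mono : ∀ x y → GradedPoset._≤_ P x y → x ≢ y → GradedPoset.ρ P x ℕ.< GradedPoset.ρ P y) where
    open WeakChainSeries ℤ[q]-ring (+ 0 ∷ + 1 ∷ []) P ρ-mono using (numerator)

    isNumerator : ∀ n → RawRing._≈_ ℤ[q] (WeightedChains.series ℤ[q] (+ 0 ∷ + 1 ∷ []) P n) (coeff ℤ[q] (proj₁ numerator) n)
    isNumerator = proj₂ numerator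

    numerator-∃! : ∃! (RawRing._≈_ ℤ[q][t]) (IsNumerator P)
    numerator-∃! = proj₁ numerator , weighted-series P (proj₁ numerator) isNumerator ,
      λ {h} → numerator-unique P (proj₁ numerator) h (weighted-series P (proj₁ numerator) isNumerator)

-- Products of binomials and the numerator of their generating series

module MultichainCount where

  open PowerSeriesFactors
  open import Data.Integer.Base using (ℤ; +_; -_; _+_; _*_)
  open import Data.Integer.Tactic.RingSolver using (solve-∀)
  open import Data.Nat.Combinatorics using (_C_; nCk≡nC[n∸k]; nCk+nC[k+1]≡[n+1]C[k+1]; nCn≡1; k>n⇒nCk≡0)
  open import Relation.Binary.PropositionalEquality

  -- γ n k = C (n + k) n
  γ : ℕ → ℕ → ℤ
  γ zero    k       = + 1
  γ (suc n) zero    = + 1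
  γ (suc n) (suc k) = γ (suc n) k + γ n (suc k)

  -- C (n + k - 1) n, with the value 0 at k = 0. This boundary value makes the Pascal rules below
  -- hold at k = 0 and lets the antidifferences of the chain count vanish at the ends of their
  -- ranges.
  γ′ : ℕ → ℕ → ℤ
  γ′ n zero    = + 0
  γ′ n (suc k) = γ n k

  γ-zeroʳ : ∀ n → γ n 0 ≡ + 1
  γ-zeroʳ zero    = refl
  γ-zeroʳ (suc n) = refl

  γ-rec : ∀ n k → γ (suc n) k ≡ γ′ (suc n) k + γ n k
  γ-rec n zero    = sym (trans (ℤₚ.+-identityˡ _) (γ-zeroʳ n))
  γ-rec n (suc k) = refl

  γ′-rec : ∀ n k → γ′ (suc n) k ≡ γ′ (suc n) (pred k) + γ′ n k
  γ′-rec n zero    = refl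
  γ′-rec n (suc k) = γ-rec n k

  -- Chosen so that Pascal's rule holds by computation; `binom≡C` translates to `_C_`.
  binom : ℕ → ℕ → ℕ
  binom n       zero    = 1
  binom zero    (suc k) = 0
  binom (suc n) (suc k) = binom n k ℕ.+ binom n (suc k)

  binom≡C : ∀ n k → binom n k ≡ n C k
  binom≡C n       zero    = sym (trans (nCk≡nC[n∸k] (ℕ.z≤n {n})) (nCn≡1 n))
  binom≡C zero    (suc k) = sym (k>n⇒nCk≡0 {0} {suc k} (ℕ.s≤s ℕ.z≤n))
  binom≡C (suc n) (suc k) = trans (cong₂ ℕ._+_ (binom≡C n k) (binom≡C n (suc k))) (nCk+nC[k+1]≡[n+1]C[k+1] n k)

  open PowerSeries ℤₚ.+-*-commutativeRing

  U : ℕ → ℕ → ℕ → ℤ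
  U a b n = γ n a * γ n b

  h : ℕ → ℕ → ℕ → ℤ
  h a b n = + binom a n * + binom b n

  -- Multiplication of a series by (1 - t)^k.
  Δ^ : ℕ → (ℕ → ℤ) → ℕ → ℤ
  Δ^ k = Δs (replicate k (- + 1))

  Δ^-suc : ∀ k f n → Δ^ (suc k) f n ≡ Δ^ k (Δ (- + 1) f) n
  Δ^-suc k f n = Δ-Δs (- + 1) (replicate k (- + 1)) f n

  U-comm : ∀ a b n → U a b n ≡ U b a n
  U-comm a b n = ℤₚ.*-comm (γ n a) (γ n b)

  Δ-U₀₀ : ∀ n → Δ (- + 1) (U 0 0) n ≡ h 0 0 n
  Δ-U₀₀ zero          = refl
  Δ-U₀₀ (suc zero)    = refl
  Δ-U₀₀ (suc (suc n)) = refl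

  Δ-U₀ : ∀ b n → Δ (- + 1) (U 0 (suc b)) n ≡ U 0 b n
  Δ-U₀ b zero    = refl
  Δ-U₀ b (suc n) rewrite γ-zeroʳ n = lemma (γ (suc n) b) (γ n (suc b))
    where
    lemma : ∀ x y → + 1 * (x + y) + - + 1 * (+ 1 * y) ≡ + 1 * x
    lemma = solve-∀

  -- Pascal splits the two binomials at index n + 1 as x + p and y + q, where p and q are those at
  -- index n. Subtracting pq from (x + p)(y + q) leaves x(y + q) + (x + p)y - xy.
  Δ-U : ∀ a b n → Δ (- + 1) (U (suc a) (suc b)) n ≡ (U a (suc b) n + U (suc a) b n) + - + 1 * U a b n
  Δ-U a b zero    = refl
  Δ-U a b (suc n) = lemma (γ (suc n) a) (γ n (suc a)) (γ (suc n) b) (γ n (suc b))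
    where
    lemma : ∀ x p y q → (x + p) * (y + q) + - + 1 * (p * q) ≡ (x * (y + q) + (x + p) * y) + - + 1 * (x * y)
    lemma = solve-∀

  -- Again Pascal in both factors, now with x, y the entries at index n and p, q those at n + 1 in
  -- the rows a and b. The series 1 - t multiplies `h a b` because both pq and xy occur.
  h-rec : ∀ a b n → h (suc a) (suc b) n ≡ (h a (suc b) n + h (suc a) b n) + - + 1 * Δ (- + 1) (h a b) n
  h-rec a b zero    = refl
  h-rec a b (suc n) rewrite ℤₚ.pos-+ (binom a n) (binom a (suc n)) | ℤₚ.pos-+ (binom b n) (binom b (suc n)) =
    lemma (+ binom a n) (+ binom a (suc n)) (+ binom b n) (+ binom b (suc n))
    where
    lemma : ∀ x p y q → (x + p) * (y + q) ≡ (p * (y + q) + (x + p) * q) + - + 1 * (p * q + - + 1 * (x * y))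
    lemma = solve-∀

  -- `Δ-U` times (1 - t)^(a+b+2) is the recurrence of `h`. On the axes one of the two binomials is
  -- 1, each factor 1 - t lowers the other index by one, and `h` is constant there.
  Δ^-U : ∀ a b n → Δ^ (suc (a ℕ.+ b)) (U a b) n ≡ h a b n
  Δ^-U zero    zero    n = Δ-U₀₀ n
  Δ^-U zero    (suc b) n = begin
    Δ^ (suc (suc b)) (U 0 (suc b)) n  ≡⟨ Δ^-suc (suc b) (U 0 (suc b)) n ⟩
    Δ^ (suc b) (Δ (- + 1) (U 0 (suc b))) n ≡⟨ Δs-cong (replicate (suc b) (- + 1)) (Δ-U₀ b) n ⟩
    Δ^ (suc b) (U 0 b) n  ≡⟨ Δ^-U zero b n ⟩
    h 0 b n  ≡⟨ indep n ⟩
    h 0 (suc b) n  ∎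
    where
    open ≡-Reasoning
    indep : ∀ n → h 0 b n ≡ h 0 (suc b) n
    indep zero    = refl
    indep (suc n) = refl
  Δ^-U (suc a) zero    n = begin
    Δ^ (suc (suc a ℕ.+ 0)) (U (suc a) 0) n ≡⟨ cong (λ k → Δ^ (suc (suc k)) (U (suc a) 0) n) (ℕₚ.+-identityʳ a) ⟩
    Δ^ (suc (suc a)) (U (suc a) 0) n  ≡⟨ Δs-cong (replicate (suc (suc a)) (- + 1)) (U-comm (suc a) 0) n ⟩
    Δ^ (suc (suc a)) (U 0 (suc a)) n  ≡⟨ Δ^-suc (suc a) (U 0 (suc a)) n ⟩
    Δ^ (suc a) (Δ (- + 1) (U 0 (suc a))) n ≡⟨ Δs-cong (replicate (suc a) (- + 1)) (λ n → trans (Δ-U₀ a n) (U-comm 0 a n)) n ⟩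
    Δ^ (suc a) (U a 0) n  ≡⟨ cong (λ k → Δ^ (suc k) (U a 0) n) (ℕₚ.+-identityʳ a) ⟨
    Δ^ (suc (a ℕ.+ 0)) (U a 0) n  ≡⟨ Δ^-U a zero n ⟩
    h a 0 n  ≡⟨ indep n ⟩
    h (suc a) 0 n  ∎
    where
    open ≡-Reasoning
    indep : ∀ n → h a 0 n ≡ h (suc a) 0 n
    indep zero    = refl
    indep (suc n) = trans (ℤₚ.*-zeroʳ (+ binom a (suc n))) (sym (ℤₚ.*-zeroʳ (+ binom (suc a) (suc n))))
  Δ^-U (suc a) (suc b) n = begin
    Δ^ (suc k) (U (suc a) (suc b)) n
      ≡⟨ Δ^-suc k (U (suc a) (suc b)) n ⟩
    Δ^ k (Δ (- + 1) (U (suc a) (suc b))) n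
      ≡⟨ Δs-cong cs (Δ-U a b) n ⟩
    Δ^ k (λ n → (U a (suc b) n + U (suc a) b n) + - + 1 * U a b n) n
      ≡⟨ trans (Δs-+ cs (λ n → U a (suc b) n + U (suc a) b n) (λ n → - + 1 * U a b n) n)
               (cong₂ _+_ (Δs-+ cs (U a (suc b)) (U (suc a) b) n) (Δs-* cs (- + 1) (U a b) n)) ⟩
    (Δ^ k (U a (suc b)) n + Δ^ k (U (suc a) b) n) + - + 1 * Δ^ k (U a b) n
      ≡⟨ cong₂ _+_ (cong₂ _+_ (Δ^-U a (suc b) n) second) (cong (- + 1 *_) third) ⟩
    (h a (suc b) n + h (suc a) b n) + - + 1 * Δ (- + 1) (h a b) n
      ≡⟨ h-rec a b n ⟨
    h (suc a) (suc b) n ∎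
    where
    open ≡-Reasoning
    k  = suc (a ℕ.+ suc b)
    cs = replicate k (- + 1)
    second : Δ^ k (U (suc a) b) n ≡ h (suc a) b n
    second = trans (cong (λ k → Δ^ (suc k) (U (suc a) b) n) (ℕₚ.+-suc a b)) (Δ^-U (suc a) b n)
    -- `k` is one more than the exponent that belongs to `U a b`, so one factor 1 - t is left over,
    -- as in `h-rec`.
    third : Δ^ k (U a b) n ≡ Δ (- + 1) (h a b) n
    third = trans (cong (λ k → Δ^ (suc k) (U a b) n) (ℕₚ.+-suc a b)) (Δ-cong (- + 1) (Δ^-U a b) n)

-- Telescoping sums over the rows and columns of the trapezoid

module TrapezoidSums where

  open MultichainCount
  open import Data.Bool.Base using (if_then_else_)
  open import Data.Integer.Base as ℤ using (ℤ; +_; -_; _+_; _*_)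
  open import Data.Integer.Tactic.RingSolver using (solve-∀)
  open import Relation.Binary.PropositionalEquality
  open import Relation.Nullary.Decidable using (dec-true; dec-false)

  ∸-suc : ∀ {m n} → suc n ℕ.≤ m → m ∸ n ≡ suc (m ∸ suc n)
  ∸-suc {m} {n} n<m = ℕₚ.+-∸-assoc 1 n<m

  Σℤ : List ℤ → ℤ
  Σℤ = sumOf ℤ.+-*-rawRing

  Σℤ-++ : ∀ xs ys → Σℤ (xs ++ ys) ≡ Σℤ xs + Σℤ ys
  Σℤ-++ []       ys = sym (ℤₚ.+-identityˡ _)
  Σℤ-++ (x ∷ xs) ys = trans (cong (_+_ x) (Σℤ-++ xs ys)) (sym (ℤₚ.+-assoc x _ _))

  Σℤ-filter : ∀ {X : Set} {P : X → Set} (P? : ∀ x → Dec (P x)) (f : X → ℤ) xs →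
              Σℤ (map f (filter P? xs)) ≡ Σℤ (map (λ x → if does (P? x) then f x else + 0) xs)
  Σℤ-filter P? f []       = refl
  Σℤ-filter P? f (x ∷ xs) with P? x
  ... | yes _ = cong (_+_ (f x)) (Σℤ-filter P? f xs)
  ... | no _  = trans (Σℤ-filter P? f xs) (sym (ℤₚ.+-identityˡ _))

  Σℤ-mapMaybe : ∀ {X Y : Set} (g : X → Maybe Y) (f : Y → ℤ) xs →
                Σℤ (map f (mapMaybe g xs)) ≡ Σℤ (map (λ x → maybe′ f (+ 0) (g x)) xs)
  Σℤ-mapMaybe g f []       = refl
  Σℤ-mapMaybe g f (x ∷ xs) with g x
  ... | just y  = cong (_+_ (f y)) (Σℤ-mapMaybe g f xs)
  ... | nothing = trans (Σℤ-mapMaybe g f xs) (sym (ℤₚ.+-identityˡ _))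

  Σℤ-cartesianProduct : ∀ {X Y : Set} (f : X × Y → ℤ) xs ys →
    Σℤ (map f (cartesianProduct xs ys)) ≡ Σℤ (map (λ x → Σℤ (map (λ y → f (x , y)) ys)) xs)
  Σℤ-cartesianProduct f []       ys = refl
  Σℤ-cartesianProduct f (x ∷ xs) ys = begin
    Σℤ (map f (map (x ,_) ys ++ cartesianProduct xs ys))
      ≡⟨ cong Σℤ (map-++ f (map (x ,_) ys) _) ⟩
    Σℤ (map f (map (x ,_) ys) ++ map f (cartesianProduct xs ys))
      ≡⟨ Σℤ-++ (map f (map (x ,_) ys)) _ ⟩
    Σℤ (map f (map (x ,_) ys)) + Σℤ (map f (cartesianProduct xs ys))
      ≡⟨ cong₂ _+_ (cong Σℤ (sym (map-∘ ys))) (Σℤ-cartesianProduct f xs ys) ⟩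
    Σℤ (map (λ y → f (x , y)) ys) + Σℤ (map (λ x → Σℤ (map (λ y → f (x , y)) ys)) xs) ∎
    where open ≡-Reasoning

  Σℤ-upTo-suc : ∀ (f : ℕ → ℤ) n → Σℤ (map f (upTo (suc n))) ≡ Σℤ (map f (upTo n)) + f n
  Σℤ-upTo-suc f n = begin
    Σℤ (map f (upTo (suc n)))  ≡⟨ cong (Σℤ ∘ map f) (sym (applyUpTo-∷ʳ (λ k → k) n)) ⟩
    Σℤ (map f (upTo n ++ n ∷ []))  ≡⟨ cong Σℤ (map-++ f (upTo n) _) ⟩
    Σℤ (map f (upTo n) ++ f n ∷ [])  ≡⟨ Σℤ-++ (map f (upTo n)) _ ⟩
    Σℤ (map f (upTo n)) + (f n + + 0)  ≡⟨ cong (_+_ (Σℤ (map f (upTo n)))) (ℤₚ.+-identityʳ (f n)) ⟩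
    Σℤ (map f (upTo n)) + f n  ∎
    where open ≡-Reasoning

  -- The enumeration of the poset runs over one fixed rectangle for all rows, so each sum is taken
  -- over a full range and its summand is zero outside the window from c₀ to c₁.
  module Telescope (t Y : ℕ → ℤ) (c₀ c₁ : ℕ) (c₀≤c₁ : c₀ ℕ.≤ c₁)
    (below : ∀ c → c ℕ.< c₀ → t c ≡ + 0)
    (inside : ∀ c → c₀ ℕ.≤ c → c ℕ.< c₁ → t c ≡ Y (suc c) + - Y c)
    (beyond : ∀ c → c₁ ℕ.≤ c → t c ≡ + 0) where

    T : ℕ → ℤ
    T n = Σℤ (map t (upTo n))

    T-below : ∀ n → n ℕ.≤ c₀ → T n ≡ + 0
    T-below zero    _    = refl
    T-below (suc n) n<c₀ = trans (Σℤ-upTo-suc t n) (cong₂ _+_ (T-below n (ℕₚ.<⇒≤ n<c₀)) (below n n<c₀))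

    T-inside : ∀ n → c₀ ℕ.≤ n → n ℕ.≤ c₁ → T n ≡ Y n + - Y c₀
    T-inside n c₀≤n n≤c₁ with ℕₚ.m≤n⇒m<n∨m≡n c₀≤n
    T-inside n       c₀≤n n≤c₁ | inj₂ refl = trans (T-below n ℕₚ.≤-refl) (sym (ℤₚ.+-inverseʳ (Y n)))
    T-inside (suc n) c₀≤n n<c₁ | inj₁ (s≤s c₀≤n′) = begin
      T (suc n)  ≡⟨ Σℤ-upTo-suc t n ⟩
      T n + t n  ≡⟨ cong₂ _+_ (T-inside n c₀≤n′ (ℕₚ.<⇒≤ n<c₁)) (inside n c₀≤n′ n<c₁) ⟩
      (Y n + - Y c₀) + (Y (suc n) + - Y n) ≡⟨ lemma (Y n) (Y c₀) (Y (suc n)) ⟩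
      Y (suc n) + - Y c₀  ∎
      where
      open ≡-Reasoning
      lemma : ∀ x y z → (x + - y) + (z + - x) ≡ z + - y
      lemma = solve-∀

    telescope : ∀ n → c₁ ℕ.≤ n → T n ≡ Y c₁ + - Y c₀
    telescope n c₁≤n with ℕₚ.m≤n⇒m<n∨m≡n c₁≤n
    telescope n       c₁≤n | inj₂ refl = T-inside n c₀≤c₁ ℕₚ.≤-refl
    telescope (suc n) c₁≤n | inj₁ (s≤s c₁≤n′) =
      trans (Σℤ-upTo-suc t n) (trans (cong₂ _+_ (telescope n c₁≤n′) (beyond n c₁≤n′)) (ℤₚ.+-identityʳ _))

  -- Number of weak chains with n + 1 elements starting in row j + 1 and column s − e.
  σ : ℕ → ℕ → ℕ → ℤ
  σ n j e = γ (suc n) j * γ′ n e + - (γ n e * γ′ (suc n) j)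

  -- The antidifference of σ n j with respect to e that vanishes at e = j.
  rowSum : ℕ → ℕ → ℕ → ℤ
  rowSum n j e = γ (suc n) j * γ′ (suc n) e + - (γ (suc n) e * γ′ (suc n) j)

  -- A point alone forms one chain. The case s - c = 0, where `σ 0 j 0` would be -j, does not arise:
  -- every column of the trapezoid is smaller than s.
  σ-zero : ∀ j e → σ 0 j (suc e) ≡ + 1
  σ-zero j e = trans (cong (λ x → x * + 1 + - (+ 1 * γ′ 1 j)) (γ-rec 0 j)) (lemma (γ′ 1 j))
    where
    lemma : ∀ x → (x + + 1) * + 1 + - (+ 1 * x) ≡ + 1
    lemma = solve-∀

  rowSum-step : ∀ n j e → rowSum n j (suc e) + - rowSum n j e ≡ σ n j (suc e)
  rowSum-step n j e = begin
    (g * γ (suc n) e + - ((γ (suc n) e + γ n (suc e)) * g′)) + - (g * γ′ (suc n) e + - (γ (suc n) e * g′))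
      ≡⟨ lemma g g′ (γ (suc n) e) (γ n (suc e)) (γ′ (suc n) e) ⟩
    g * (γ (suc n) e + - γ′ (suc n) e) + - (γ n (suc e) * g′)
      ≡⟨ cong (λ x → g * x + - (γ n (suc e) * g′)) (trans (cong (λ z → z + - γ′ (suc n) e) (γ-rec n e)) (cancel (γ′ (suc n) e) (γ n e))) ⟩
    σ n j (suc e) ∎
    where
    open ≡-Reasoning
    g  = γ (suc n) j
    g′ = γ′ (suc n) j
    lemma : ∀ g g′ x y z → (g * x + - ((x + y) * g′)) + - (g * z + - (x * g′)) ≡ g * (x + - z) + - (y * g′)
    lemma = solve-∀
    cancel : ∀ x y → (x + y) + - x ≡ y
    cancel = solve-∀

  rowSum-diagonal : ∀ n j → rowSum n j j ≡ + 0
  rowSum-diagonal n j = ℤₚ.+-inverseʳ (γ (suc n) j * γ′ (suc n) j)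

  -- The antidifference of `rowSum n j e` in j that vanishes at j = 0. At `suc i` it unfolds to
  -- `σ (suc n) i e`, and this closes the induction on the length of the chains.
  columnSum : ℕ → ℕ → ℕ → ℤ
  columnSum n e j = γ′ (suc (suc n)) j * γ′ (suc n) e + - (γ (suc n) e * γ′ (suc (suc n)) (pred j))

  columnSum-zero : ∀ n e → columnSum n e 0 ≡ + 0
  columnSum-zero n e = lemma (γ′ (suc n) e) (γ (suc n) e)
    where
    lemma : ∀ x y → + 0 * x + - (y * + 0) ≡ + 0
    lemma = solve-∀

  columnSum-step : ∀ n e j → columnSum n e (suc j) + - columnSum n e j ≡ rowSum n j e
  columnSum-step n e j = begin
    (γ (suc (suc n)) j * x + - (y * u)) + - (u * x + - (y * γ′ (suc (suc n)) (pred j)))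
      ≡⟨ cong₂ (λ p q → (p * x + - (y * q)) + - (u * x + - (y * γ′ (suc (suc n)) (pred j))))
               (γ-rec (suc n) j) (γ′-rec (suc n) j) ⟩
    ((u + g) * x + - (y * (v + g′))) + - (u * x + - (y * v))
      ≡⟨ lemma u g x y v g′ ⟩
    g * x + - (y * g′) ∎
    where
    open ≡-Reasoning
    x  = γ′ (suc n) e
    y  = γ (suc n) e
    u  = γ′ (suc (suc n)) j
    v  = γ′ (suc (suc n)) (pred j)
    g  = γ (suc n) j
    g′ = γ′ (suc n) j
    lemma : ∀ u g x y v g′ → ((u + g) * x + - (y * (v + g′))) + - (u * x + - (y * v)) ≡ g * x + - (y * g′)
    lemma = solve-∀

  module _ (r s : ℕ) where

    private
      T = Trapezoid r s

    Σ-listT : ∀ (f : T → ℤ) → Σℤ (map f (listT r s)) ≡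
      Σℤ (map (λ i → Σℤ (map (λ c → maybe′ f (+ 0) (toTrapezoid r s (i , c))) (upTo (suc s)))) (upTo (suc r)))
    Σ-listT f = trans (Σℤ-mapMaybe (toTrapezoid r s) f (cartesianProduct (upTo (suc r)) (upTo (suc s))))
                      (Σℤ-cartesianProduct (λ p → maybe′ f (+ 0) (toTrapezoid r s p)) (upTo (suc r)) (upTo (suc s)))

    at : (T → ℤ) → ℕ → ℕ → ℤ
    at f i c = maybe′ f (+ 0) (toTrapezoid r s (i , c))

    at-inside : ∀ f {i c} (v : InTrapezoid r s i c) → at f i c ≡ f ⟨ i , c ∣ v ⟩
    at-inside f v = cong (maybe′ f (+ 0)) (toTrapezoid-complete r s ⟨ _ , _ ∣ v ⟩)

    at-zero : ∀ f {i c} → (∀ v → f ⟨ i , c ∣ v ⟩ ≡ + 0) → at f i c ≡ + 0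
    at-zero f {i} {c} z with InTrapezoid? r s i c
    ... | yes v = z v
    ... | no _  = refl

    at-outside : ∀ f {i c} → ¬ InTrapezoid r s i c → at f i c ≡ + 0
    at-outside f ¬v = at-zero f (λ v → ⊥-elim (¬v v))

    -- As c grows, e = s - c decreases, so the antidifference in c is the negative of `rowSum`. Row
    -- j + 1 ends just before c = s - j, that is e = j, where `rowSum` vanishes by antisymmetry;
    -- only the left end c₀ contributes.
    row-telescope : ∀ f n j c₀ → j ℕ.< r → suc j ℕ.≤ c₀ → c₀ ℕ.≤ s ∸ j → j ℕ.≤ s →
      (∀ c v → c ℕ.< c₀ → f ⟨ suc j , c ∣ v ⟩ ≡ + 0) →
      (∀ c v → c₀ ℕ.≤ c → f ⟨ suc j , c ∣ v ⟩ ≡ σ n j (s ∸ c)) →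
      Σℤ (map (at f (suc j)) (upTo (suc s))) ≡ rowSum n j (s ∸ c₀)
    row-telescope f n j c₀ j<r j<c₀ c₀≤ j≤s zeros values = begin
      Σℤ (map (at f (suc j)) (upTo (suc s)))
        ≡⟨ telescope (suc s) (ℕₚ.m≤n⇒m≤1+n (ℕₚ.m∸n≤m s j)) ⟩
      - rowSum n j (s ∸ (s ∸ j)) + - - rowSum n j (s ∸ c₀)
        ≡⟨ cong₂ _+_ (trans (cong (λ e → - rowSum n j e) (ℕₚ.m∸[m∸n]≡n j≤s)) (cong -_ (rowSum-diagonal n j))) (ℤₚ.neg-involutive _) ⟩
      + 0 + rowSum n j (s ∸ c₀)
        ≡⟨ ℤₚ.+-identityˡ _ ⟩
      rowSum n j (s ∸ c₀) ∎
      where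
      open ≡-Reasoning
      pred-< : ∀ {m} → 1 ℕ.≤ m → pred m ℕ.< m
      pred-< (s≤s _) = ℕₚ.≤-refl
      pred-∸ : s ∸ suc j ≡ pred (s ∸ j)
      pred-∸ = sym (ℕₚ.pred[m∸n]≡m∸[1+n] s j)
      inside : ∀ c → c₀ ℕ.≤ c → c ℕ.< s ∸ j → at f (suc j) c ≡ - rowSum n j (s ∸ suc c) + - - rowSum n j (s ∸ c)
      inside c c₀≤c c<s∸j = begin
        at f (suc j) c
          ≡⟨ trans (at-inside f v) (values c v c₀≤c) ⟩
        σ n j (s ∸ c)
          ≡⟨ cong (σ n j) e ⟩
        σ n j (suc (s ∸ suc c))
          ≡⟨ rowSum-step n j (s ∸ suc c) ⟨
        rowSum n j (suc (s ∸ suc c)) + - rowSum n j (s ∸ suc c)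
          ≡⟨ lemma (rowSum n j (suc (s ∸ suc c))) (rowSum n j (s ∸ suc c)) ⟩
        - rowSum n j (s ∸ suc c) + - - rowSum n j (suc (s ∸ suc c))
          ≡⟨ cong (λ e → - rowSum n j (s ∸ suc c) + - - rowSum n j e) (sym e) ⟩
        - rowSum n j (s ∸ suc c) + - - rowSum n j (s ∸ c) ∎
        where
        v : InTrapezoid r s (suc j) c
        v = s≤s z≤n , j<r , ℕₚ.≤-trans j<c₀ c₀≤c
          , subst (c ℕ.≤_) (sym pred-∸) (ℕₚ.<⇒≤pred c<s∸j)
        e : s ∸ c ≡ suc (s ∸ suc c)
        e = ∸-suc (ℕₚ.≤-trans c<s∸j (ℕₚ.m∸n≤m s j))
        lemma : ∀ x y → x + - y ≡ - y + - - x
        lemma = solve-∀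
      beyond : ∀ c → s ∸ j ℕ.≤ c → at f (suc j) c ≡ + 0
      beyond c s∸j≤c = at-outside f {suc j} {c} λ { (_ , _ , j<c , c≤) →
        ℕₚ.<-irrefl refl (ℕₚ.≤-<-trans (ℕₚ.≤-trans s∸j≤c c≤)
          (subst (ℕ._< s ∸ j) (sym pred-∸) (pred-< (ℕₚ.≤-trans (ℕₚ.≤-trans (s≤s z≤n) j<c₀) c₀≤)))) }
      open Telescope (at f (suc j)) (λ c → - rowSum n j (s ∸ c)) c₀ (s ∸ j) c₀≤
        (λ c c<c₀ → at-zero f (λ v → zeros c v c<c₀)) inside beyond

    row-zeros : ∀ f i → (∀ c v → f ⟨ i , c ∣ v ⟩ ≡ + 0) → Σℤ (map (at f i) (upTo (suc s))) ≡ + 0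
    row-zeros f i z = go (upTo (suc s))
      where
      go : ∀ cs → Σℤ (map (at f i) cs) ≡ + 0
      go []       = refl
      go (c ∷ cs) = cong₂ _+_ (at-zero f (z c)) (go cs)

    row-zero : ∀ f → Σℤ (map (at f 0) (upTo (suc s))) ≡ + 0
    row-zero f = row-zeros f 0 (λ { c (() , _) })

    -- The up-set of (i + 1, c₀) meets each row j + 1 ≤ i + 1 in the columns c₀, …, s − j − 1.
    upset-sum : ∀ n (f : T → ℤ) i c₀ (v₀ : InTrapezoid r s (suc i) c₀) →
      (∀ y → f y ≡ σ n (pred (Trapezoid.row y)) (s ∸ Trapezoid.col y)) →
      Σℤ (map f (filter (IsDecPartialOrder._≤?_ (⊑-isDecPartialOrder r s) ⟨ suc i , c₀ ∣ v₀ ⟩) (listT r s)))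
        ≡ σ (suc n) i (s ∸ c₀)
    upset-sum n f i c₀ v₀@(_ , i<r , i<c₀ , c₀≤) value = begin
      Σℤ (map f (filter (x₀ ≤?_) (listT r s)))
        ≡⟨ Σℤ-filter (x₀ ≤?_) f (listT r s) ⟩
      Σℤ (map g (listT r s))
        ≡⟨ Σ-listT g ⟩
      Σℤ (map rows (upTo (suc r)))
        ≡⟨ telescope (suc r) (s≤s i<r) ⟩
      columnSum n e (suc i) + - columnSum n e 0
        ≡⟨ cong (λ z → columnSum n e (suc i) + - z) (columnSum-zero n e) ⟩
      columnSum n e (suc i) + + 0
        ≡⟨ ℤₚ.+-identityʳ _ ⟩
      σ (suc n) i e ∎
      where
      open ≡-Reasoning
      open IsDecPartialOrder (⊑-isDecPartialOrder r s) using (_≤?_)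
      e = s ∸ c₀
      x₀ = ⟨ suc i , c₀ ∣ v₀ ⟩
      g : T → ℤ
      g y = if does (x₀ ≤? y) then f y else + 0
      rows : ℕ → ℤ
      rows k = Σℤ (map (at g k) (upTo (suc s)))
      g-above : ∀ y → _⊑_ r s x₀ y → g y ≡ f y
      g-above y le rewrite dec-true (x₀ ≤? y) le = refl
      g-other : ∀ y → ¬ _⊑_ r s x₀ y → g y ≡ + 0
      g-other y ≰ rewrite dec-false (x₀ ≤? y) ≰ = refl
      below : ∀ k → k ℕ.< 1 → rows k ≡ + 0
      below zero _ = row-zero g
      below (suc k) (s≤s ())
      inside : ∀ k → 1 ℕ.≤ k → k ℕ.< suc (suc i) → rows k ≡ columnSum n e (pred (suc k)) + - columnSum n e (pred k)
      inside (suc j) _ (s≤s (s≤s j≤i)) = trans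
        (row-telescope g n j c₀ (ℕₚ.≤-<-trans j≤i i<r) (ℕₚ.≤-trans (s≤s j≤i) i<c₀)
          (ℕₚ.≤-trans c₀≤ (ℕₚ.∸-monoʳ-≤ s (ℕₚ.m≤n⇒m≤1+n j≤i)))
          (ℕₚ.≤-trans (ℕₚ.m≤n⇒m≤1+n j≤i) (ℕₚ.≤-trans i<c₀ (ℕₚ.≤-trans c₀≤ (ℕₚ.m∸n≤m s (suc i)))))
          (λ c v c<c₀ → g-other _ λ { (_ , c₀≤c) → ℕₚ.<⇒≱ c<c₀ c₀≤c })
          (λ c v c₀≤c → trans (g-above _ (s≤s j≤i , c₀≤c)) (value _)))
        (sym (columnSum-step n e j))
      beyond : ∀ k → suc (suc i) ℕ.≤ k → rows k ≡ + 0
      beyond k i<k = row-zeros g k (λ c v → g-other _ λ { (k≤i , _) → ℕₚ.<⇒≱ i<k k≤i })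
      open Telescope rows (λ k → columnSum n e (pred k)) 1 (suc (suc i)) (s≤s z≤n) below inside beyond

    -- For c₀ = j + 1 the two products in the row sum are neighbouring values of the single function
    -- `Y`, since `γ (suc n) j` is `γ′ (suc n) (suc j)`. So the row sums telescope once more, and
    -- `Y` is zero at the first row.
    total-sum : ∀ n (f : T → ℤ) → 2 ℕ.* r ℕ.≤ s →
      (∀ y → f y ≡ σ n (pred (Trapezoid.row y)) (s ∸ Trapezoid.col y)) →
      Σℤ (map f (listT r s)) ≡ γ′ (suc n) r * γ′ (suc n) (s ∸ r)
    total-sum n f 2r≤s value = begin
      Σℤ (map f (listT r s))
        ≡⟨ Σ-listT f ⟩
      Σℤ (map rows (upTo (suc r)))
        ≡⟨ telescope (suc r) ℕₚ.≤-refl ⟩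
      γ′ (suc n) r * γ′ (suc n) (s ∸ r) + - (+ 0 * γ′ (suc n) s)
        ≡⟨ lemma (γ′ (suc n) r * γ′ (suc n) (s ∸ r)) (γ′ (suc n) s) ⟩
      γ′ (suc n) r * γ′ (suc n) (s ∸ r) ∎
      where
      open ≡-Reasoning
      lemma : ∀ x y → x + - (+ 0 * y) ≡ x
      lemma = solve-∀
      rows : ℕ → ℤ
      rows k = Σℤ (map (at f k) (upTo (suc s)))
      Y : ℕ → ℤ
      Y k = γ′ (suc n) (pred k) * γ′ (suc n) (s ∸ pred k)
      inside : ∀ k → 1 ℕ.≤ k → k ℕ.< suc r → rows k ≡ Y (suc k) + - Y k
      inside (suc j) _ (s≤s j<r) = trans
        (row-telescope f n j (suc j) j<r ℕₚ.≤-refl j<s∸j (ℕₚ.<⇒≤ j<s)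
          (λ c v c≤j → ⊥-elim (ℕₚ.<⇒≱ c≤j (let (_ , _ , j<c , _) = v in j<c)))
          (λ c v _ → value _))
        (cong (λ e → γ (suc n) j * γ′ (suc n) (s ∸ suc j) + - e)
          (trans (ℤₚ.*-comm (γ (suc n) (s ∸ suc j)) (γ′ (suc n) j))
                 (cong (λ e → γ′ (suc n) j * γ′ (suc n) e) (sym (∸-suc j<s)))))
        where
        -- Here 2r ≤ s enters: in each row the first column j + 1 does not exceed the end s - j of
        -- the telescoping window.
        2j<s : suc j ℕ.+ suc j ℕ.≤ s
        2j<s = ℕₚ.≤-trans (ℕₚ.+-mono-≤ j<r j<r) (subst (ℕ._≤ s) (cong (r ℕ.+_) (ℕₚ.+-identityʳ r)) 2r≤s)
        j<s : suc j ℕ.≤ s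
        j<s = ℕₚ.≤-trans (ℕₚ.m≤m+n (suc j) (suc j)) 2j<s
        j<s∸j : suc j ℕ.≤ s ∸ j
        j<s∸j = ℕₚ.≤-trans (ℕₚ.≤-trans (ℕₚ.≤-reflexive (sym (ℕₚ.m+n∸n≡m (suc j) (suc j)))) (ℕₚ.∸-monoˡ-≤ (suc j) 2j<s))
                            (ℕₚ.∸-monoʳ-≤ s (ℕₚ.n≤1+n j))
      below : ∀ k → k ℕ.< 1 → rows k ≡ + 0
      below zero _ = row-zero f
      below (suc k) (s≤s ())
      beyond : ∀ k → suc r ℕ.≤ k → rows k ≡ + 0
      beyond k r<k = row-zeros f k (λ { c (_ , k≤r , _) → ⊥-elim (ℕₚ.<⇒≱ r<k k≤r) })
      open Telescope rows Y 1 (suc r) (s≤s z≤n) below inside beyond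

-- Specialisation at q = 1 and the coefficients of the numerator

module NumeratorAtOne where

  open PowerSeriesFactors
  open WeakChains
  open MultichainCount
  open TrapezoidSums
  open import Data.Integer.Base as ℤ using (ℤ; +_; -_; _+_; _*_)
  open import Relation.Binary.PropositionalEquality

  φ : List ℤ → ℤ
  φ p = eval ℤ.+-*-rawRing p (+ 1)

  power-one : ∀ n → power ℤ.+-*-rawRing (+ 1) n ≡ + 1
  power-one zero    = refl
  power-one (suc n) = trans (ℤₚ.*-identityˡ _) (power-one n)

  φ-q^ : ∀ n → φ (q^ n) ≡ + 1
  φ-q^ n = trans (ℤPoly.eval-power (+ 0 ∷ + 1 ∷ []) (+ 1) n) (power-one n)

  module ℤSeries   = PowerSeries ℤₚ.+-*-commutativeRing
  module ℤ[q]Series = PowerSeries ℤ[q]-ring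

  φ-Δ : ∀ c f n → φ (ℤ[q]Series.Δ c f n) ≡ ℤSeries.Δ (φ c) (φ ∘ f) n
  φ-Δ c f zero    = refl
  φ-Δ c f (suc n) = trans (ℤPoly.eval-add (f (suc n)) (mulPoly ℤ.+-*-rawRing c (f n)) (+ 1))
                          (cong (_+_ (φ (f (suc n)))) (ℤPoly.eval-mul c (f n) (+ 1)))

  φ-Δs : ∀ cs f n → φ (ℤ[q]Series.Δs cs f n) ≡ ℤSeries.Δs (map φ cs) (φ ∘ f) n
  φ-Δs []       f n = refl
  φ-Δs (c ∷ cs) f n = trans (φ-Δ c (ℤ[q]Series.Δs cs f) n) (ℤSeries.Δ-cong (φ c) (φ-Δs cs f) n)

  map-const-replicate : ∀ {X Y : Set} {f : X → Y} {y} → (∀ x → f x ≡ y) → ∀ xs → map f xs ≡ replicate (length xs) y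
  map-const-replicate e []       = refl
  map-const-replicate e (x ∷ xs) = cong₂ _∷_ (e x) (map-const-replicate e xs)

  module _ (P : GradedPoset)
    (ρ-mono : ∀ x y → GradedPoset._≤_ P x y → x ≢ y → GradedPoset.ρ P x ℕ.< GradedPoset.ρ P y) where
    open GradedPoset P using (ρ)
    open WeakChainSeries ℤ[q]-ring (+ 0 ∷ + 1 ∷ []) P ρ-mono using (factors; series-Δs)

    φ-A : ∀ m → φ (A[_] P m) ≡ WeightedChains.A ℤ.+-*-rawRing (+ 1) P m
    φ-A m = trans (ℤPoly.eval-sumOf (map (λ xs → q^ (sum (map ρ xs))) (weakChains P m)) (+ 1))
      (cong Σℤ (trans (sym (map-∘ (weakChains P m)))
                      (map-cong (λ xs → ℤPoly.eval-power (+ 0 ∷ + 1 ∷ []) (+ 1) (sum (map ρ xs))) (weakChains P m))))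

    φ-factors : map φ factors ≡ replicate (suc (maxRank P)) (- + 1)
    φ-factors = trans (sym (map-∘ ranks)) (trans (map-const-replicate φ-neg ranks)
      (cong (λ k → replicate k (- + 1)) (length-upTo (suc (maxRank P)))))
      where
      ranks = upTo (suc (maxRank P))
      φ-neg : ∀ a → φ (map -_ (q^ a)) ≡ - + 1
      φ-neg a = trans (ℤPoly.eval-neg (q^ a) (+ 1)) (cong -_ (φ-q^ a))

    -- Evaluation at q = 1 is a ring homomorphism and sends every factor 1 - q^a t to 1 - t; the
    -- ranks 0, ..., H give H + 1 equal factors.
    φ-series : ∀ n → φ (WeightedChains.series ℤ[q] (+ 0 ∷ + 1 ∷ []) P n) ≡
                     Δ^ (suc (maxRank P)) (WeightedChains.A ℤ.+-*-rawRing (+ 1) P) n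
    φ-series n = begin
      φ (WeightedChains.series ℤ[q] (+ 0 ∷ + 1 ∷ []) P n)
        ≡⟨ ℤPoly.eval-cong (WeightedChains.series ℤ[q] (+ 0 ∷ + 1 ∷ []) P n) (ℤ[q]Series.Δs factors (A[_] P) n) (+ 1) (series-Δs n) ⟩
      φ (ℤ[q]Series.Δs factors (A[_] P) n)
        ≡⟨ φ-Δs factors (A[_] P) n ⟩
      ℤSeries.Δs (map φ factors) (φ ∘ A[_] P) n
        ≡⟨ cong (λ cs → ℤSeries.Δs cs (φ ∘ A[_] P) n) φ-factors ⟩
      Δ^ (suc (maxRank P)) (φ ∘ A[_] P) n
        ≡⟨ ℤSeries.Δs-cong (replicate (suc (maxRank P)) (- + 1)) φ-A n ⟩
      Δ^ (suc (maxRank P)) (WeightedChains.A ℤ.+-*-rawRing (+ 1) P) n ∎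
      where open ≡-Reasoning

    atq=1-coeff : ∀ ℍ → IsNumerator P ℍ → ∀ n →
      coeff ℤ.+-*-rawRing (atq=1 ℍ) n ≡ Δ^ (suc (maxRank P)) (WeightedChains.A ℤ.+-*-rawRing (+ 1) P) n
    atq=1-coeff ℍ isNumerator n = begin
      coeff ℤ.+-*-rawRing (atq=1 ℍ) n
        ≡⟨ coeff-map ℍ n ⟩
      φ (coeff ℤ[q] ℍ n)
        ≡⟨ ℤPoly.eval-cong (WeightedChains.series ℤ[q] (+ 0 ∷ + 1 ∷ []) P n) (coeff ℤ[q] ℍ n) (+ 1) (isNumerator n) ⟨
      φ (WeightedChains.series ℤ[q] (+ 0 ∷ + 1 ∷ []) P n)
        ≡⟨ φ-series n ⟩
      Δ^ (suc (maxRank P)) (WeightedChains.A ℤ.+-*-rawRing (+ 1) P) n ∎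
      where
      open ≡-Reasoning
      coeff-map : ∀ p n → coeff ℤ.+-*-rawRing (map φ p) n ≡ φ (coeff ℤ[q] p n)
      coeff-map []      n       = refl
      coeff-map (a ∷ p) zero    = refl
      coeff-map (a ∷ p) (suc n) = coeff-map p n

  rankT-mono : ∀ r s (x y : Trapezoid r s) → _⊑_ r s x y → x ≢ y → rankT r s x ℕ.< rankT r s y
  rankT-mono r s x@(⟨ i , c ∣ _ , _ , i≤c , _ ⟩) y@(⟨ j , d ∣ _ ⟩) (j≤i , c≤d) x≢y with ℕₚ.m≤n⇒m<n∨m≡n c≤d
  ... | inj₁ c<d = ℕₚ.<-≤-trans (ℕₚ.∸-monoˡ-< c<d i≤c) (ℕₚ.∸-monoʳ-≤ d j≤i)
  ... | inj₂ refl with ℕₚ.m≤n⇒m<n∨m≡n j≤i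
  ...   | inj₁ j<i  = ℕₚ.∸-monoʳ-< j<i i≤c
  ...   | inj₂ refl = ⊥-elim (x≢y (Trapezoid-≡ r s refl refl))

  foldr-⊔-bound : ∀ {X : Set} (f : X → ℕ) b → (∀ x → f x ℕ.≤ b) → ∀ xs → foldr _⊔_ 0 (map f xs) ℕ.≤ b
  foldr-⊔-bound f b f≤b []       = z≤n
  foldr-⊔-bound f b f≤b (x ∷ xs) = ℕₚ.⊔-lub (f≤b x) (foldr-⊔-bound f b f≤b xs)

  module _ (a b : ℕ) where

    private
      r = suc a
      s = suc a ℕ.+ suc b

    module _ (2≤2r : 2 ℕ.≤ 2 ℕ.* r) (2r≤s : 2 ℕ.* r ℕ.≤ s) where

      private
        P = trapezoidal r s 2≤2r 2r≤s

      -- The largest rank is s - 2, attained at the top element. It makes H + 1 the exponent that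
      -- `Δ^-U` requires.
      maxRank-trapezoidal : maxRank P ≡ a ℕ.+ b
      maxRank-trapezoidal = ℕₚ.≤-antisym (foldr-⊔-bound (rankT r s) (a ℕ.+ b) bound (listT r s))
        (subst (ℕ._≤ maxRank P) rank-top
          (WeakChainSeries.ρ≤maxRank ℤₚ.+-*-commutativeRing (+ 1) P (rankT-mono r s) (GradedPoset.top P)))
        where
        rank-top : rankT r s (GradedPoset.top P) ≡ a ℕ.+ b
        rank-top = cong pred (ℕₚ.+-suc a b)
        bound : ∀ x → rankT r s x ℕ.≤ a ℕ.+ b
        bound ⟨ suc i , c ∣ _ , _ , i≤c , c≤ ⟩ =
          ℕₚ.≤-trans (ℕₚ.∸-mono (ℕₚ.≤-trans c≤ (ℕₚ.m∸n≤m (a ℕ.+ suc b) i)) (s≤s z≤n)) (ℕₚ.≤-reflexive rank-top)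

      open WeakChainSeries ℤₚ.+-*-commutativeRing (+ 1) P (rankT-mono r s) using (S; A-zero; A-suc)

      S≡σ : ∀ m y → S m y ≡ σ m (pred (Trapezoid.row y)) (s ∸ Trapezoid.col y)
      S≡σ zero y@(⟨ suc i , c ∣ _ , _ , i≤c , c≤ ⟩) = trans (power-one (rankT r s y))
        (sym (trans (cong (σ 0 i) (∸-suc c<s)) (σ-zero i (s ∸ suc c))))
        where
        c<s : c ℕ.< s
        c<s = s≤s (ℕₚ.≤-trans c≤ (ℕₚ.m∸n≤m (a ℕ.+ suc b) i))
      S≡σ (suc m) y@(⟨ suc i , c ∣ v ⟩) = trans (cong (_* rest) (power-one (rankT r s y)))
        (trans (ℤₚ.*-identityˡ rest) (upset-sum r s m (S m) i c v (S≡σ m)))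
        where rest = Σℤ (map (S m) (filter (GradedPoset._≤?_ P y) (listT r s)))

      A≡U : ∀ m → WeightedChains.A ℤ.+-*-rawRing (+ 1) P m ≡ U a b m
      A≡U zero    = A-zero
      A≡U (suc m) = trans (A-suc m) (trans (total-sum r s m (S m) 2r≤s (S≡σ m))
        (cong (λ e → γ (suc m) a * γ′ (suc m) e) (ℕₚ.m+n∸m≡n a (suc b))))

      numerator-coeff : ∀ ℍ → IsNumerator P ℍ → ∀ n → coeff ℤ.+-*-rawRing (atq=1 ℍ) n ≡ h a b n
      numerator-coeff ℍ isNumerator n = begin
        coeff ℤ.+-*-rawRing (atq=1 ℍ) n
          ≡⟨ atq=1-coeff P (rankT-mono r s) ℍ isNumerator n ⟩
        Δ^ (suc (maxRank P)) (WeightedChains.A ℤ.+-*-rawRing (+ 1) P) n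
          ≡⟨ cong (λ k → Δ^ (suc k) (WeightedChains.A ℤ.+-*-rawRing (+ 1) P) n) maxRank-trapezoidal ⟩
        Δ^ (suc (a ℕ.+ b)) (WeightedChains.A ℤ.+-*-rawRing (+ 1) P) n
          ≡⟨ ℤSeries.Δs-cong (replicate (suc (a ℕ.+ b)) (- + 1)) A≡U n ⟩
        Δ^ (suc (a ℕ.+ b)) (U a b) n
          ≡⟨ Δ^-U a b n ⟩
        h a b n ∎
        where open ≡-Reasoning

-- The ring of Cauchy reals, positivity and cancellation

module RealRing where

  open import Data.Rational.Base using (0ℚ; 1ℚ; ½; _+_; _*_; -_; _-_; _<_; _≤_; ∣_∣; positive; nonNegative)
  open import Data.Rational.Properties as ℚₚ using (_≟_)
  open import Relation.Binary.PropositionalEquality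
  open import Relation.Nullary.Decidable using (dec⇒maybe)
  open import Tactic.RingSolver using (solve-∀)
  open import Tactic.RingSolver.Core.AlmostCommutativeRing using (AlmostCommutativeRing; fromCommutativeRing)

  ℚ-ring : AlmostCommutativeRing 0ℓ 0ℓ
  ℚ-ring = fromCommutativeRing ℚₚ.+-*-commutativeRing (λ x → dec⇒maybe (0ℚ ≟ x))

  ½<1 : ∀ {ε} → 0ℚ < ε → ½ * ε < ε
  ½<1 {ε} 0<ε = subst₂ _<_ (ℚₚ.+-identityʳ (½ * ε)) (halves ε) (ℚₚ.+-monoʳ-< (½ * ε) (half-pos 0<ε))

  *-pos : ∀ {x y} → 0ℚ < x → 0ℚ < y → 0ℚ < x * y
  *-pos {x} {y} 0<x 0<y = subst (_< x * y) (ℚₚ.*-zeroʳ x) (ℚₚ.*-monoʳ-<-pos x {{positive 0<x}} 0<y)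

  p≤∣p∣ : ∀ p → p ≤ ∣ p ∣
  p≤∣p∣ p with ℚₚ.≤-total 0ℚ p
  ... | inj₁ 0≤p = ℚₚ.≤-reflexive (sym (ℚₚ.0≤p⇒∣p∣≡p 0≤p))
  ... | inj₂ p≤0 = ℚₚ.≤-trans p≤0 0≤∣ p ∣

  ∣-∣-sym : ∀ x y → ∣ x - y ∣ ≡ ∣ y - x ∣
  ∣-∣-sym x y = trans (sym (ℚₚ.∣-p∣≡∣p∣ (x - y))) (cong ∣_∣ (lemma x y))
    where
    lemma : ∀ x y → - (x + - y) ≡ y + - x
    lemma = solve-∀ ℚ-ring

  ∣-∣-triangle : ∀ x y z → ∣ x - z ∣ ≤ ∣ x - y ∣ + ∣ y - z ∣
  ∣-∣-triangle x y z = subst (λ w → ∣ w ∣ ≤ ∣ x - y ∣ + ∣ y - z ∣) (lemma x y z) (ℚₚ.∣p+q∣≤∣p∣+∣q∣ (x - y) (y - z))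
    where
    lemma : ∀ x y z → (x + - y) + (y + - z) ≡ x + - z
    lemma = solve-∀ ℚ-ring

  private
    shift-lemma : ∀ a b c d → b - a ≡ d - c → b + (c - a) ≡ d
    shift-lemma a b c d e = trans (lemma b a c) (trans (cong (_+ c) e) (lemma′ c d))
      where
      lemma : ∀ b a c → b + (c + - a) ≡ (b + - a) + c
      lemma = solve-∀ ℚ-ring
      lemma′ : ∀ c d → (d + - c) + c ≡ d
      lemma′ = solve-∀ ℚ-ring

    shift-lemma′ : ∀ a c → a + (c + - a) ≡ c
    shift-lemma′ = solve-∀ ℚ-ring

  -- Only the difference of the two sides matters for an inequality, so every linear rearrangement
  -- reduces to an identity for the ring solver.
  <-shift : ∀ {a b c d} → a < b → b - a ≡ d - c → c < d
  <-shift {a} {b} {c} {d} a<b e = subst₂ _<_ (shift-lemma′ a c) (shift-lemma a b c d e) (ℚₚ.+-monoˡ-< (c - a) a<b)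

  ≤-shift : ∀ {a b c d} → a ≤ b → b - a ≡ d - c → c ≤ d
  ≤-shift {a} {b} {c} {d} a≤b e = subst₂ _≤_ (shift-lemma′ a c) (shift-lemma a b c d e) (ℚₚ.+-monoˡ-≤ (c - a) a≤b)

  -- Real arithmetic acts term by term on sequences, so polynomial identities over ℚ carry over to ℝ
  -- through this lemma.
  ≃-pointwise : ∀ x y → (∀ n → seq x n ≡ seq y n) → x ≃ y
  ≃-pointwise x y e ε 0<ε = 0 , λ n _ →
    subst (λ z → ∣ z ∣ < ε) (sym (trans (cong (_- seq y n) (e n)) (ℚₚ.+-inverseʳ (seq y n)))) 0<ε

  ≃-refl : ∀ {x} → x ≃ x
  ≃-refl {x} = ≃-pointwise x x (λ _ → refl)

  ≃-sym : ∀ {x y} → x ≃ y → y ≃ x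
  ≃-sym {x} {y} e ε 0<ε = let (N , close) = e ε 0<ε in
    N , λ n le → subst (_< ε) (∣-∣-sym (seq x n) (seq y n)) (close n le)

  ≃-trans : ∀ {x y z} → x ≃ y → y ≃ z → x ≃ z
  ≃-trans {x} {y} {z} e f ε 0<ε =
    let (M , closeˣʸ) = e (½ * ε) (half-pos 0<ε)
        (N , closeʸᶻ) = f (½ * ε) (half-pos 0<ε)
    in M ⊔ N , λ n le → ℚₚ.≤-<-trans (∣-∣-triangle (seq x n) (seq y n) (seq z n))
         (subst (∣ seq x n - seq y n ∣ + ∣ seq y n - seq z n ∣ <_) (halves ε)
           (ℚₚ.+-mono-< (closeˣʸ n (ℕₚ.m⊔n≤o⇒m≤o M N le)) (closeʸᶻ n (ℕₚ.m⊔n≤o⇒n≤o M N le))))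

  addℝ-congˡ : ∀ {x y} z → x ≃ y → addℝ x z ≃ addℝ y z
  addℝ-congˡ {x} {y} z e ε 0<ε = let (N , close) = e ε 0<ε in
    N , λ n le → subst (λ w → ∣ w ∣ < ε) (lemma (seq x n) (seq y n) (seq z n)) (close n le)
    where
    lemma : ∀ x y z → x + - y ≡ (x + z) + - (y + z)
    lemma = solve-∀ ℚ-ring

  addℝ-comm : ∀ x y → addℝ x y ≃ addℝ y x
  addℝ-comm x y = ≃-pointwise (addℝ x y) (addℝ y x) (λ n → ℚₚ.+-comm (seq x n) (seq y n))

  addℝ-cong : ∀ {x y z w} → x ≃ y → z ≃ w → addℝ x z ≃ addℝ y w
  addℝ-cong {x} {y} {z} {w} e f =
    ≃-trans {addℝ x z} {addℝ y z} {addℝ y w} (addℝ-congˡ {x} {y} z e)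
    (≃-trans {addℝ y z} {addℝ z y} {addℝ y w} (addℝ-comm y z)
    (≃-trans {addℝ z y} {addℝ w y} {addℝ y w} (addℝ-congˡ {z} {w} y f) (addℝ-comm w y)))

  negℝ-cong : ∀ {x y} → x ≃ y → negℝ x ≃ negℝ y
  negℝ-cong {x} {y} e ε 0<ε = let (N , close) = e ε 0<ε in
    N , λ n le → subst (_< ε) (trans (sym (ℚₚ.∣-p∣≡∣p∣ (seq x n - seq y n))) (cong ∣_∣ (lemma (seq x n) (seq y n)))) (close n le)
    where
    lemma : ∀ x y → - (x + - y) ≡ - x + - - y
    lemma = solve-∀ ℚ-ring

  mulℝ-comm : ∀ x y → mulℝ x y ≃ mulℝ y x
  mulℝ-comm x y = ≃-pointwise (mulℝ x y) (mulℝ y x) (λ n → ℚₚ.*-comm (seq x n) (seq y n))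

  mulℝ-congˡ : ∀ {x y} z → x ≃ y → mulℝ x z ≃ mulℝ y z
  mulℝ-congˡ {x} {y} z e ε 0<ε =
    let (K , 0<K , M , ∣z∣≤K) = bounded z
        (δ , 0<δ , Kδ≡)       = shrink K ε 0<K 0<ε
        (N , close)           = e δ 0<δ
    in M ⊔ N , λ n le → subst (λ w → ∣ w ∣ < ε) (lemma (seq x n) (seq y n) (seq z n))
         (ℚₚ.<-trans (mul-bound (seq z n) (seq x n - seq y n) 0<K
                        (∣z∣≤K n (ℕₚ.m⊔n≤o⇒m≤o M N le)) (close n (ℕₚ.m⊔n≤o⇒n≤o M N le)))
                     (subst (_< ε) (sym Kδ≡) (½<1 0<ε)))
    where
    lemma : ∀ x y z → z * (x + - y) ≡ x * z + - (y * z)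
    lemma = solve-∀ ℚ-ring

  mulℝ-cong : ∀ {x y z w} → x ≃ y → z ≃ w → mulℝ x z ≃ mulℝ y w
  mulℝ-cong {x} {y} {z} {w} e f =
    ≃-trans {mulℝ x z} {mulℝ y z} {mulℝ y w} (mulℝ-congˡ {x} {y} z e)
    (≃-trans {mulℝ y z} {mulℝ z y} {mulℝ y w} (mulℝ-comm y z)
    (≃-trans {mulℝ z y} {mulℝ w y} {mulℝ y w} (mulℝ-congˡ {z} {w} y f) (mulℝ-comm w y)))

  ℝ-commutativeRing : CommutativeRing 0ℓ 0ℓ
  ℝ-commutativeRing = record
    { RawRing ℝ-ring
    ; isCommutativeRing = record
      { isRing = record
        { +-isAbelianGroup = record
          { isGroup = record
            { isMonoid = record
              { isSemigroup = record
                { isMagma = record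
                  { isEquivalence = record
                    { refl  = λ {x} → ≃-refl {x}
                    ; sym   = λ {x} {y} → ≃-sym {x} {y}
                    ; trans = λ {x} {y} {z} → ≃-trans {x} {y} {z}
                    }
                  ; ∙-cong = λ {x} {y} {z} {w} → addℝ-cong {x} {y} {z} {w}
                  }
                ; assoc = λ x y z → ≃-pointwise (addℝ (addℝ x y) z) (addℝ x (addℝ y z))
                                      (λ n → ℚₚ.+-assoc (seq x n) (seq y n) (seq z n))
                }
              ; identity = (λ x → ≃-pointwise (addℝ (constℝ 0ℚ) x) x (λ n → ℚₚ.+-identityˡ (seq x n)))
                         , (λ x → ≃-pointwise (addℝ x (constℝ 0ℚ)) x (λ n → ℚₚ.+-identityʳ (seq x n)))
              }
            ; inverse = (λ x → ≃-pointwise (addℝ (negℝ x) x) (constℝ 0ℚ) (λ n → ℚₚ.+-inverseˡ (seq x n)))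
                      , (λ x → ≃-pointwise (addℝ x (negℝ x)) (constℝ 0ℚ) (λ n → ℚₚ.+-inverseʳ (seq x n)))
            ; ⁻¹-cong = λ {x} {y} → negℝ-cong {x} {y}
            }
          ; comm = addℝ-comm
          }
        ; *-cong = λ {x} {y} {z} {w} → mulℝ-cong {x} {y} {z} {w}
        ; *-assoc = λ x y z → ≃-pointwise (mulℝ (mulℝ x y) z) (mulℝ x (mulℝ y z))
                                (λ n → ℚₚ.*-assoc (seq x n) (seq y n) (seq z n))
        ; *-identity = (λ x → ≃-pointwise (mulℝ (constℝ 1ℚ) x) x (λ n → ℚₚ.*-identityˡ (seq x n)))
                     , (λ x → ≃-pointwise (mulℝ x (constℝ 1ℚ)) x (λ n → ℚₚ.*-identityʳ (seq x n)))
        ; distrib = (λ x y z → ≃-pointwise (mulℝ x (addℝ y z)) (addℝ (mulℝ x y) (mulℝ x z))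
                                 (λ n → ℚₚ.*-distribˡ-+ (seq x n) (seq y n) (seq z n)))
                  , (λ x y z → ≃-pointwise (mulℝ (addℝ y z) x) (addℝ (mulℝ y x) (mulℝ z x))
                                 (λ n → ℚₚ.*-distribʳ-+ (seq x n) (seq y n) (seq z n)))
        }
      ; *-comm = mulℝ-comm
      }
    }

  -- The uniform margin ε makes positivity stable under `≃` and closed under products, and it
  -- supplies the bound that rational approximations inherit.
  Positive : ℝ → Set
  Positive x = ∃[ ε ] 0ℚ < ε × ∃[ N ] ∀ n → N ℕ.≤ n → ε < seq x n

  positive-cong : ∀ {x y} → x ≃ y → Positive x → Positive y
  positive-cong {x} {y} e (ε , 0<ε , M , ε<x) =
    let (N , close) = e (½ * ε) (half-pos 0<ε) in
    ½ * ε , half-pos 0<ε , M ⊔ N , λ n le →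
      let a = seq x n ; b = seq y n in
      <-shift (ℚₚ.+-mono-< (ε<x n (ℕₚ.m⊔n≤o⇒m≤o M N le))
                           (ℚₚ.≤-<-trans (p≤∣p∣ (a - b)) (close n (ℕₚ.m⊔n≤o⇒n≤o M N le))))
              (trans (cong (λ w → (a + ½ * ε) - (w + (a - b))) (sym (halves ε))) (lemma (½ * ε) a b))
    where
    lemma : ∀ h a b → (a + h) + - ((h + h) + (a + - b)) ≡ b + - h
    lemma = solve-∀ ℚ-ring

  positive-* : ∀ {x y} → Positive x → Positive y → Positive (mulℝ x y)
  positive-* {x} {y} (ε , 0<ε , M , ε<x) (δ , 0<δ , N , δ<y) =
    ε * δ , *-pos 0<ε 0<δ , M ⊔ N , λ n le →
      let ε<xₙ = ε<x n (ℕₚ.m⊔n≤o⇒m≤o M N le) ; δ<yₙ = δ<y n (ℕₚ.m⊔n≤o⇒n≤o M N le) in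
      ℚₚ.<-trans (ℚₚ.*-monoʳ-<-pos ε {{positive 0<ε}} δ<yₙ)
                 (ℚₚ.*-monoˡ-<-pos (seq y n) {{positive (ℚₚ.<-trans 0<δ δ<yₙ)}} ε<xₙ)

  positive-+ : ∀ {x y} → Positive x → Positive y → Positive (addℝ x y)
  positive-+ {x} {y} (ε , 0<ε , M , ε<x) (δ , 0<δ , N , δ<y) =
    ε + δ , ℚₚ.+-mono-< 0<ε 0<δ , M ⊔ N , λ n le →
      ℚₚ.+-mono-< (ε<x n (ℕₚ.m⊔n≤o⇒m≤o M N le)) (δ<y n (ℕₚ.m⊔n≤o⇒n≤o M N le))

  positive-const : ∀ {p} → 0ℚ < p → Positive (constℝ p)
  positive-const {p} 0<p = ½ * p , half-pos 0<p , 0 , λ _ _ → ½<1 0<p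

  <ℝ⇒positive : ∀ {x y} → x <ℝ y → Positive (addℝ y (negℝ x))
  <ℝ⇒positive {x} {y} (ε , 0<ε , N , x+ε<y) = ε , 0<ε , N , λ n le → <-shift (x+ε<y n le) (lemma (seq x n) (seq y n) ε)
    where
    lemma : ∀ x y ε → y + - (x + ε) ≡ (y + - x) + - ε
    lemma = solve-∀ ℚ-ring

  positive⇒<ℝ : ∀ {x y} → Positive (addℝ y (negℝ x)) → x <ℝ y
  positive⇒<ℝ {x} {y} (ε , 0<ε , N , ε<y-x) = ε , 0<ε , N , λ n le → <-shift (ε<y-x n le) (lemma (seq x n) (seq y n) ε)
    where
    lemma : ∀ x y ε → (y + - x) + - ε ≡ y + - (x + ε)
    lemma = solve-∀ ℚ-ring

  <ℝ-trans : ∀ {x y z} → x <ℝ y → y <ℝ z → x <ℝ z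
  <ℝ-trans {x} {y} {z} x<y y<z = positive⇒<ℝ {x} {z}
    (positive-cong {addℝ (addℝ z (negℝ y)) (addℝ y (negℝ x))} {addℝ z (negℝ x)}
      (≃-pointwise (addℝ (addℝ z (negℝ y)) (addℝ y (negℝ x))) (addℝ z (negℝ x)) (λ n → lemma (seq x n) (seq y n) (seq z n)))
      (positive-+ {addℝ z (negℝ y)} {addℝ y (negℝ x)} (<ℝ⇒positive {y} {z} y<z) (<ℝ⇒positive {x} {y} x<y)))
    where
    lemma : ∀ x y z → (z + - y) + (y + - x) ≡ z + - x
    lemma = solve-∀ ℚ-ring

  -- No inverse of x is formed: from some index on ε < x, so the terms of y are at most those of xy
  -- divided by ε in absolute value.
  positive-cancel : ∀ {x y} → Positive x → mulℝ x y ≃ constℝ 0ℚ → y ≃ constℝ 0ℚ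
  positive-cancel {x} {y} (ε , 0<ε , M , ε<x) xy≃0 η 0<η =
    let (N , close) = xy≃0 (ε * η) (*-pos 0<ε 0<η) in
    M ⊔ N , λ n le →
      let a = seq x n ; b = seq y n
          ε<a = ε<x n (ℕₚ.m⊔n≤o⇒m≤o M N le)
          0<a = ℚₚ.<-trans 0<ε ε<a
          open ℚₚ.≤-Reasoning
      in subst (λ w → ∣ w ∣ < η) (sym (ℚₚ.+-identityʳ b)) (ℚₚ.*-cancelˡ-<-nonNeg ε {{nonNegative (ℚₚ.<⇒≤ 0<ε)}} (begin-strict
        ε * ∣ b ∣  ≤⟨ ℚₚ.*-monoʳ-≤-nonNeg ∣ b ∣ {{ℚₚ.∣-∣-nonNeg b}} (ℚₚ.<⇒≤ ε<a) ⟩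
        a * ∣ b ∣  ≡⟨ cong (_* ∣ b ∣) (ℚₚ.0≤p⇒∣p∣≡p (ℚₚ.<⇒≤ 0<a)) ⟨
        ∣ a ∣ * ∣ b ∣  ≡⟨ ℚₚ.∣p*q∣≡∣p∣*∣q∣ a b ⟨
        ∣ a * b ∣  ≡⟨ cong ∣_∣ (ℚₚ.+-identityʳ (a * b)) ⟨
        ∣ a * b - 0ℚ ∣  <⟨ close n (ℕₚ.m⊔n≤o⇒n≤o M N le) ⟩
        ε * η  ∎))

  #-cancel : ∀ {x z y} → x # z → mulℝ (addℝ x (negℝ z)) y ≃ constℝ 0ℚ → y ≃ constℝ 0ℚ
  #-cancel {x} {z} {y} (inj₂ z<x) e = positive-cancel {addℝ x (negℝ z)} {y} (<ℝ⇒positive {z} {x} z<x) e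
  #-cancel {x} {z} {y} (inj₁ x<z) e = positive-cancel {addℝ z (negℝ x)} {y} (<ℝ⇒positive {x} {z} x<z)
    (≃-trans {mulℝ (addℝ z (negℝ x)) y} {negℝ (mulℝ (addℝ x (negℝ z)) y)} {constℝ 0ℚ}
      (≃-pointwise (mulℝ (addℝ z (negℝ x)) y) (negℝ (mulℝ (addℝ x (negℝ z)) y)) (λ n → lemma (seq x n) (seq y n) (seq z n)))
      (negℝ-cong {mulℝ (addℝ x (negℝ z)) y} {constℝ 0ℚ} e))
    where
    lemma : ∀ x y z → (z + - x) * y ≡ - ((x + - z) * y)
    lemma = solve-∀ ℚ-ring

-- Embedding of the integers into ℚ and the archimedean property

module RationalLemmas where

  open RealRing
  open import Data.Integer.Base as ℤ using (ℤ; +_)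
  open import Data.Rational.Base
  open import Data.Rational.Properties as ℚₚ using ()
  open import Data.Rational.Unnormalised.Base as ℚᵘ using (mkℚᵘ; *≡*; *≤*)
  import Data.Rational.Unnormalised.Properties as ℚᵘₚ
  open import Relation.Binary.PropositionalEquality
  open import Tactic.RingSolver using (solve-∀)

  toℚᵘ-ℤ→ℚ : ∀ z → toℚᵘ (ℤ→ℚ z) ℚᵘ.≃ mkℚᵘ z 0
  toℚᵘ-ℤ→ℚ z = ℚₚ.toℚᵘ-fromℚᵘ (mkℚᵘ z 0)

  -- Rationals are stored in lowest terms; on unnormalised fractions with denominator 1 the identity
  -- is a computation in ℤ.
  ℤ→ℚ-+ : ∀ a b → ℤ→ℚ (a ℤ.+ b) ≡ ℤ→ℚ a + ℤ→ℚ b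
  ℤ→ℚ-+ a b = ℚₚ.toℚᵘ-injective (begin
    toℚᵘ (ℤ→ℚ (a ℤ.+ b))  ≈⟨ toℚᵘ-ℤ→ℚ (a ℤ.+ b) ⟩
    mkℚᵘ (a ℤ.+ b) 0  ≈⟨ *≡* (cong (ℤ._* + 1) (cong₂ ℤ._+_ (ℤₚ.*-identityʳ a) (ℤₚ.*-identityʳ b))) ⟨
    mkℚᵘ a 0 ℚᵘ.+ mkℚᵘ b 0  ≈⟨ ℚᵘₚ.+-cong (toℚᵘ-ℤ→ℚ a) (toℚᵘ-ℤ→ℚ b) ⟨
    toℚᵘ (ℤ→ℚ a) ℚᵘ.+ toℚᵘ (ℤ→ℚ b)  ≈⟨ ℚₚ.toℚᵘ-homo-+ (ℤ→ℚ a) (ℤ→ℚ b) ⟨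
    toℚᵘ (ℤ→ℚ a + ℤ→ℚ b)  ∎)
    where open ℚᵘₚ.≃-Reasoning

  ℤ→ℚ-* : ∀ a b → ℤ→ℚ (a ℤ.* b) ≡ ℤ→ℚ a * ℤ→ℚ b
  ℤ→ℚ-* a b = ℚₚ.toℚᵘ-injective (begin
    toℚᵘ (ℤ→ℚ (a ℤ.* b))  ≈⟨ toℚᵘ-ℤ→ℚ (a ℤ.* b) ⟩
    mkℚᵘ (a ℤ.* b) 0  ≈⟨ *≡* refl ⟩
    mkℚᵘ a 0 ℚᵘ.* mkℚᵘ b 0  ≈⟨ ℚᵘₚ.*-cong (toℚᵘ-ℤ→ℚ a) (toℚᵘ-ℤ→ℚ b) ⟨
    toℚᵘ (ℤ→ℚ a) ℚᵘ.* toℚᵘ (ℤ→ℚ b)  ≈⟨ ℚₚ.toℚᵘ-homo-* (ℤ→ℚ a) (ℤ→ℚ b) ⟨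
    toℚᵘ (ℤ→ℚ a * ℤ→ℚ b)  ∎)
    where open ℚᵘₚ.≃-Reasoning

  ℕ→ℚ-+ : ∀ m n → ℕ→ℚ (m ℕ.+ n) ≡ ℕ→ℚ m + ℕ→ℚ n
  ℕ→ℚ-+ m n = trans (cong ℤ→ℚ (ℤₚ.pos-+ m n)) (ℤ→ℚ-+ (+ m) (+ n))

  ℕ→ℚ-* : ∀ m n → ℕ→ℚ (m ℕ.* n) ≡ ℕ→ℚ m * ℕ→ℚ n
  ℕ→ℚ-* m n = trans (cong ℤ→ℚ (ℤₚ.pos-* m n)) (ℤ→ℚ-* (+ m) (+ n))

  ℕ→ℚ-suc : ∀ n → ℕ→ℚ (suc n) ≡ 1ℚ + ℕ→ℚ n
  ℕ→ℚ-suc n = ℕ→ℚ-+ 1 n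

  ℕ→ℚ-mono : ∀ {m n} → m ℕ.≤ n → ℕ→ℚ m ≤ ℕ→ℚ n
  ℕ→ℚ-mono {m} {n} m≤n = ℚₚ.toℚᵘ-cancel-≤ (ℚᵘₚ.≤-respˡ-≃ (ℚᵘₚ.≃-sym (toℚᵘ-ℤ→ℚ (+ m)))
    (ℚᵘₚ.≤-respʳ-≃ (ℚᵘₚ.≃-sym (toℚᵘ-ℤ→ℚ (+ n))) (*≤* (ℤₚ.*-monoʳ-≤-nonNeg (+ 1) (ℤ.+≤+ m≤n)))))

  0≤ℕ→ℚ : ∀ n → 0ℚ ≤ ℕ→ℚ n
  0≤ℕ→ℚ n = ℕ→ℚ-mono {0} {n} z≤n

  0<ℕ→ℚ-suc : ∀ n → 0ℚ < ℕ→ℚ (suc n)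
  0<ℕ→ℚ-suc n = ℚₚ.<-≤-trans (ℚₚ.positive⁻¹ 1ℚ) (ℕ→ℚ-mono {1} {suc n} (s≤s z≤n))

  archimedean : ∀ δ → 0ℚ < δ → ∃[ N ] 1ℚ ≤ δ * ℕ→ℚ N
  -- The witness is the denominator of δ: the product is then the numerator, a positive integer.
  archimedean δ@(mkℚ (+ suc a) d c) 0<δ = suc d , ℚₚ.toℚᵘ-cancel-≤ (begin
    mkℚᵘ (+ 1) 0  ≤⟨ *≤* (ℤ.+≤+ bound) ⟩
    mkℚᵘ (+ suc a) d ℚᵘ.* mkℚᵘ (+ suc d) 0 ≃⟨ ℚᵘₚ.*-cong (ℚᵘₚ.≃-refl {toℚᵘ δ}) (toℚᵘ-ℤ→ℚ (+ suc d)) ⟨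
    toℚᵘ δ ℚᵘ.* toℚᵘ (ℕ→ℚ (suc d))  ≃⟨ ℚₚ.toℚᵘ-homo-* δ (ℕ→ℚ (suc d)) ⟨
    toℚᵘ (δ * ℕ→ℚ (suc d))  ∎)
    where
    open ℚᵘₚ.≤-Reasoning
    bound : 1 ℕ.* (suc d ℕ.* 1) ℕ.≤ suc a ℕ.* suc d ℕ.* 1
    bound = ℕₚ.≤-trans (ℕₚ.≤-reflexive (trans (ℕₚ.*-identityˡ _) (ℕₚ.*-identityʳ (suc d))))
      (ℕₚ.≤-trans (ℕₚ.m≤m+n (suc d) (a ℕ.* suc d)) (ℕₚ.≤-reflexive (sym (ℕₚ.*-identityʳ (suc a ℕ.* suc d)))))
  archimedean δ@(mkℚ (+ 0) d c) 0<δ with () ← positive 0<δ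
  archimedean δ@(mkℚ (ℤ.-[1+ n ]) d c) 0<δ with () ← positive 0<δ

  halving : ℚ → ℕ → ℚ
  halving C zero    = C
  halving C (suc n) = ½ * halving C n

  module _ {C : ℚ} (0<C : 0ℚ < C) where

    halving-pos : ∀ n → 0ℚ < halving C n
    halving-pos zero    = 0<C
    halving-pos (suc n) = half-pos (halving-pos n)

    -- The linear bound n + 1 ≤ 2^n is enough for convergence to 0; its induction step is n + 2 ≤ 2
    -- (n + 1).
    halving-bound : ∀ n → halving C n * ℕ→ℚ (suc n) ≤ C
    halving-bound zero    = ℚₚ.≤-reflexive (ℚₚ.*-identityʳ C)
    halving-bound (suc n) = begin
      ½ * w * ℕ→ℚ (suc (suc n))  ≤⟨ ℚₚ.*-monoˡ-≤-nonNeg (½ * w) {{nonNegative (ℚₚ.<⇒≤ (halving-pos (suc n)))}}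
                                               (ℕ→ℚ-mono {suc (suc n)} {suc n ℕ.+ suc n}
                                                 (s≤s (ℕₚ.m≤n+m (suc n) n))) ⟩
      ½ * w * ℕ→ℚ (suc n ℕ.+ suc n)  ≡⟨ cong (½ * w *_) (ℕ→ℚ-+ (suc n) (suc n)) ⟩
      ½ * w * (ℕ→ℚ (suc n) + ℕ→ℚ (suc n)) ≡⟨ lemma ½ w (ℕ→ℚ (suc n)) ⟩
      (½ + ½) * (w * ℕ→ℚ (suc n))  ≡⟨ ℚₚ.*-identityˡ (w * ℕ→ℚ (suc n)) ⟩
      w * ℕ→ℚ (suc n)  ≤⟨ halving-bound n ⟩
      C  ∎
      where
      open ℚₚ.≤-Reasoning
      w = halving C n
      lemma : ∀ h w x → h * w * (x + x) ≡ (h + h) * (w * x)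
      lemma = solve-∀ ℚ-ring

    halving-small : ∀ ε → 0ℚ < ε → ∃[ N ] ∀ n → N ℕ.≤ n → halving C n < ε
    halving-small ε 0<ε =
      let (δ , 0<δ , Cδ≡) = shrink C ε 0<C 0<ε
          (N , 1≤δN)      = archimedean δ 0<δ
          open ℚₚ.≤-Reasoning
      in N , λ n N≤n → ℚₚ.≤-<-trans (ℚₚ.*-cancelʳ-≤-pos (ℕ→ℚ (suc n)) {{positive (0<ℕ→ℚ-suc n)}} (begin
           halving C n * ℕ→ℚ (suc n)  ≤⟨ halving-bound n ⟩
           C  ≡⟨ ℚₚ.*-identityʳ C ⟨
           C * 1ℚ  ≤⟨ ℚₚ.*-monoˡ-≤-nonNeg C {{nonNegative (ℚₚ.<⇒≤ 0<C)}} 1≤δN ⟩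
           C * (δ * ℕ→ℚ N)  ≡⟨ ℚₚ.*-assoc C δ (ℕ→ℚ N) ⟨
           C * δ * ℕ→ℚ N  ≡⟨ cong (_* ℕ→ℚ N) Cδ≡ ⟩
           ½ * ε * ℕ→ℚ N  ≤⟨ ℚₚ.*-monoˡ-≤-nonNeg (½ * ε) {{nonNegative (ℚₚ.<⇒≤ (half-pos 0<ε))}}
                                           (ℕ→ℚ-mono {N} {suc n} (ℕₚ.m≤n⇒m≤1+n N≤n)) ⟩
           ½ * ε * ℕ→ℚ (suc n)  ∎)) (½<1 0<ε)

-- Bisection for Lipschitz functions on the rationals

module IntervalBisection where

  open RealRing
  open RationalLemmas
  open import Data.Rational.Base
  open import Data.Rational.Properties as ℚₚ using ()
  open import Relation.Binary.PropositionalEquality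
  open import Tactic.RingSolver using (solve-∀)

  ∣∣-lub : ∀ {x c} → x ≤ c → - x ≤ c → ∣ x ∣ ≤ c
  ∣∣-lub {x} {c} x≤c -x≤c with ℚₚ.∣p∣≡p∨∣p∣≡-p x
  ... | inj₁ e = subst (_≤ c) (sym e) x≤c
  ... | inj₂ e = subst (_≤ c) (sym e) -x≤c

  interval-distance : ∀ {l u x y} → l ≤ x → x ≤ u → l ≤ y → y ≤ u → ∣ x - y ∣ ≤ u - l
  interval-distance {l} {u} {x} {y} l≤x x≤u l≤y y≤u = ∣∣-lub
    (ℚₚ.+-mono-≤ x≤u (ℚₚ.neg-antimono-≤ l≤y))
    (subst (_≤ u - l) (lemma x y) (ℚₚ.+-mono-≤ y≤u (ℚₚ.neg-antimono-≤ l≤x)))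
    where
    lemma : ∀ x y → y + - x ≡ - (x + - y)
    lemma = solve-∀ ℚ-ring

  -- g is defined on ℚ because its sign is decidable there. The Lipschitz constant replaces
  -- continuity: it makes g tend to 0 along the brackets and keeps the root a definite distance away
  -- from both end points.
  module Bisection (g : ℚ → ℚ) (a b : ℚ) (a<b : a < b) (ga<0 : g a < 0ℚ) (0<gb : 0ℚ < g b)
    (L : ℚ) (0<L : 0ℚ < L)
    (lipschitz : ∀ x y → a ≤ x → x ≤ b → a ≤ y → y ≤ b → ∣ g x - g y ∣ ≤ L * ∣ x - y ∣) where

    width : ℕ → ℚ
    width = halving (b - a)

    0<b-a : 0ℚ < b - a
    0<b-a = <-shift a<b (sym (ℚₚ.+-identityʳ (b - a)))

    -- One inequality is weak and the other strict, as in the two outcomes of the test at the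
    -- midpoint; a midpoint that happens to be a zero becomes the new `lo`.
    record Bracket (n : ℕ) : Set where
      field
        lo hi : ℚ
        a≤lo  : a ≤ lo
        hi≤b  : hi ≤ b
        g-lo  : g lo ≤ 0ℚ
        g-hi  : 0ℚ < g hi
        gap   : hi ≡ lo + width n

      lo≤hi : lo ≤ hi
      lo≤hi = subst₂ _≤_ (ℚₚ.+-identityʳ lo) (sym gap) (ℚₚ.+-monoʳ-≤ lo (ℚₚ.<⇒≤ (halving-pos 0<b-a n)))

    open Bracket

    midpoint : ∀ {n} → Bracket n → ℚ
    midpoint {n} S = lo S + width (suc n)

    lo≤mid : ∀ {n} (S : Bracket n) → lo S ≤ midpoint S
    lo≤mid {n} S = subst (_≤ midpoint S) (ℚₚ.+-identityʳ (lo S)) (ℚₚ.+-monoʳ-≤ (lo S) (ℚₚ.<⇒≤ (halving-pos 0<b-a (suc n))))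

    mid+width : ∀ {n} (S : Bracket n) → hi S ≡ midpoint S + width (suc n)
    mid+width {n} S = trans (gap S) (trans (cong (lo S +_) (sym (halves (width n)))) (sym (ℚₚ.+-assoc (lo S) _ _)))

    mid≤hi : ∀ {n} (S : Bracket n) → midpoint S ≤ hi S
    mid≤hi {n} S = subst₂ _≤_ (ℚₚ.+-identityʳ (midpoint S)) (sym (mid+width S))
      (ℚₚ.+-monoʳ-≤ (midpoint S) (ℚₚ.<⇒≤ (halving-pos 0<b-a (suc n))))

    refine : ∀ {n} (S : Bracket n) → ∃[ S′ ] lo S ≤ lo {suc n} S′ × hi S′ ≤ hi S
    refine {n} S with g (midpoint S) ℚₚ.≤? 0ℚ
    ... | yes gm≤0 = record
      { lo = midpoint S ; hi = hi S ; a≤lo = ℚₚ.≤-trans (a≤lo S) (lo≤mid S) ; hi≤b = hi≤b S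
      ; g-lo = gm≤0 ; g-hi = g-hi S ; gap = mid+width S } , lo≤mid S , ℚₚ.≤-refl
    ... | no gm≰0 = record
      { lo = lo S ; hi = midpoint S ; a≤lo = a≤lo S ; hi≤b = ℚₚ.≤-trans (mid≤hi S) (hi≤b S)
      ; g-lo = g-lo S ; g-hi = ℚₚ.≰⇒> gm≰0 ; gap = refl } , ℚₚ.≤-refl , mid≤hi S

    bracket : ∀ n → Bracket n
    bracket zero    = record
      { lo = a ; hi = b ; a≤lo = ℚₚ.≤-refl ; hi≤b = ℚₚ.≤-refl ; g-lo = ℚₚ.<⇒≤ ga<0 ; g-hi = 0<gb
      ; gap = lemma a b }
      where
      lemma : ∀ a b → b ≡ a + (b + - a)
      lemma = solve-∀ ℚ-ring
    bracket (suc n) = proj₁ (refine (bracket n))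

    nested : ∀ n k → lo (bracket n) ≤ lo (bracket (k ℕ.+ n)) × hi (bracket (k ℕ.+ n)) ≤ hi (bracket n)
    nested n zero    = ℚₚ.≤-refl , ℚₚ.≤-refl
    nested n (suc k) =
      let (p , q) = nested n k ; (p′ , q′) = proj₂ (refine (bracket (k ℕ.+ n)))
      in ℚₚ.≤-trans p p′ , ℚₚ.≤-trans q′ q

    lo-mono : ∀ {n m} → n ℕ.≤ m → lo (bracket n) ≤ lo (bracket m)
    lo-mono {n} {m} n≤m = subst (λ k → lo (bracket n) ≤ lo (bracket k)) (ℕₚ.m∸n+n≡m n≤m) (proj₁ (nested n (m ℕ.∸ n)))

    lo≤hi′ : ∀ {n m} → n ℕ.≤ m → lo (bracket m) ≤ hi (bracket n)
    lo≤hi′ {n} {m} n≤m = ℚₚ.≤-trans (lo≤hi (bracket m))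
      (subst (λ k → hi (bracket k) ≤ hi (bracket n)) (ℕₚ.m∸n+n≡m n≤m) (proj₂ (nested n (m ℕ.∸ n))))

    gap′ : ∀ n → hi (bracket n) - lo (bracket n) ≡ width n
    gap′ n = trans (cong (_- lo (bracket n)) (gap (bracket n))) (lemma (lo (bracket n)) (width n))
      where
      lemma : ∀ l w → (l + w) + - l ≡ w
      lemma = solve-∀ ℚ-ring

    root : ℝ
    root .seq n = lo (bracket n)
    root .cauchy ε 0<ε =
      let (N , small) = halving-small 0<b-a ε 0<ε in
      N , λ m n N≤m N≤n → ℚₚ.≤-<-trans
        (interval-distance (lo-mono N≤m) (lo≤hi′ N≤m) (lo-mono N≤n) (lo≤hi′ N≤n))
        (subst (_< ε) (sym (gap′ N)) (small N ℕₚ.≤-refl))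

    g-hi-lo : ∀ n → g (hi (bracket n)) - g (lo (bracket n)) ≤ L * width n
    g-hi-lo n = begin
      g u - g l  ≤⟨ p≤∣p∣ (g u - g l) ⟩
      ∣ g u - g l ∣  ≤⟨ lipschitz u l (ℚₚ.≤-trans (a≤lo S) (lo≤hi S)) (hi≤b S)
                                          (a≤lo S) (ℚₚ.≤-trans (lo≤hi S) (hi≤b S)) ⟩
      L * ∣ u - l ∣  ≡⟨ cong (λ w → L * ∣ w ∣) (gap′ n) ⟩
      L * ∣ width n ∣  ≡⟨ cong (L *_) (ℚₚ.0≤p⇒∣p∣≡p (ℚₚ.<⇒≤ (halving-pos 0<b-a n))) ⟩
      L * width n  ∎
      where
      open ℚₚ.≤-Reasoning
      S = bracket n
      l = lo S
      u = hi S

    -- g(lo) ≤ 0 < g(hi) bounds the size of g(lo) by g(hi) - g(lo), hence by L times the width.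
    root-value : ∀ ε → 0ℚ < ε → ∃[ N ] ∀ n → N ℕ.≤ n → ∣ g (seq root n) ∣ < ε
    root-value ε 0<ε =
      let (δ , 0<δ , Lδ≡) = shrink L ε 0<L 0<ε
          (N , small)     = halving-small 0<b-a δ 0<δ
          open ℚₚ.≤-Reasoning
      in N , λ n N≤n → let S = bracket n in begin-strict
        ∣ g (lo S) ∣  ≤⟨ ∣∣-lub (ℚₚ.≤-trans (g-lo S) (ℚₚ.neg-antimono-≤ (g-lo S))) ℚₚ.≤-refl ⟩
        - g (lo S)  ≡⟨ ℚₚ.+-identityˡ (- g (lo S)) ⟨
        0ℚ - g (lo S)  ≤⟨ ℚₚ.+-monoˡ-≤ (- g (lo S)) (ℚₚ.<⇒≤ (g-hi S)) ⟩
        g (hi S) - g (lo S)  ≤⟨ g-hi-lo n ⟩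
        L * width n  <⟨ ℚₚ.*-monoʳ-<-pos L {{positive 0<L}} (small n N≤n) ⟩
        L * δ  ≡⟨ Lδ≡ ⟩
        ½ * ε  <⟨ ½<1 0<ε ⟩
        ε  ∎

    -- The Lipschitz inequality read backwards: values that differ force a distance between the
    -- arguments.
    separated : ∀ {x y δ} → a ≤ x → x ≤ y → y ≤ b → L * δ < g y - g x → δ < y - x
    separated {x} {y} {δ} a≤x x≤y y≤b Lδ< = ℚₚ.*-cancelˡ-<-nonNeg L {{nonNegative (ℚₚ.<⇒≤ 0<L)}} (begin-strict
      L * δ  <⟨ Lδ< ⟩
      g y - g x  ≤⟨ p≤∣p∣ (g y - g x) ⟩
      ∣ g y - g x ∣  ≤⟨ lipschitz y x (ℚₚ.≤-trans a≤x x≤y) y≤b a≤x (ℚₚ.≤-trans x≤y y≤b) ⟩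
      L * ∣ y - x ∣  ≡⟨ cong (L *_) (ℚₚ.0≤p⇒∣p∣≡p (≤-shift x≤y (sym (ℚₚ.+-identityʳ (y - x))))) ⟩
      L * (y - x)  ∎)
      where open ℚₚ.≤-Reasoning

    -- Every lower end has g ≤ 0 while g(b) > 0, which keeps it further than g(b) / 2L from b.
    root<b : root <ℝ constℝ b
    root<b =
      let (δ , 0<δ , Lδ≡) = shrink L (g b) 0<L 0<gb
          open ℚₚ.≤-Reasoning
      in δ , 0<δ , 0 , λ n _ → let S = bracket n in
        <-shift (separated (a≤lo S) (ℚₚ.≤-trans (lo≤hi S) (hi≤b S)) ℚₚ.≤-refl (begin-strict
          L * δ  ≡⟨ Lδ≡ ⟩
          ½ * g b  <⟨ ½<1 0<gb ⟩
          g b  ≡⟨ ℚₚ.+-identityʳ (g b) ⟨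
          g b - 0ℚ  ≤⟨ ℚₚ.+-monoʳ-≤ (g b) (ℚₚ.neg-antimono-≤ (g-lo S)) ⟩
          g b - g (lo S)  ∎))
          (lemma (lo S) b δ)
      where
      lemma : ∀ l b δ → (b + - l) + - δ ≡ b + - (l + δ)
      lemma = solve-∀ ℚ-ring

    -- The sign at `lo` does not separate it from a, but g(hi) > 0 > g(a) keeps `hi` further than δ
    -- = -g(a) / 2L from a. Once the width is below δ / 2, `lo` is further than δ / 2 from a.
    a<root : constℝ a <ℝ root
    a<root =
      let 0<-ga           = ℚₚ.neg-antimono-< ga<0
          (δ , 0<δ , Lδ≡) = shrink L (- g a) 0<L 0<-ga
          (N , small)     = halving-small 0<b-a (½ * δ) (half-pos 0<δ)
          open ℚₚ.≤-Reasoning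
      in ½ * δ , half-pos 0<δ , N , λ n N≤n → let S = bracket n in
        <-shift (ℚₚ.+-mono-< (separated ℚₚ.≤-refl (ℚₚ.≤-trans (a≤lo S) (lo≤hi S)) (hi≤b S) (begin-strict
            L * δ  ≡⟨ Lδ≡ ⟩
            ½ * - g a  <⟨ ½<1 0<-ga ⟩
            - g a  ≡⟨ ℚₚ.+-identityˡ (- g a) ⟨
            0ℚ - g a  ≤⟨ ℚₚ.+-monoˡ-≤ (- g a) (ℚₚ.<⇒≤ (g-hi S)) ⟩
            g (hi S) - g a  ∎))
            (small n N≤n))
          (trans (cong₂ (λ u d → (u - a + ½ * δ) - (d + width n)) (gap S) (sym (halves δ)))
                 (lemma (lo S) (width n) a (½ * δ)))
      where
      lemma : ∀ l w a h → ((l + w) + - a + h) + - ((h + h) + w) ≡ l + - (a + h)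
      lemma = solve-∀ ℚ-ring

-- Real zeros of rational polynomials from sign changes

module PolynomialRoots where

  open PolynomialRing
  open RealRing
  open IntervalBisection
  open import Data.Rational.Base hiding (_≃_)
  open import Data.Rational.Properties as ℚₚ using ()
  open import Relation.Binary.PropositionalEquality
  open import Tactic.RingSolver using (solve-∀)

  module ℚPoly = PolyProperties ℚₚ.+-*-commutativeRing
  module ℝPoly = PolyProperties ℝ-commutativeRing

  evℚ : List ℚ → ℚ → ℚ
  evℚ = eval +-*-rawRing

  evℝ : List ℝ → ℝ → ℝ
  evℝ = eval ℝ-ring

  -- The bridge between the two evaluations: real values of f are controlled through rational values
  -- at the approximations of z.
  evℝ-const : ∀ f z n → seq (evℝ (map constℝ f) z) n ≡ evℚ f (seq z n)
  evℝ-const []      z n = refl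
  evℝ-const (a ∷ f) z n = cong (λ w → a + seq z n * w) (evℝ-const f z n)

  ≤-bound : ∀ {a b c} → 0ℚ ≤ a → ∣ b ∣ ≤ c → ∀ x → ∣ x ∣ ≤ a → ∣ x * b ∣ ≤ a * c
  ≤-bound {a} {b} {c} 0≤a b≤c x x≤a = begin
    ∣ x * b ∣  ≡⟨ ℚₚ.∣p*q∣≡∣p∣*∣q∣ x b ⟩
    ∣ x ∣ * ∣ b ∣  ≤⟨ ℚₚ.*-monoʳ-≤-nonNeg ∣ b ∣ {{ℚₚ.∣-∣-nonNeg b}} x≤a ⟩
    a * ∣ b ∣  ≤⟨ ℚₚ.*-monoˡ-≤-nonNeg a {{nonNegative 0≤a}} b≤c ⟩
    a * c  ∎
    where open ℚₚ.≤-Reasoning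

  0≤-* : ∀ {x y} → 0ℚ ≤ x → 0ℚ ≤ y → 0ℚ ≤ x * y
  0≤-* {x} {y} 0≤x 0≤y = subst (_≤ x * y) (ℚₚ.*-zeroʳ x) (ℚₚ.*-monoˡ-≤-nonNeg x {{nonNegative 0≤x}} 0≤y)

  module _ (K : ℚ) (0≤K : 0ℚ ≤ K) where

    eval-bound : ∀ f → ∃[ M ] 0ℚ ≤ M × ∀ x → ∣ x ∣ ≤ K → ∣ evℚ f x ∣ ≤ M
    eval-bound []      = 0ℚ , ℚₚ.≤-refl , λ _ _ → ℚₚ.≤-refl
    eval-bound (a ∷ f) = let (M , 0≤M , f≤M) = eval-bound f in
      ∣ a ∣ + K * M , ℚₚ.+-mono-≤ 0≤∣ a ∣ (0≤-* 0≤K 0≤M) , λ x x≤K →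
        ℚₚ.≤-trans (ℚₚ.∣p+q∣≤∣p∣+∣q∣ a (x * evℚ f x)) (ℚₚ.+-monoʳ-≤ ∣ a ∣ (≤-bound 0≤K (f≤M x x≤K) x x≤K))

    -- Along Horner's rule, xu - yv = (x - y)u + y(u - v); the first term needs a bound on the
    -- values, the second is the induction hypothesis.
    eval-lipschitz : ∀ f → ∃[ L ] 0ℚ ≤ L × ∀ x y → ∣ x ∣ ≤ K → ∣ y ∣ ≤ K → ∣ evℚ f x - evℚ f y ∣ ≤ L * ∣ x - y ∣
    eval-lipschitz []      = 0ℚ , ℚₚ.≤-refl , λ x y _ _ → ℚₚ.≤-reflexive (sym (ℚₚ.*-zeroˡ ∣ x - y ∣))
    eval-lipschitz (a ∷ f) =
      let (M , 0≤M , f≤M) = eval-bound f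
          (L , 0≤L , lip) = eval-lipschitz f
          open ℚₚ.≤-Reasoning
      in M + K * L , ℚₚ.+-mono-≤ 0≤M (0≤-* 0≤K 0≤L) , λ x y x≤K y≤K → let u = evℚ f x ; v = evℚ f y in begin
        ∣ (a + x * u) - (a + y * v) ∣  ≡⟨ cong ∣_∣ (lemma a x y u v) ⟩
        ∣ (x - y) * u + y * (u - v) ∣  ≤⟨ ℚₚ.∣p+q∣≤∣p∣+∣q∣ ((x - y) * u) (y * (u - v)) ⟩
        ∣ (x - y) * u ∣ + ∣ y * (u - v) ∣  ≤⟨ ℚₚ.+-mono-≤ (≤-bound 0≤∣ x - y ∣ (f≤M x x≤K) (x - y) ℚₚ.≤-refl)
                                                                 (≤-bound 0≤K (lip x y x≤K y≤K) y y≤K) ⟩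
        ∣ x - y ∣ * M + K * (L * ∣ x - y ∣)  ≡⟨ lemma′ ∣ x - y ∣ M K L ⟩
        (M + K * L) * ∣ x - y ∣  ∎
      where
      lemma : ∀ a x y u v → (a + x * u) + - (a + y * v) ≡ (x + - y) * u + y * (u + - v)
      lemma = solve-∀ ℚ-ring
      lemma′ : ∀ d M K L → d * M + K * (L * d) ≡ (M + K * L) * d
      lemma′ = solve-∀ ℚ-ring

  alternate : ℕ → ℚ
  alternate zero    = 1ℚ
  alternate (suc n) = - alternate n

  alternate-≤ : ∀ n a → alternate n * a ≤ ∣ a ∣
  alternate-≤ zero    a = subst (_≤ ∣ a ∣) (sym (ℚₚ.*-identityˡ a)) (p≤∣p∣ a)
  alternate-≤ (suc n) a = subst₂ _≤_ (lemma (alternate n) a) (ℚₚ.∣-p∣≡∣p∣ a) (alternate-≤ n (- a))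
    where
    lemma : ∀ s a → s * - a ≡ - s * a
    lemma = solve-∀ ℚ-ring

  -- For f = a + x g, a point x ≤ -(1 + |a|) at which g has absolute value at least 1 and the right
  -- sign gives x g at least 1 + |a| in size, so a cannot disturb the sign. Working with the bound 1
  -- instead of 0 lets the induction run without division.
  sign-at-−∞ : ∀ f n → length f ≡ suc n → 1ℚ ≤ coeff ℚPoly.R₀ f n →
               ∃[ K ] 0ℚ ≤ K × ∀ x → x ≤ - K → 1ℚ ≤ alternate n * evℚ f x
  sign-at-−∞ (a ∷ [])    zero    e 1≤a = 0ℚ , ℚₚ.≤-refl , λ x _ → subst (1ℚ ≤_) (lemma a x) 1≤a
    where
    lemma : ∀ a x → a ≡ 1ℚ * (a + x * 0ℚ)
    lemma = solve-∀ ℚ-ring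
  sign-at-−∞ (a ∷ f@(b ∷ f′)) (suc n) e 1≤ =
    let (K , 0≤K , large) = sign-at-−∞ f n (ℕₚ.suc-injective e) 1≤
        K′ = K + (1ℚ + ∣ a ∣)
        0≤1+a : 0ℚ ≤ 1ℚ + ∣ a ∣
        0≤1+a = ℚₚ.+-mono-≤ (ℚₚ.<⇒≤ (ℚₚ.positive⁻¹ 1ℚ)) 0≤∣ a ∣
        open ℚₚ.≤-Reasoning
    in K′ , ℚₚ.+-mono-≤ 0≤K 0≤1+a , λ x x≤ →
      let s = alternate n ; v = evℚ f x
          x≤-K : x ≤ - K
          x≤-K = ℚₚ.≤-trans x≤ (ℚₚ.neg-antimono-≤ (subst (_≤ K′) (ℚₚ.+-identityʳ K) (ℚₚ.+-monoʳ-≤ K 0≤1+a)))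
          1+a≤-x : 1ℚ + ∣ a ∣ ≤ - x
          1+a≤-x = ℚₚ.≤-trans (subst (_≤ K′) (ℚₚ.+-identityˡ (1ℚ + ∣ a ∣)) (ℚₚ.+-monoˡ-≤ (1ℚ + ∣ a ∣) 0≤K))
                     (subst (_≤ - x) (lemma K′) (ℚₚ.neg-antimono-≤ x≤))
      in begin
        1ℚ  ≡⟨ lemma₁ ∣ a ∣ ⟩
        (1ℚ + ∣ a ∣) * 1ℚ - ∣ a ∣  ≤⟨ ℚₚ.+-monoˡ-≤ (- ∣ a ∣) (ℚₚ.≤-trans
                                              (ℚₚ.*-monoʳ-≤-nonNeg 1ℚ 1+a≤-x)
                                              (ℚₚ.*-monoˡ-≤-nonNeg (- x) {{nonNegative (ℚₚ.≤-trans 0≤1+a 1+a≤-x)}} (large x x≤-K))) ⟩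
        - x * (s * v) - ∣ a ∣  ≤⟨ ℚₚ.+-monoʳ-≤ (- x * (s * v)) (ℚₚ.neg-antimono-≤ (alternate-≤ n a)) ⟩
        - x * (s * v) - s * a  ≡⟨ lemma₂ x s v a ⟩
        - s * (a + x * v)  ∎
    where
    lemma : ∀ k → - - k ≡ k
    lemma = solve-∀ ℚ-ring
    lemma₁ : ∀ a → 1ℚ ≡ (1ℚ + a) * 1ℚ + - a
    lemma₁ = solve-∀ ℚ-ring
    lemma₂ : ∀ x s v a → - x * (s * v) + - (s * a) ≡ - s * (a + x * v)
    lemma₂ = solve-∀ ℚ-ring

  -- The points decrease from x on, and s is the sign of f at the current point.
  Alternating : List ℚ → ℚ → ℚ → List ℚ → Set
  Alternating f s x []       = 0ℚ < s * evℚ f x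
  Alternating f s x (y ∷ ys) = 0ℚ < s * evℚ f x × y < x × Alternating f (- s) y ys

  Root : List ℚ → ℝ → Set
  Root f z = evℝ (map constℝ f) z ≃ constℝ 0ℚ

  alternating-head : ∀ f s x ys → Alternating f s x ys → 0ℚ < s * evℚ f x
  alternating-head f s x []       0<fx       = 0<fx
  alternating-head f s x (y ∷ ys) (0<fx , _) = 0<fx

  infix 4 _>ℝ_
  _>ℝ_ : ℝ → ℝ → Set
  x >ℝ y = y <ℝ x

  -- Bisection expects a negative value on the left and a positive one on the right, so it is
  -- applied to s f; since s is its own inverse, a zero of s f is one of f.
  root-between : ∀ f s x y → s * s ≡ 1ℚ → 0ℚ < s * evℚ f x → y < x → 0ℚ < - s * evℚ f y →
                 ∃[ z ] constℝ y <ℝ z × z <ℝ constℝ x × Root f z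
  root-between f s x y s²≡1 0<fx y<x 0<-fy = root , a<root , root<b , is-root
    where
    g : ℚ → ℚ
    g t = s * evℚ f t
    unsign : ∀ s v → - (- s * v) ≡ s * v
    unsign = solve-∀ ℚ-ring
    gy<0 : g y < 0ℚ
    gy<0 = subst (_< 0ℚ) (unsign s (evℚ f y)) (ℚₚ.neg-antimono-< 0<-fy)
    K = ∣ y ∣ + ∣ x ∣
    0≤K : 0ℚ ≤ K
    0≤K = ℚₚ.+-mono-≤ 0≤∣ y ∣ 0≤∣ x ∣
    in-K : ∀ t → y ≤ t → t ≤ x → ∣ t ∣ ≤ K
    in-K t y≤t t≤x = ∣∣-lub
      (ℚₚ.≤-trans t≤x (ℚₚ.≤-trans (p≤∣p∣ x) (subst (_≤ K) (ℚₚ.+-identityˡ ∣ x ∣) (ℚₚ.+-monoˡ-≤ ∣ x ∣ 0≤∣ y ∣))))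
      (ℚₚ.≤-trans (ℚₚ.neg-antimono-≤ y≤t) (ℚₚ.≤-trans (subst (- y ≤_) (ℚₚ.∣-p∣≡∣p∣ y) (p≤∣p∣ (- y)))
        (subst (_≤ K) (ℚₚ.+-identityʳ ∣ y ∣) (ℚₚ.+-monoʳ-≤ ∣ y ∣ 0≤∣ x ∣))))
    lip = eval-lipschitz K 0≤K f
    L₀ = proj₁ lip
    -- The summand 1 makes the constant strictly positive even when f is constant and `L₀` is 0.
    L = 1ℚ + ∣ s ∣ * L₀
    0<L : 0ℚ < L
    0<L = ℚₚ.+-mono-<-≤ (ℚₚ.positive⁻¹ 1ℚ) (0≤-* 0≤∣ s ∣ (proj₁ (proj₂ lip)))
    g-lipschitz : ∀ t u → y ≤ t → t ≤ x → y ≤ u → u ≤ x → ∣ g t - g u ∣ ≤ L * ∣ t - u ∣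
    g-lipschitz t u y≤t t≤x y≤u u≤x = begin
      ∣ s * evℚ f t - s * evℚ f u ∣  ≡⟨ cong ∣_∣ (distrib s (evℚ f t) (evℚ f u)) ⟩
      ∣ s * (evℚ f t - evℚ f u) ∣  ≤⟨ ≤-bound 0≤∣ s ∣ (proj₂ (proj₂ lip) t u (in-K t y≤t t≤x) (in-K u y≤u u≤x)) s ℚₚ.≤-refl ⟩
      ∣ s ∣ * (L₀ * ∣ t - u ∣)  ≡⟨ lemma (∣ s ∣) L₀ (∣ t - u ∣) ⟩
      0ℚ * ∣ t - u ∣ + ∣ s ∣ * L₀ * ∣ t - u ∣  ≤⟨ ℚₚ.+-monoˡ-≤ (∣ s ∣ * L₀ * ∣ t - u ∣)
                                             (ℚₚ.*-monoʳ-≤-nonNeg ∣ t - u ∣ {{ℚₚ.∣-∣-nonNeg (t - u)}} (ℚₚ.<⇒≤ (ℚₚ.positive⁻¹ 1ℚ))) ⟩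
      1ℚ * ∣ t - u ∣ + ∣ s ∣ * L₀ * ∣ t - u ∣  ≡⟨ ℚₚ.*-distribʳ-+ ∣ t - u ∣ 1ℚ (∣ s ∣ * L₀) ⟨
      L * ∣ t - u ∣  ∎
      where
      open ℚₚ.≤-Reasoning
      distrib : ∀ s u v → s * u + - (s * v) ≡ s * (u + - v)
      distrib = solve-∀ ℚ-ring
      lemma : ∀ s l d → s * (l * d) ≡ 0ℚ * d + s * l * d
      lemma = solve-∀ ℚ-ring
    open Bisection g y x y<x gy<0 0<fx L 0<L g-lipschitz
    sf≃0 : mulℝ (constℝ s) (evℝ (map constℝ f) root) ≃ constℝ 0ℚ
    sf≃0 ε 0<ε = let (N , small) = root-value ε 0<ε in
      N , λ n le → subst (λ w → ∣ w ∣ < ε)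
        (trans (cong (s *_) (sym (evℝ-const f root n))) (sym (ℚₚ.+-identityʳ _))) (small n le)
    is-root : Root f root
    is-root = ≃-trans {fr} {mulℝ (mulℝ (constℝ s) fr) (constℝ s)} {constℝ 0ℚ}
      (≃-pointwise fr (mulℝ (mulℝ (constℝ s) fr) (constℝ s)) (λ n →
        trans (sym (ℚₚ.*-identityˡ (seq fr n))) (trans (cong (_* seq fr n) (sym s²≡1)) (lemma s (seq fr n)))))
      (≃-trans {mulℝ (mulℝ (constℝ s) fr) (constℝ s)} {mulℝ (constℝ 0ℚ) (constℝ s)} {constℝ 0ℚ}
        (mulℝ-congˡ {mulℝ (constℝ s) fr} {constℝ 0ℚ} (constℝ s) sf≃0)
        (≃-pointwise (mulℝ (constℝ 0ℚ) (constℝ s)) (constℝ 0ℚ) (λ n → ℚₚ.*-zeroˡ s)))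
      where
      fr = evℝ (map constℝ f) root
      lemma : ∀ s v → s * s * v ≡ s * v * s
      lemma = solve-∀ ℚ-ring

  -- The rational sample points separate neighbouring zeros, so the zeros found are strictly ordered
  -- and not merely different.
  alternating-roots : ∀ f s x ys → s * s ≡ 1ℚ → Alternating f s x ys →
    ∃[ zs ] length zs ≡ length ys × AllPairs _>ℝ_ zs × All (_<ℝ constℝ x) zs × All (Root f) zs
  alternating-roots f s x []       s² alt = [] , refl , [] , [] , []
  alternating-roots f s x (y ∷ ys) s² (0<fx , y<x , alt) =
    let (z , y<z , z<x , root)            = root-between f s x y s² 0<fx y<x (alternating-head f (- s) y ys alt)
        (zs , len , desc , below , roots) = alternating-roots f (- s) y ys (trans (lemma s) s²) alt
    in z ∷ zs , cong suc len
     , All.map (λ {w} w<y → <ℝ-trans {w} {constℝ y} {z} w<y y<z) below ∷ desc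
     , z<x ∷ All.map (λ {w} w<y → <ℝ-trans {w} {constℝ y} {constℝ x} w<y (<ℝ-trans {constℝ y} {z} {constℝ x} y<z z<x)) below
     , root ∷ roots
    where
    lemma : ∀ s → - s * - s ≡ s * s
    lemma = solve-∀ ℚ-ring

-- The differential recurrence of Σ C(A,k) C(B,k) t^k

module BinomialPolynomials where

  open PolynomialRing
  open RealRing
  open RationalLemmas
  open PolynomialRoots
  open MultichainCount using (binom)
  open import Data.Nat.Tactic.RingSolver using () renaming (solve-∀ to solveℕ-∀)
  open import Relation.Binary.PropositionalEquality as ≡ using (_≡_)
  open import Tactic.RingSolver using (solve-∀)

  module Truncation (R : CommutativeRing 0ℓ 0ℓ) where
    open CommutativeRing R hiding (zero)
    open NatSolver commutativeSemiring using (solve; _:=_) renaming (_:+_ to _⊕_; _:*_ to _⊗_)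
    open PolyProperties R using (R₀)

    -- The sum of g k x^k over k < n, written as a function of the sequence g, so that identities
    -- between coefficients lift to values.
    E : ℕ → (ℕ → Carrier) → Carrier → Carrier
    E n g x = eval R₀ (applyUpTo g n) x

    E-cong : ∀ n {f g} x → (∀ k → f k ≈ g k) → E n f x ≈ E n g x
    E-cong zero    x e = refl
    E-cong (suc n) x e = +-cong (e 0) (*-congˡ (E-cong n x (λ k → e (suc k))))

    E-+ : ∀ n f g x → E n (λ k → f k + g k) x ≈ E n f x + E n g x
    E-+ zero    f g x = sym (+-identityˡ 0#)
    E-+ (suc n) f g x = trans (+-congˡ (*-congˡ (E-+ n (f ∘ suc) (g ∘ suc) x)))
      (solve 5 (λ a b x u v → (a ⊕ b) ⊕ x ⊗ (u ⊕ v) := (a ⊕ x ⊗ u) ⊕ (b ⊕ x ⊗ v)) refl (f 0) (g 0) x _ _)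

    E-* : ∀ n c f x → E n (λ k → c * f k) x ≈ c * E n f x
    E-* zero    c f x = sym (zeroʳ c)
    E-* (suc n) c f x = trans (+-congˡ (*-congˡ (E-* n c (f ∘ suc) x)))
      (solve 4 (λ c a x u → c ⊗ a ⊕ x ⊗ (c ⊗ u) := c ⊗ (a ⊕ x ⊗ u)) refl c (f 0) x _)

    E-extend : ∀ n f x → f n ≈ 0# → E (suc n) f x ≈ E n f x
    E-extend zero    f x e = trans (+-cong e (zeroʳ x)) (+-identityˡ 0#)
    E-extend (suc n) f x e = +-congˡ (*-congˡ (E-extend n (f ∘ suc) x e))

    delay : (ℕ → Carrier) → ℕ → Carrier
    delay g zero    = 0#
    delay g (suc k) = g k

    E-delay : ∀ n g x → E (suc n) (delay g) x ≈ x * E n g x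
    E-delay n g x = +-identityˡ _

  open import Data.Rational.Base using (ℚ; 0ℚ; 1ℚ; _+_; _*_; -_; _-_)
  open import Data.Rational.Properties as ℚₚ using ()

  open Truncation ℚₚ.+-*-commutativeRing

  -- The derivative at x as the difference quotient (f(t) - f(x)) / (t - x) taken at t = x. In this
  -- form a factorisation of f gives its value at a zero directly.
  derivative : ℚ → List ℚ → ℚ
  derivative x []      = 0ℚ
  derivative x (a ∷ f) = evℚ (ℚPoly.quotient x f) x

  derivative-∷ : ∀ x f → evℚ (ℚPoly.quotient x f) x ≡ evℚ f x + x * derivative x f
  derivative-∷ x []      = ≡.sym (≡.trans (ℚₚ.+-identityˡ _) (ℚₚ.*-zeroʳ x))
  derivative-∷ x (a ∷ f) = ≡.refl

  -- The Euler operator x d/dx multiplies the coefficient of x^k by k. The offset j is there for the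
  -- induction, in which removing the constant term raises all indices by one.
  E-euler : ∀ n j g x → E n (λ k → ℕ→ℚ (j ℕ.+ k) * g k) x ≡ ℕ→ℚ j * E n g x + x * derivative x (applyUpTo g n)
  E-euler zero    j g x = lemma (ℕ→ℚ j) x
    where
    lemma : ∀ j x → 0ℚ ≡ j * 0ℚ + x * 0ℚ
    lemma = solve-∀ ℚ-ring
  E-euler (suc n) j g x = begin
    ℕ→ℚ (j ℕ.+ 0) * g 0 + x * E n (λ k → ℕ→ℚ (j ℕ.+ suc k) * g (suc k)) x
      ≡⟨ ≡.cong₂ (λ u v → ℕ→ℚ u * g 0 + x * v) (ℕₚ.+-identityʳ j)
           (≡.trans (E-cong n x (λ k → ≡.cong (λ u → ℕ→ℚ u * g (suc k)) (ℕₚ.+-suc j k))) (E-euler n (suc j) (g ∘ suc) x)) ⟩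
    J * g 0 + x * (ℕ→ℚ (suc j) * e + x * d)
      ≡⟨ ≡.cong (λ u → J * g 0 + x * (u * e + x * d)) (ℕ→ℚ-suc j) ⟩
    J * g 0 + x * ((1ℚ + J) * e + x * d)
      ≡⟨ lemma J (g 0) x e d ⟩
    J * (g 0 + x * e) + x * (e + x * d)
      ≡⟨ ≡.cong (λ u → J * (g 0 + x * e) + x * u) (derivative-∷ x (applyUpTo (g ∘ suc) n)) ⟨
    J * (g 0 + x * e) + x * evℚ (ℚPoly.quotient x (applyUpTo (g ∘ suc) n)) x ∎
    where
    open ≡.≡-Reasoning
    J = ℕ→ℚ j
    e = E n (g ∘ suc) x
    d = derivative x (applyUpTo (g ∘ suc) n)
    lemma : ∀ j a x e d → j * a + x * ((1ℚ + j) * e + x * d) ≡ j * (a + x * e) + x * (e + x * d)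
    lemma = solve-∀ ℚ-ring

  -- The absorption rule (k + 1) C(n,k+1) = (n - k) C(n,k), arranged without subtraction so that it
  -- also holds for k > n.
  binom-absorb : ∀ n k → suc k ℕ.* binom n (suc k) ℕ.+ k ℕ.* binom n k ≡ n ℕ.* binom n k
  binom-absorb zero    zero    = ≡.refl
  binom-absorb zero    (suc k) = ≡.cong₂ ℕ._+_ (ℕₚ.*-zeroʳ (suc (suc k))) (ℕₚ.*-zeroʳ (suc k))
  binom-absorb (suc n) zero    = begin
    1 ℕ.* (1 ℕ.+ binom n 1) ℕ.+ 0  ≡⟨ lemma (binom n 1) ⟩
    suc (1 ℕ.* binom n 1 ℕ.+ 0)  ≡⟨ ≡.cong suc (binom-absorb n 0) ⟩
    suc n ℕ.* 1  ∎
    where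
    open ≡.≡-Reasoning
    lemma : ∀ x → 1 ℕ.* (1 ℕ.+ x) ℕ.+ 0 ≡ 1 ℕ.+ (1 ℕ.* x ℕ.+ 0)
    lemma = solveℕ-∀
  binom-absorb (suc n) (suc k) = begin
    suc (suc k) ℕ.* (b ℕ.+ c) ℕ.+ suc k ℕ.* (a ℕ.+ b)
      ≡⟨ lemma k a b c ⟩
    (a ℕ.+ (suc k ℕ.* b ℕ.+ k ℕ.* a)) ℕ.+ (b ℕ.+ (suc (suc k) ℕ.* c ℕ.+ suc k ℕ.* b))
      ≡⟨ ≡.cong₂ (λ u v → (a ℕ.+ u) ℕ.+ (b ℕ.+ v)) (binom-absorb n k) (binom-absorb n (suc k)) ⟩
    (a ℕ.+ n ℕ.* a) ℕ.+ (b ℕ.+ n ℕ.* b)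
      ≡⟨ lemma′ n a b ⟩
    suc n ℕ.* (a ℕ.+ b) ∎
    where
    open ≡.≡-Reasoning
    a = binom n k
    b = binom n (suc k)
    c = binom n (suc (suc k))
    lemma : ∀ k a b c → (2 ℕ.+ k) ℕ.* (b ℕ.+ c) ℕ.+ (1 ℕ.+ k) ℕ.* (a ℕ.+ b)
            ≡ (a ℕ.+ ((1 ℕ.+ k) ℕ.* b ℕ.+ k ℕ.* a)) ℕ.+ (b ℕ.+ ((2 ℕ.+ k) ℕ.* c ℕ.+ (1 ℕ.+ k) ℕ.* b))
    lemma = solveℕ-∀
    lemma′ : ∀ n a b → (a ℕ.+ n ℕ.* a) ℕ.+ (b ℕ.+ n ℕ.* b) ≡ (1 ℕ.+ n) ℕ.* (a ℕ.+ b)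
    lemma′ = solveℕ-∀

  binom-absorbℚ : ∀ n k → (1ℚ + ℕ→ℚ k) * ℕ→ℚ (binom n (suc k)) + ℕ→ℚ k * ℕ→ℚ (binom n k) ≡ ℕ→ℚ n * ℕ→ℚ (binom n k)
  binom-absorbℚ n k = begin
    (1ℚ + ℕ→ℚ k) * ℕ→ℚ (binom n (suc k)) + ℕ→ℚ k * ℕ→ℚ (binom n k)
      ≡⟨ ≡.cong₂ _+_ (≡.trans (ℕ→ℚ-* (suc k) (binom n (suc k))) (≡.cong (_* ℕ→ℚ (binom n (suc k))) (ℕ→ℚ-suc k))) (ℕ→ℚ-* k (binom n k)) ⟨
    ℕ→ℚ (suc k ℕ.* binom n (suc k)) + ℕ→ℚ (k ℕ.* binom n k)
      ≡⟨ ℕ→ℚ-+ (suc k ℕ.* binom n (suc k)) (k ℕ.* binom n k) ⟨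
    ℕ→ℚ (suc k ℕ.* binom n (suc k) ℕ.+ k ℕ.* binom n k)
      ≡⟨ ≡.cong ℕ→ℚ (binom-absorb n k) ⟩
    ℕ→ℚ (n ℕ.* binom n k)
      ≡⟨ ℕ→ℚ-* n (binom n k) ⟩
    ℕ→ℚ n * ℕ→ℚ (binom n k) ∎
    where open ≡.≡-Reasoning

  binom-> : ∀ n k → n ℕ.< k → binom n k ≡ 0
  binom-> zero    (suc k) _         = ≡.refl
  binom-> (suc n) (suc k) (ℕ.s≤s l) = ≡.cong₂ ℕ._+_ (binom-> n k l) (binom-> n (suc k) (ℕₚ.m≤n⇒m≤1+n l))

  binom-diagonal : ∀ n → binom n n ≡ 1
  binom-diagonal zero    = ≡.refl
  binom-diagonal (suc n) = ≡.cong₂ ℕ._+_ (binom-diagonal n) (binom-> n (suc n) ℕₚ.≤-refl)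

  binom-pos : ∀ n k → k ℕ.≤ n → 1 ℕ.≤ binom n k
  binom-pos n       zero    _         = ℕₚ.≤-refl
  binom-pos (suc n) (suc k) (ℕ.s≤s l) = ℕₚ.≤-trans (binom-pos n k l) (ℕₚ.m≤m+n (binom n k) _)

  hℚ : ℕ → ℕ → ℕ → ℚ
  hℚ a b k = ℕ→ℚ (binom a k) * ℕ→ℚ (binom b k)

  polyℚ : ℕ → ℕ → List ℚ
  polyℚ a b = applyUpTo (hℚ a b) (suc a)

  hℚ-> : ∀ a b → hℚ a b (suc a) ≡ 0ℚ
  hℚ-> a b = ≡.trans (≡.cong (λ u → ℕ→ℚ u * ℕ→ℚ (binom b (suc a))) (binom-> a (suc a) ℕₚ.≤-refl)) (ℚₚ.*-zeroˡ (ℕ→ℚ (binom b (suc a))))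

  -- The differential recurrence coefficient by coefficient: `delay` is multiplication by t, and the
  -- factor `ℕ→ℚ k` is t d/dt.
  hℚ-rec : ∀ a b k → (1ℚ + ℕ→ℚ a) * hℚ (suc a) b k ≡
    ((1ℚ + ℕ→ℚ a) * hℚ a b k + ℕ→ℚ b * delay (hℚ a b) k)
    + (ℕ→ℚ k * hℚ a b k + - 1ℚ * delay (λ k → ℕ→ℚ k * hℚ a b k) k)
  hℚ-rec a b zero    = lemma (ℕ→ℚ a) (ℕ→ℚ b)
    where
    lemma : ∀ a b → (1ℚ + a) * 1ℚ ≡ ((1ℚ + a) * 1ℚ + b * 0ℚ) + (0ℚ * 1ℚ + - 1ℚ * 0ℚ)
    lemma = solve-∀ ℚ-ring
  hℚ-rec a b (suc k) = begin
    (1ℚ + A) * (ℕ→ℚ (binom a k ℕ.+ binom a (suc k)) * v′)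
      ≡⟨ ≡.cong (λ w → (1ℚ + A) * (w * v′)) (ℕ→ℚ-+ (binom a k) (binom a (suc k))) ⟩
    (1ℚ + A) * ((u + u′) * v′)
      ≡⟨ lemma₁ A u u′ v′ ⟩
    (1ℚ + A) * (u′ * v′) + (u + A * u) * v′
      -- Absorption in row a trades the factor A for multiples of k; two steps below, absorption in
      -- row b gathers part of them into the factor B.
      ≡⟨ ≡.cong (λ w → (1ℚ + A) * (u′ * v′) + (u + w) * v′) (binom-absorbℚ a k) ⟨
    (1ℚ + A) * (u′ * v′) + (u + ((1ℚ + K) * u′ + K * u)) * v′
      ≡⟨ lemma₂ A K u u′ v v′ ⟩
    ((1ℚ + A) * (u′ * v′) + u * ((1ℚ + K) * v′ + K * v)) + ((1ℚ + K) * (u′ * v′) + - 1ℚ * (K * (u * v)))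
      ≡⟨ ≡.cong (λ w → ((1ℚ + A) * (u′ * v′) + u * w) + ((1ℚ + K) * (u′ * v′) + - 1ℚ * (K * (u * v)))) (binom-absorbℚ b k) ⟩
    ((1ℚ + A) * (u′ * v′) + u * (B * v)) + ((1ℚ + K) * (u′ * v′) + - 1ℚ * (K * (u * v)))
      ≡⟨ ≡.cong₂ (λ x y → ((1ℚ + A) * (u′ * v′) + x) + (y * (u′ * v′) + - 1ℚ * (K * (u * v)))) (lemma₃ u v B) (≡.sym (ℕ→ℚ-suc k)) ⟩
    ((1ℚ + A) * (u′ * v′) + B * (u * v)) + (ℕ→ℚ (suc k) * (u′ * v′) + - 1ℚ * (K * (u * v))) ∎
    where
    open ≡.≡-Reasoning
    A  = ℕ→ℚ a
    B  = ℕ→ℚ b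
    K  = ℕ→ℚ k
    u  = ℕ→ℚ (binom a k)
    u′ = ℕ→ℚ (binom a (suc k))
    v  = ℕ→ℚ (binom b k)
    v′ = ℕ→ℚ (binom b (suc k))
    lemma₁ : ∀ A u u′ v′ → (1ℚ + A) * ((u + u′) * v′) ≡ (1ℚ + A) * (u′ * v′) + (u + A * u) * v′
    lemma₁ = solve-∀ ℚ-ring
    lemma₂ : ∀ A K u u′ v v′ → (1ℚ + A) * (u′ * v′) + (u + ((1ℚ + K) * u′ + K * u)) * v′ ≡
      ((1ℚ + A) * (u′ * v′) + u * ((1ℚ + K) * v′ + K * v)) + ((1ℚ + K) * (u′ * v′) + - 1ℚ * (K * (u * v)))
    lemma₂ = solve-∀ ℚ-ring
    lemma₃ : ∀ u v B → u * (B * v) ≡ B * (u * v)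
    lemma₃ = solve-∀ ℚ-ring

  polyℚ-rec : ∀ a b x → (1ℚ + ℕ→ℚ a) * evℚ (polyℚ (suc a) b) x ≡
    (1ℚ + ℕ→ℚ a + ℕ→ℚ b * x) * evℚ (polyℚ a b) x + x * (1ℚ - x) * derivative x (polyℚ a b)
  polyℚ-rec a b x = begin
    (1ℚ + A) * E (suc (suc a)) (hℚ (suc a) b) x
      ≡⟨ E-* (suc (suc a)) (1ℚ + A) (hℚ (suc a) b) x ⟨
    E (suc (suc a)) (λ k → (1ℚ + A) * hℚ (suc a) b k) x
      ≡⟨ E-cong (suc (suc a)) x (hℚ-rec a b) ⟩
    E (suc (suc a)) (λ k → (f₁ k + f₂ k) + (f₃ k + f₄ k)) x
      ≡⟨ ≡.trans (E-+ (suc (suc a)) (λ k → f₁ k + f₂ k) (λ k → f₃ k + f₄ k) x)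
                 (≡.cong₂ _+_ (E-+ (suc (suc a)) f₁ f₂ x) (E-+ (suc (suc a)) f₃ f₄ x)) ⟩
    (E (suc (suc a)) f₁ x + E (suc (suc a)) f₂ x) + (E (suc (suc a)) f₃ x + E (suc (suc a)) f₄ x)
      ≡⟨ ≡.cong₂ _+_ (≡.cong₂ _+_ eq₁ eq₂) (≡.cong₂ _+_ eq₃ eq₄) ⟩
    ((1ℚ + A) * e + B * (x * e)) + (x * d + - 1ℚ * (x * (x * d)))
      ≡⟨ lemma A B x e d ⟩
    (1ℚ + A + B * x) * e + x * (1ℚ - x) * d ∎
    where
    open ≡.≡-Reasoning
    A = ℕ→ℚ a
    B = ℕ→ℚ b
    e = evℚ (polyℚ a b) x
    d = derivative x (polyℚ a b)
    θ : ℕ → ℚ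
    θ k = ℕ→ℚ k * hℚ a b k
    f₁ f₂ f₃ f₄ : ℕ → ℚ
    f₁ k = (1ℚ + A) * hℚ a b k
    f₂ k = B * delay (hℚ a b) k
    f₃ = θ
    f₄ k = - 1ℚ * delay θ k
    θ-value : E (suc a) θ x ≡ x * d
    θ-value = ≡.trans (E-euler (suc a) 0 (hℚ a b) x) (≡.trans (≡.cong (_+ x * d) (ℚₚ.*-zeroˡ e)) (ℚₚ.+-identityˡ (x * d)))
    eq₁ : E (suc (suc a)) f₁ x ≡ (1ℚ + A) * e
    eq₁ = ≡.trans (E-* (suc (suc a)) (1ℚ + A) (hℚ a b) x) (≡.cong ((1ℚ + A) *_) (E-extend (suc a) (hℚ a b) x (hℚ-> a b)))
    eq₂ : E (suc (suc a)) f₂ x ≡ B * (x * e)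
    eq₂ = ≡.trans (E-* (suc (suc a)) B (delay (hℚ a b)) x) (≡.cong (B *_) (E-delay (suc a) (hℚ a b) x))
    eq₃ : E (suc (suc a)) f₃ x ≡ x * d
    eq₃ = ≡.trans (E-extend (suc a) θ x (≡.trans (≡.cong (ℕ→ℚ (suc a) *_) (hℚ-> a b)) (ℚₚ.*-zeroʳ (ℕ→ℚ (suc a))))) θ-value
    eq₄ : E (suc (suc a)) f₄ x ≡ - 1ℚ * (x * (x * d))
    eq₄ = ≡.trans (E-* (suc (suc a)) (- 1ℚ) (delay θ) x)
            (≡.cong (- 1ℚ *_) (≡.trans (E-delay (suc a) θ x) (≡.cong (x *_) θ-value)))
    lemma : ∀ A B x e d → ((1ℚ + A) * e + B * (x * e)) + (x * d + - 1ℚ * (x * (x * d))) ≡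
            (1ℚ + A + B * x) * e + x * (1ℚ + - x) * d
    lemma = solve-∀ ℚ-ring

-- The factor theorem over rings with an apartness relation

module LinearFactors where

  open PolynomialRing
  open import Relation.Binary.PropositionalEquality as ≡ using (_≡_)

  module _ (R : CommutativeRing 0ℓ 0ℓ) where
    open CommutativeRing R

    -- The only property of apartness that the factor theorem uses: a difference of apart elements
    -- is not a zero divisor.
    RegularDifferences : (Carrier → Carrier → Set) → Set
    RegularDifferences _#_ = ∀ {x z} y → x # z → (z + - x) * y ≈ 0# → y ≈ 0#

  module FactorTheorem (R : CommutativeRing 0ℓ 0ℓ) (_#_ : CommutativeRing.Carrier R → CommutativeRing.Carrier R → Set)
    (cancel : RegularDifferences R _#_) where
    open CommutativeRing R hiding (zero)
    open SetoidReasoning setoid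
    open PolyProperties R hiding (sym; trans)

    private
      P = Poly R₀
      ev = eval R₀

    linear : Carrier → P
    linear z = - z ∷ 1# ∷ []

    linears : List Carrier → P
    linears zs = productOf (polyRing R₀) (map linear zs)

    differences : Carrier → List Carrier → Carrier
    differences t []       = 1#
    differences t (z ∷ zs) = (t + - z) * differences t zs

    eval-linear : ∀ z t → ev (linear z) t ≈ t + - z
    eval-linear z t = trans (+-congˡ (trans (*-congˡ (eval-const 1# t)) (*-identityʳ t))) (+-comm (- z) t)

    eval-linears : ∀ zs t → ev (linears zs) t ≈ differences t zs
    eval-linears []       t = eval-const 1# t
    eval-linears (z ∷ zs) t = trans (eval-mul (linear z) (linears zs) t)
      (*-cong (eval-linear z t) (eval-linears zs t))

    differences-++ : ∀ t ys zs → differences t (ys ++ zs) ≈ differences t ys * differences t zs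
    differences-++ t []       zs = sym (*-identityˡ _)
    differences-++ t (y ∷ ys) zs = trans (*-congˡ (differences-++ t ys zs)) (sym (*-assoc _ _ _))

    swap-const : ∀ c p q → mulPoly R₀ (c ∷ []) (mulPoly R₀ p q) ≋ mulPoly R₀ p (mulPoly R₀ (c ∷ []) q)
    swap-const c p q n = begin
      coeff R₀ (mulPoly R₀ (c ∷ []) (mulPoly R₀ p q)) n  ≈⟨ mul-assoc (c ∷ []) p q n ⟨
      coeff R₀ (mulPoly R₀ (mulPoly R₀ (c ∷ []) p) q) n  ≈⟨ mul-cong (mulPoly R₀ (c ∷ []) p) (mulPoly R₀ p (c ∷ [])) q q
                                                               (mul-comm (c ∷ []) p) (λ _ → refl) n ⟩
      coeff R₀ (mulPoly R₀ (mulPoly R₀ p (c ∷ [])) q) n  ≈⟨ mul-assoc p (c ∷ []) q n ⟩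
      coeff R₀ (mulPoly R₀ p (mulPoly R₀ (c ∷ []) q)) n  ∎

    quotient-roots : ∀ a p z zs → ev (a ∷ p) z ≈ 0# → All (z #_) zs → All (λ x → ev (a ∷ p) x ≈ 0#) zs →
                     All (λ x → ev (quotient z p) x ≈ 0#) zs
    quotient-roots a p z []       pz≈0 []         []           = []
    quotient-roots a p z (x ∷ zs) pz≈0 (z#x ∷ z#) (px≈0 ∷ p≈0) = cancel _ z#x (begin
      (x + - z) * ev (quotient z p) x  ≈⟨ *-congʳ (eval-linear z x) ⟨
      ev (linear z) x * ev (quotient z p) x  ≈⟨ eval-mul (linear z) (quotient z p) x ⟨
      ev (mulPoly R₀ (linear z) (quotient z p)) x  ≈⟨ eval-cong (a ∷ p) (mulPoly R₀ (linear z) (quotient z p)) x (factor a p z pz≈0) ⟨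
      ev (a ∷ p) x  ≈⟨ px≈0 ⟩
      0#  ∎) ∷ quotient-roots a p z zs pz≈0 z# p≈0

    -- Each zero is divided out in turn. The statement about the quotient is separate because the
    -- same factorisation also gives the derivative at z, in `quotient-value`.
    factorisation : ∀ p zs → length p ≡ suc (length zs) → AllPairs _#_ zs → All (λ z → ev p z ≈ 0#) zs →
                    p ≋ mulPoly R₀ (coeff R₀ p (length zs) ∷ []) (linears zs)
    quotient-factorisation : ∀ a p z zs → length p ≡ suc (length zs) → AllPairs _#_ (z ∷ zs) →
      ev (a ∷ p) z ≈ 0# → All (λ x → ev (a ∷ p) x ≈ 0#) zs →
      quotient z p ≋ mulPoly R₀ (coeff R₀ p (length zs) ∷ []) (linears zs)

    factorisation (a ∷ [])        []       e []         []          zero    = sym (trans (+-identityʳ _) (*-identityʳ a))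
    factorisation (a ∷ [])        []       e []         []          (suc n) = refl
    factorisation (a ∷ p)         (z ∷ zs) e apart@(_ ∷ _) (pz≈0 ∷ p≈0) n = begin
      coeff R₀ (a ∷ p) n
        ≈⟨ factor a p z pz≈0 n ⟩
      coeff R₀ (mulPoly R₀ (linear z) (quotient z p)) n
        ≈⟨ mul-congʳ (linear z) (quotient z p) (mulPoly R₀ (coeff R₀ p (length zs) ∷ []) (linears zs)) (quotient-factorisation a p z zs (ℕₚ.suc-injective e) apart pz≈0 p≈0) n ⟩
      coeff R₀ (mulPoly R₀ (linear z) (mulPoly R₀ (coeff R₀ p (length zs) ∷ []) (linears zs))) n
        ≈⟨ swap-const (coeff R₀ p (length zs)) (linear z) (linears zs) n ⟨
      coeff R₀ (mulPoly R₀ (coeff R₀ p (length zs) ∷ []) (linears (z ∷ zs))) n ∎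

    quotient-factorisation a p z zs e (z# ∷ apart) pz≈0 p≈0 n = begin
      coeff R₀ (quotient z p) n
        ≈⟨ factorisation (quotient z p) zs (≡.trans (length-quotient z p) e) apart (quotient-roots a p z zs pz≈0 z# p≈0) n ⟩
      coeff R₀ (mulPoly R₀ (coeff R₀ (quotient z p) (length zs) ∷ []) (linears zs)) n
        ≈⟨ mul-cong (coeff R₀ (quotient z p) (length zs) ∷ []) (coeff R₀ p (length zs) ∷ []) (linears zs) (linears zs)
             (λ { zero → lead ; (suc k) → refl }) (λ _ → refl) n ⟩
      coeff R₀ (mulPoly R₀ (coeff R₀ p (length zs) ∷ []) (linears zs)) n ∎
      where
      -- Synthetic division passes the leading coefficient on unchanged, the quotient having no
      -- coefficient beyond this index.
      lead : coeff R₀ (quotient z p) (length zs) ≈ coeff R₀ p (length zs)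
      lead = begin
        coeff R₀ (quotient z p) (length zs)
          ≈⟨ coeff-quotient z p (length zs) ⟩
        coeff R₀ p (length zs) + z * coeff R₀ (quotient z p) (suc (length zs))
          ≡⟨ ≡.cong (λ x → coeff R₀ p (length zs) + z * x)
               (coeff-beyond (quotient z p) (ℕₚ.≤-reflexive (≡.trans (length-quotient z p) e))) ⟩
        coeff R₀ p (length zs) + z * 0#
          ≈⟨ trans (+-congˡ (zeroʳ z)) (+-identityʳ _) ⟩
        coeff R₀ p (length zs) ∎

    -- The left side is the derivative of `a ∷ p` at its zero z. The other zeros come in two lists
    -- because those above z and those below z contribute different signs.
    quotient-value : ∀ a p z ys zs → length p ≡ suc (length (ys ++ zs)) → AllPairs _#_ (z ∷ ys ++ zs) →
      ev (a ∷ p) z ≈ 0# → All (λ x → ev (a ∷ p) x ≈ 0#) (ys ++ zs) →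
      ev (quotient z p) z ≈ coeff R₀ p (length (ys ++ zs)) * (differences z ys * differences z zs)
    quotient-value a p z ys zs e apart pz≈0 p≈0 = begin
      ev (quotient z p) z
        ≈⟨ eval-cong (quotient z p) (mulPoly R₀ (c ∷ []) (linears (ys ++ zs))) z (quotient-factorisation a p z (ys ++ zs) e apart pz≈0 p≈0) ⟩
      ev (mulPoly R₀ (c ∷ []) (linears (ys ++ zs))) z
        ≈⟨ eval-mul (c ∷ []) (linears (ys ++ zs)) z ⟩
      ev (c ∷ []) z * ev (linears (ys ++ zs)) z
        ≈⟨ *-cong (eval-const c z) (trans (eval-linears (ys ++ zs) z) (differences-++ z ys zs)) ⟩
      c * (differences z ys * differences z zs) ∎
      where c = coeff R₀ p (length (ys ++ zs))

-- Interlacing: distinct negative zeros by induction on A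

module NegativeRoots where

  open RealRing
  open RationalLemmas
  open PolynomialRoots
  open BinomialPolynomials
  open LinearFactors
  open MultichainCount using (binom)
  open import Data.Rational.Base using (ℚ; 0ℚ; 1ℚ; _+_; _*_; -_; _-_; _<_; _≤_; ∣_∣; nonNegative)
  open import Data.Rational.Properties as ℚₚ using ()
  open import Relation.Binary.PropositionalEquality
  open import Tactic.RingSolver using (solve-∀)

  open FactorTheorem ℝ-commutativeRing _#_ (λ {x} {z} y x#z e → #-cancel {z} {x} {y} (Sum.swap x#z) e) public

  module _ (R : CommutativeRing 0ℓ 0ℓ) where
    open CommutativeRing R renaming (refl to ≈-refl; trans to ≈-trans; _+_ to _⊕_; _*_ to _⊗_)

    zero-multiple-+ : ∀ y f s → f ≈ 0# → y ⊗ f ⊕ s ≈ s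
    zero-multiple-+ y f s e = ≈-trans (+-congʳ (≈-trans (*-congˡ e) (zeroʳ y))) (+-identityˡ s)

  polyℝ : ℕ → ℕ → List ℝ
  polyℝ a b = map constℝ (polyℚ a b)

  derivativeℝ : ℝ → List ℝ → ℝ
  derivativeℝ z p = evℝ (ℝPoly.quotient z p) z

  derivativeℝ-const : ∀ z p n → seq (derivativeℝ z (map constℝ p)) n ≡ evℚ (ℚPoly.quotient (seq z n) p) (seq z n)
  derivativeℝ-const z []      n = refl
  derivativeℝ-const z (a ∷ p) n = cong₂ (λ u v → u + seq z n * v) (evℝ-const (a ∷ p) z n) (derivativeℝ-const z p n)

  coeff-applyUpTo : ∀ (g : ℕ → ℚ) n k → k ℕ.< n → coeff ℝ-ring (map constℝ (applyUpTo g n)) k ≡ constℝ (g k)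
  coeff-applyUpTo g (suc n) zero    _       = refl
  coeff-applyUpTo g (suc n) (suc k) (s≤s l) = coeff-applyUpTo (g ∘ suc) n k l

  positive-const-cancel : ∀ {c y} → 0ℚ < c → Positive (mulℝ (constℝ c) y) → Positive y
  positive-const-cancel {c} {y} 0<c (ε , 0<ε , N , ε<cy) =
    let (δ , 0<δ , cδ≡) = shrink c ε 0<c 0<ε in
    δ , 0<δ , N , λ n le → ℚₚ.*-cancelˡ-<-nonNeg c {{nonNegative (ℚₚ.<⇒≤ 0<c)}}
      (ℚₚ.<-trans (subst (_< ε) (sym cδ≡) (½<1 0<ε)) (ε<cy n le))

  -- C(a,a) = 1 and C(b,a) is a positive integer for a ≤ b. The bound 1 is the form that
  -- `sign-at-−∞` takes.
  leading-≥1 : ∀ a b → a ℕ.≤ b → 1ℚ ≤ hℚ a b a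
  leading-≥1 a b a≤b = subst (1ℚ ≤_) (trans (sym (ℚₚ.*-identityˡ (ℕ→ℚ (binom b a))))
    (cong (λ u → ℕ→ℚ u * ℕ→ℚ (binom b a)) (sym (binom-diagonal a))))
    (ℕ→ℚ-mono {1} {binom b a} (binom-pos b a a≤b))

  differences-below : ∀ z ws → All (_<ℝ z) ws → Positive (differences z ws)
  differences-below z []       []           = positive-const (ℚₚ.positive⁻¹ 1ℚ)
  differences-below z (w ∷ ws) (w<z ∷ ws<z) =
    positive-* {addℝ z (negℝ w)} {differences z ws} (<ℝ⇒positive {w} {z} w<z) (differences-below z ws ws<z)

  differences-above : ∀ z ws → All (z <ℝ_) ws → Positive (mulℝ (constℝ (alternate (length ws))) (differences z ws))
  differences-above z []       []           = positive-const (ℚₚ.positive⁻¹ 1ℚ)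
  differences-above z (w ∷ ws) (z<w ∷ z<ws) = positive-cong
    {mulℝ (addℝ w (negℝ z)) (mulℝ (constℝ s) (differences z ws))}
    {mulℝ (constℝ (- s)) (mulℝ (addℝ z (negℝ w)) (differences z ws))}
    (≃-pointwise (mulℝ (addℝ w (negℝ z)) (mulℝ (constℝ s) (differences z ws)))
                 (mulℝ (constℝ (- s)) (mulℝ (addℝ z (negℝ w)) (differences z ws)))
                 (λ n → lemma (seq w n) (seq z n) s (seq (differences z ws) n)))
    (positive-* {addℝ w (negℝ z)} {mulℝ (constℝ s) (differences z ws)} (<ℝ⇒positive {z} {w} z<w) (differences-above z ws z<ws))
    where
    s = alternate (length ws)
    lemma : ∀ w z s d → (w + - z) * (s * d) ≡ - s * ((z + - w) * d)
    lemma = solve-∀ ℚ-ring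

  eventually-below : ∀ w zs → All (_<ℝ w) zs → ∃[ N ] ∀ n → N ℕ.≤ n → All (λ z → seq z n < seq w n) zs
  eventually-below w []       []                                = 0 , λ _ _ → []
  eventually-below w (z ∷ zs) ((ε , 0<ε , M , z+ε<w) ∷ zs<w) =
    let (N , below) = eventually-below w zs zs<w in
    M ⊔ N , λ n le →
      ℚₚ.<-trans (subst (_< seq z n + ε) (ℚₚ.+-identityʳ (seq z n)) (ℚₚ.+-monoʳ-< (seq z n) 0<ε))
                 (z+ε<w n (ℕₚ.m⊔n≤o⇒m≤o M N le))
      ∷ below n (ℕₚ.m⊔n≤o⇒n≤o M N le)

  module Sampling (F : List ℚ) (K : ℚ) where

    -- Rational approximations of the real numbers zs, followed by a point far to the left.
    points : ℕ → ℚ → List ℝ → List ℚ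
    points n x []       = - (K + (1ℚ + ∣ x ∣)) ∷ []
    points n x (z ∷ zs) = seq z n ∷ points n (seq z n) zs

    length-points : ∀ n x zs → length (points n x zs) ≡ suc (length zs)
    length-points n x []       = refl
    length-points n x (z ∷ zs) = cong suc (length-points n (seq z n) zs)

    -- One index n serves all approximations at once, and x is arbitrary so that it can be the
    -- approximation of the preceding zero, which moves with n.
    AlternatingEventually : ℚ → List ℝ → Set
    AlternatingEventually s zs = ∃[ N ] ∀ n → N ℕ.≤ n → ∀ x → All (λ z → seq z n < x) zs → 0ℚ < s * evℚ F x →
      Alternating F s x (points n x zs)

    -- A positive real exceeds a fixed ε from some index on, and the terms of the real F(z) are the
    -- values of F at the approximations of z; so these have the sign of F(z) as well.
    alternating-∷ : ∀ s z zs → Positive (mulℝ (constℝ (- s)) (evℝ (map constℝ F) z)) → All (_<ℝ z) zs →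
      AlternatingEventually (- s) zs → AlternatingEventually s (z ∷ zs)
    alternating-∷ s z zs (ε , 0<ε , N₁ , sign) zs<z (N₃ , rest) with eventually-below z zs zs<z
    ... | N₂ , below = N₁ ⊔ (N₂ ⊔ N₃) , λ n le x → λ { (z<x ∷ _) 0<Fx →
        0<Fx , z<x , rest n (ℕₚ.m⊔n≤o⇒n≤o N₂ N₃ (ℕₚ.m⊔n≤o⇒n≤o N₁ (N₂ ⊔ N₃) le)) (seq z n)
          (below n (ℕₚ.m⊔n≤o⇒m≤o N₂ N₃ (ℕₚ.m⊔n≤o⇒n≤o N₁ (N₂ ⊔ N₃) le)))
          (subst (λ u → 0ℚ < - s * u) (evℝ-const F z n)
            (ℚₚ.<-trans 0<ε (sign n (ℕₚ.m⊔n≤o⇒m≤o N₁ (N₂ ⊔ N₃) le)))) }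

    alternating⇒roots : 0ℚ < 1ℚ * evℚ F 0ℚ → ∀ zs → All (_<ℝ constℝ 0ℚ) zs → AlternatingEventually 1ℚ zs →
      ∃[ ws ] length ws ≡ suc (length zs) × AllPairs _>ℝ_ ws × All (_<ℝ constℝ 0ℚ) ws × All (Root F) ws
    alternating⇒roots 0<F0 zs zs<0 (N₁ , alternating) with eventually-below (constℝ 0ℚ) zs zs<0
    ... | N₂ , below
      with alternating-roots F 1ℚ 0ℚ (points (N₁ ⊔ N₂) 0ℚ zs) refl
             (alternating (N₁ ⊔ N₂) (ℕₚ.m≤m⊔n N₁ N₂) 0ℚ (below (N₁ ⊔ N₂) (ℕₚ.m≤n⊔m N₁ N₂)) 0<F0)
    ... | ws , len , rest = ws , trans len (length-points (N₁ ⊔ N₂) 0ℚ zs) , rest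

  evℚ-zero : ∀ c p → evℚ (c ∷ p) 0ℚ ≡ c
  evℚ-zero c p = lemma c (evℚ p 0ℚ)
    where
    lemma : ∀ c v → c + 0ℚ * v ≡ c
    lemma = solve-∀ ℚ-ring

  module Interlacing (a b : ℕ) (a<b : a ℕ.< b) where

    f = polyℚ a b
    F = polyℚ (suc a) b

    -- At a root z of f the sign of F is opposite to that of f′, because z < 0.
    sign-at-root : ∀ pre z post → length (pre ++ z ∷ post) ≡ a → AllPairs _#_ (z ∷ pre ++ post) →
      All (z <ℝ_) pre → All (_<ℝ z) post → z <ℝ constℝ 0ℚ → Root f z → All (Root f) (pre ++ post) →
      Positive (mulℝ (constℝ (- alternate (length pre))) (evℝ (map constℝ F) z))
    sign-at-root pre z post len apart z<pre post<z z<0 root roots =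
      positive-const-cancel {1ℚ + ℕ→ℚ a} {mulℝ (constℝ (- s)) Fz} 0<1+a
        (positive-cong {S} {mulℝ (constℝ (1ℚ + ℕ→ℚ a)) (mulℝ (constℝ (- s)) Fz)}
          (≃-trans {S} {addℝ (mulℝ Y fz) S} {mulℝ (constℝ (1ℚ + ℕ→ℚ a)) (mulℝ (constℝ (- s)) Fz)}
            (≃-sym {addℝ (mulℝ Y fz) S} {S} (zero-multiple-+ ℝ-commutativeRing Y fz S root))
            (≃-pointwise (addℝ (mulℝ Y fz) S) (mulℝ (constℝ (1ℚ + ℕ→ℚ a)) (mulℝ (constℝ (- s)) Fz)) recurrence))
          S-positive)
      where
      s  = alternate (length pre)
      p  = applyUpTo (hℚ a b ∘ suc) a
      fz = evℝ (map constℝ f) z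
      Fz = evℝ (map constℝ F) z
      D  = derivativeℝ z (map constℝ p)
      -- The recurrence multiplied by -s reads (1 + a)(-s F(z)) = Y f(z) + S. The term Y f(z)
      -- vanishes at the root, and S = (-z)(1 - z) · s f′(z) is a product of positive numbers.
      Y  = mulℝ (constℝ (- s)) (addℝ (constℝ (1ℚ + ℕ→ℚ a)) (mulℝ (constℝ (ℕ→ℚ b)) z))
      Q  = mulℝ (negℝ z) (addℝ (constℝ 1ℚ) (negℝ z))
      S  = mulℝ Q (mulℝ (constℝ s) D)

      0<1+a : 0ℚ < 1ℚ + ℕ→ℚ a
      0<1+a = ℚₚ.+-mono-<-≤ (ℚₚ.positive⁻¹ 1ℚ) (0≤ℕ→ℚ a)

      recurrence : ∀ n → seq (addℝ (mulℝ Y fz) S) n ≡ seq (mulℝ (constℝ (1ℚ + ℕ→ℚ a)) (mulℝ (constℝ (- s)) Fz)) n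
      recurrence n = begin
        - s * (1ℚ + ℕ→ℚ a + ℕ→ℚ b * x) * seq fz n + - x * (1ℚ - x) * (s * seq D n)
          ≡⟨ cong₂ (λ u v → - s * (1ℚ + ℕ→ℚ a + ℕ→ℚ b * x) * u + - x * (1ℚ - x) * (s * v))
                   (evℝ-const f z n) (derivativeℝ-const z p n) ⟩
        - s * (1ℚ + ℕ→ℚ a + ℕ→ℚ b * x) * evℚ f x + - x * (1ℚ - x) * (s * derivative x f)
          ≡⟨ lemma s (1ℚ + ℕ→ℚ a + ℕ→ℚ b * x) (evℚ f x) x (derivative x f) ⟩
        - s * ((1ℚ + ℕ→ℚ a + ℕ→ℚ b * x) * evℚ f x + x * (1ℚ - x) * derivative x f)
          ≡⟨ cong (- s *_) (polyℚ-rec a b x) ⟨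
        - s * ((1ℚ + ℕ→ℚ a) * evℚ F x)
          ≡⟨ lemma′ s (1ℚ + ℕ→ℚ a) (evℚ F x) ⟩
        (1ℚ + ℕ→ℚ a) * (- s * evℚ F x)
          ≡⟨ cong (λ u → (1ℚ + ℕ→ℚ a) * (- s * u)) (evℝ-const F z n) ⟨
        (1ℚ + ℕ→ℚ a) * (- s * seq Fz n) ∎
        where
        open ≡-Reasoning
        x = seq z n
        lemma : ∀ s y u x d → - s * y * u + - x * (1ℚ + - x) * (s * d) ≡ - s * (y * u + x * (1ℚ + - x) * d)
        lemma = solve-∀ ℚ-ring
        lemma′ : ∀ s c u → - s * (c * u) ≡ c * (- s * u)
        lemma′ = solve-∀ ℚ-ring

      k = length (pre ++ post)
      a≡ : a ≡ suc k
      a≡ = trans (sym len) (trans (length-++ pre) (trans (ℕₚ.+-suc (length pre) (length post)) (cong suc (sym (length-++ pre)))))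
      c = coeff ℝ-ring (map constℝ p) k
      c-positive : Positive c
      c-positive = subst Positive (sym (coeff-applyUpTo (hℚ a b ∘ suc) a k (ℕₚ.≤-reflexive (sym a≡))))
        (positive-const (ℚₚ.<-≤-trans (ℚₚ.positive⁻¹ 1ℚ)
          (subst (λ m → 1ℚ ≤ hℚ a b m) a≡ (leading-≥1 a b (ℕₚ.<⇒≤ a<b)))))
      Pre  = differences z pre
      Post = differences z post
      -- D is f′(z). The zeros in `pre` lie above z and contribute the sign s; those in `post` lie
      -- below and contribute none.
      value : D ≃ mulℝ c (mulℝ Pre Post)
      value = quotient-value (constℝ (hℚ a b 0)) (map constℝ p) z pre post
        (trans (length-map constℝ p) (trans (length-applyUpTo (hℚ a b ∘ suc) a) a≡)) apart root roots
      sD-positive : Positive (mulℝ (constℝ s) D)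
      sD-positive = positive-cong {mulℝ c (mulℝ (mulℝ (constℝ s) Pre) Post)} {mulℝ (constℝ s) D}
        (≃-trans {mulℝ c (mulℝ (mulℝ (constℝ s) Pre) Post)} {mulℝ (mulℝ c (mulℝ Pre Post)) (constℝ s)} {mulℝ (constℝ s) D}
          (≃-pointwise (mulℝ c (mulℝ (mulℝ (constℝ s) Pre) Post)) (mulℝ (mulℝ c (mulℝ Pre Post)) (constℝ s))
            (λ n → lemma (seq c n) s (seq Pre n) (seq Post n)))
          (≃-trans {mulℝ (mulℝ c (mulℝ Pre Post)) (constℝ s)} {mulℝ D (constℝ s)} {mulℝ (constℝ s) D}
            (mulℝ-congˡ {mulℝ c (mulℝ Pre Post)} {D} (constℝ s) (≃-sym {D} {mulℝ c (mulℝ Pre Post)} value))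
            (mulℝ-comm D (constℝ s))))
        (positive-* {c} {mulℝ (mulℝ (constℝ s) Pre) Post} c-positive
          (positive-* {mulℝ (constℝ s) Pre} {Post} (differences-above z pre z<pre) (differences-below z post post<z)))
        where
        lemma : ∀ c s p q → c * (s * p * q) ≡ c * (p * q) * s
        lemma = solve-∀ ℚ-ring
      -z-positive : Positive (negℝ z)
      -z-positive = positive-cong {addℝ (constℝ 0ℚ) (negℝ z)} {negℝ z}
        (≃-pointwise (addℝ (constℝ 0ℚ) (negℝ z)) (negℝ z) (λ n → ℚₚ.+-identityˡ (- seq z n))) (<ℝ⇒positive {z} {constℝ 0ℚ} z<0)
      S-positive : Positive S
      S-positive = positive-* {Q} {mulℝ (constℝ s) D}
        (positive-* {negℝ z} {addℝ (constℝ 1ℚ) (negℝ z)} -z-positive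
          (positive-+ {constℝ 1ℚ} {negℝ z} (positive-const (ℚₚ.positive⁻¹ 1ℚ)) -z-positive))
        sD-positive

    −∞ : ∃[ K ] 0ℚ ≤ K × ∀ x → x ≤ - K → 1ℚ ≤ alternate (suc a) * evℚ F x
    −∞ = sign-at-−∞ F (suc a) (length-applyUpTo (hℚ (suc a) b) (suc (suc a)))
        (subst (1ℚ ≤_) (sym (ℚPoly.coeff-applyUpTo-< (hℚ (suc a) b) (ℕₚ.≤-refl {suc (suc a)}))) (leading-≥1 (suc a) b a<b))
    K = proj₁ −∞

    open Sampling F K

    -- The zeros of f are visited from the largest down, and `pre` collects those already passed, so
    -- the sign at the next one is fixed by the length of `pre`. When all a zeros are passed, the
    -- far left point supplies the last sign change.
    alternating-points : ∀ pre zs → length (pre ++ zs) ≡ a → AllPairs _#_ pre → AllPairs _>ℝ_ zs →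
      All (λ p → All (_<ℝ p) zs) pre → All (_<ℝ constℝ 0ℚ) zs → All (Root f) pre → All (Root f) zs →
      AlternatingEventually (alternate (length pre)) zs
    alternating-points pre [] len _ _ _ _ _ _ = 0 , λ n _ x _ 0<Fx → 0<Fx , y<x x , last x
      where
      -- At most -K, so the sign at -∞ applies, and smaller than -|x|, hence to the left of x.
      y : ℚ → ℚ
      y x = - (K + (1ℚ + ∣ x ∣))
      length-pre : length pre ≡ a
      length-pre = trans (sym (ℕₚ.+-identityʳ (length pre))) (trans (sym (length-++ pre)) len)
      0≤1+∣x∣ : ∀ x → 0ℚ ≤ 1ℚ + ∣ x ∣
      0≤1+∣x∣ x = ℚₚ.+-mono-≤ (ℚₚ.<⇒≤ (ℚₚ.positive⁻¹ 1ℚ)) 0≤∣ x ∣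
      y≤-K : ∀ x → y x ≤ - K
      y≤-K x = ℚₚ.neg-antimono-≤ (subst (_≤ K + (1ℚ + ∣ x ∣)) (ℚₚ.+-identityʳ K) (ℚₚ.+-monoʳ-≤ K (0≤1+∣x∣ x)))
      last : ∀ x → 0ℚ < - alternate (length pre) * evℚ F (y x)
      last x = subst (λ m → 0ℚ < - alternate m * evℚ F (y x)) (sym length-pre)
        (ℚₚ.<-≤-trans (ℚₚ.positive⁻¹ 1ℚ) (proj₂ (proj₂ −∞) (y x) (y≤-K x)))
      y<x : ∀ x → y x < x
      y<x x = begin-strict
        - (K + (1ℚ + ∣ x ∣))  <⟨ ℚₚ.neg-antimono-< (ℚₚ.+-mono-≤-< (proj₁ (proj₂ −∞)) (ℚₚ.+-monoˡ-< ∣ x ∣ (ℚₚ.positive⁻¹ 1ℚ))) ⟩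
        - (0ℚ + (0ℚ + ∣ x ∣))  ≡⟨ lemma ∣ x ∣ ⟩
        - ∣ x ∣  ≤⟨ ℚₚ.neg-antimono-≤ (subst (- x ≤_) (ℚₚ.∣-p∣≡∣p∣ x) (p≤∣p∣ (- x))) ⟩
        - - x  ≡⟨ lemma′ x ⟩
        x  ∎
        where
        open ℚₚ.≤-Reasoning
        lemma : ∀ x → - (0ℚ + (0ℚ + x)) ≡ - x
        lemma = solve-∀ ℚ-ring
        lemma′ : ∀ x → - - x ≡ x
        lemma′ = solve-∀ ℚ-ring
    alternating-points pre (z ∷ zs) len pre# (zs<z ∷ desc) pre> (z<0 ∷ zs<0) pre-roots (root ∷ roots) =
      alternating-∷ (alternate (length pre)) z zs
        (sign-at-root pre z zs len
          ( Allₚ.++⁺ (All.map inj₁ z<pre) (All.map inj₂ zs<z)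
          ∷ AllPairsₚ.++⁺ pre# (AllPairs.map inj₂ desc) (All.map (λ { (_ ∷ zs<p) → All.map inj₂ zs<p }) pre>))
          z<pre zs<z z<0 root (Allₚ.++⁺ pre-roots roots))
        zs<z
        (alternating-points (z ∷ pre) zs
          (trans (cong suc (length-++ pre)) (trans (sym (ℕₚ.+-suc (length pre) (length zs))) (trans (sym (length-++ pre)) len)))
          (All.map inj₁ z<pre ∷ pre#) desc (zs<z ∷ All.map (λ { (_ ∷ zs<p) → zs<p }) pre>)
          zs<0 (root ∷ pre-roots) roots)
      where
      z<pre : All (z <ℝ_) pre
      z<pre = All.map (λ { (z<p ∷ _) → z<p }) pre>

  DistinctNegativeRoots : ℕ → ℕ → Set
  DistinctNegativeRoots a b =
    ∃[ zs ] length zs ≡ a × AllPairs _>ℝ_ zs × All (_<ℝ constℝ 0ℚ) zs × All (Root (polyℚ a b)) zs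

  -- B stays fixed while A grows. The a approximated zeros together with 0, where F is 1, and the
  -- far left point are a + 2 points with alternating signs, giving a + 1 zeros.
  distinctNegativeRoots : ∀ a b → a ℕ.≤ b → DistinctNegativeRoots a b
  distinctNegativeRoots zero    b _   = [] , refl , [] , [] , []
  distinctNegativeRoots (suc a) b a<b with distinctNegativeRoots a b (ℕₚ.<⇒≤ a<b)
  ... | zs , len , desc , neg , roots =
    let (ws , len′ , rest) = alternating⇒roots 0<F0 zs neg (alternating-points [] zs len [] desc [] neg [] roots)
    in ws , trans len′ (cong suc len) , rest
    where
    open Interlacing a b a<b
    open Sampling F K
    0<F0 : 0ℚ < 1ℚ * evℚ F 0ℚ
    0<F0 = subst (λ u → 0ℚ < 1ℚ * u) (sym (evℚ-zero (hℚ (suc a) b 0) (applyUpTo (hℚ (suc a) b ∘ suc) (suc a)))) (ℚₚ.positive⁻¹ 1ℚ)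

-- Expansion in powers of t / (1 - t) by a shift operator

module BinomialIdentity where

  open PolynomialRing
  open BinomialPolynomials
  open MultichainCount using (binom)
  open import Data.Integer.Base using (+_)
  open import Data.Nat.Tactic.RingSolver using () renaming (solve-∀ to solveℕ-∀)
  open import Relation.Binary.PropositionalEquality as ≡ using (_≡_)
  open import Tactic.RingSolver using (solve-∀)

  -- rep b k = C (b + k) k
  rep : ℕ → ℕ → ℕ
  rep zero    k       = 1
  rep (suc b) zero    = 1
  rep (suc b) (suc k) = rep (suc b) k ℕ.+ rep b (suc k)

  rep-zeroʳ : ∀ b → rep b 0 ≡ 1
  rep-zeroʳ zero    = ≡.refl
  rep-zeroʳ (suc b) = ≡.refl

  -- One step of the rising factorial (b + 1)_k, divided by k!; this is how `rep` meets the Jacobi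
  -- coefficients.
  rep-suc : ∀ b k → suc k ℕ.* rep b (suc k) ≡ (suc b ℕ.+ k) ℕ.* rep b k
  rep-suc zero    k       = ≡.refl
  rep-suc (suc b) zero    = begin
    1 ℕ.* (1 ℕ.+ rep b 1)  ≡⟨ ≡.cong (λ u → 1 ℕ.* (1 ℕ.+ u)) (≡.trans (≡.sym (ℕₚ.*-identityˡ (rep b 1))) (rep-suc b 0)) ⟩
    1 ℕ.* (1 ℕ.+ (suc b ℕ.+ 0) ℕ.* rep b 0) ≡⟨ ≡.cong (λ u → 1 ℕ.* (1 ℕ.+ (suc b ℕ.+ 0) ℕ.* u)) (rep-zeroʳ b) ⟩
    1 ℕ.* (1 ℕ.+ (suc b ℕ.+ 0) ℕ.* 1)  ≡⟨ lemma b ⟩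
    (suc (suc b) ℕ.+ 0) ℕ.* 1  ∎
    where
    open ≡.≡-Reasoning
    lemma : ∀ b → 1 ℕ.* (1 ℕ.+ ((1 ℕ.+ b) ℕ.+ 0) ℕ.* 1) ≡ ((2 ℕ.+ b) ℕ.+ 0) ℕ.* 1
    lemma = solveℕ-∀
  rep-suc (suc b) (suc k) = begin
    suc (suc k) ℕ.* ((p ℕ.+ q) ℕ.+ q′)
      ≡⟨ lemma₁ k p q q′ ⟩
    (suc k ℕ.* (p ℕ.+ q) ℕ.+ (p ℕ.+ q)) ℕ.+ suc (suc k) ℕ.* q′
      ≡⟨ ≡.cong₂ (λ u v → (u ℕ.+ (p ℕ.+ q)) ℕ.+ v) (rep-suc (suc b) k) (rep-suc b (suc k)) ⟩
    ((suc (suc b) ℕ.+ k) ℕ.* p ℕ.+ (p ℕ.+ q)) ℕ.+ (suc b ℕ.+ suc k) ℕ.* q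
      ≡⟨ lemma₂ b k p q ⟩
    (suc (suc b) ℕ.+ suc k) ℕ.* (p ℕ.+ q) ∎
    where
    open ≡.≡-Reasoning
    p  = rep (suc b) k
    q  = rep b (suc k)
    q′ = rep b (suc (suc k))
    lemma₁ : ∀ k p q q′ → (2 ℕ.+ k) ℕ.* ((p ℕ.+ q) ℕ.+ q′) ≡ ((1 ℕ.+ k) ℕ.* (p ℕ.+ q) ℕ.+ (p ℕ.+ q)) ℕ.+ (2 ℕ.+ k) ℕ.* q′
    lemma₁ = solveℕ-∀
    lemma₂ : ∀ b k p q → (((2 ℕ.+ b) ℕ.+ k) ℕ.* p ℕ.+ (p ℕ.+ q)) ℕ.+ ((1 ℕ.+ b) ℕ.+ (1 ℕ.+ k)) ℕ.* q ≡ ((2 ℕ.+ b) ℕ.+ (1 ℕ.+ k)) ℕ.* (p ℕ.+ q)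
    lemma₂ = solveℕ-∀

  binom-rep : ∀ k m → binom (k ℕ.+ m) k ≡ rep k m
  binom-rep zero    m       = ≡.refl
  binom-rep (suc k) zero    = ≡.trans (≡.cong (λ n → binom (suc n) (suc k)) (ℕₚ.+-identityʳ k)) (binom-diagonal (suc k))
  binom-rep (suc k) (suc m) = ≡.trans
    (≡.cong₂ ℕ._+_ (binom-rep k (suc m)) (≡.trans (≡.cong (λ n → binom n (suc k)) (ℕₚ.+-suc k m)) (binom-rep (suc k) m)))
    (ℕₚ.+-comm (rep k (suc m)) (rep (suc k) m))

  module BinomialTransform (R : CommutativeRing 0ℓ 0ℓ) where
    open CommutativeRing R hiding (zero)
    open SetoidReasoning setoid
    open NatSolver commutativeSemiring using (solve; _:=_; con) renaming (_:+_ to _⊕_; _:*_ to _⊗_)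
    open RingProperties ring using (+-cancelʳ)
    open PolyProperties R using (R₀)
    open Truncation R

    -- ((x + y S)ⁿ c) 0, where S is the shift of sequences.
    T : Carrier → Carrier → ℕ → (ℕ → Carrier) → Carrier
    T x y zero    c = c 0
    T x y (suc n) c = x * T x y n c + y * T x y n (c ∘ suc)

    module _ (x y : Carrier) where

      T-cong : ∀ n {c d} → (∀ k → c k ≈ d k) → T x y n c ≈ T x y n d
      T-cong zero    e = e 0
      T-cong (suc n) e = +-cong (*-congˡ (T-cong n e)) (*-congˡ (T-cong n (λ k → e (suc k))))

      T-+ : ∀ n c d → T x y n (λ k → c k + d k) ≈ T x y n c + T x y n d
      T-+ zero    c d = refl
      T-+ (suc n) c d = trans (+-cong (*-congˡ (T-+ n c d)) (*-congˡ (T-+ n (c ∘ suc) (d ∘ suc))))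
        (solve 6 (λ x y p q r s → x ⊗ (p ⊕ q) ⊕ y ⊗ (r ⊕ s) := (x ⊗ p ⊕ y ⊗ r) ⊕ (x ⊗ q ⊕ y ⊗ s)) refl x y _ _ _ _)

      T-zero : ∀ n {c} → (∀ k → c k ≈ 0#) → T x y n c ≈ 0#
      T-zero zero    e = e 0
      T-zero (suc n) e = trans (+-cong (trans (*-congˡ (T-zero n e)) (zeroʳ x))
                                       (trans (*-congˡ (T-zero n (λ k → e (suc k)))) (zeroʳ y))) (+-identityˡ 0#)

    -- In operator form, w^n (1 + v S)^n = (w + t S)^n.
    T-scale : ∀ w v t → w * v ≈ t → ∀ n c → power R₀ w n * T 1# v n c ≈ T w t n c
    T-scale w v t e zero    c = *-identityˡ (c 0)
    T-scale w v t e (suc n) c = begin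
      (w * wⁿ) * (1# * T 1# v n c + v * T 1# v n (c ∘ suc))
        ≈⟨ solve 5 (λ w p v x y → (w ⊗ p) ⊗ (con 1 ⊗ x ⊕ v ⊗ y) := w ⊗ (p ⊗ x) ⊕ (w ⊗ v) ⊗ (p ⊗ y)) refl w wⁿ v _ _ ⟩
      w * (wⁿ * T 1# v n c) + (w * v) * (wⁿ * T 1# v n (c ∘ suc))
        ≈⟨ +-cong (*-congˡ (T-scale w v t e n c)) (*-cong e (T-scale w v t e n (c ∘ suc))) ⟩
      w * T w t n c + t * T w t n (c ∘ suc) ∎
      where wⁿ = power R₀ w n

    module _ (ι : ℕ → Carrier) (ι-0 : ι 0 ≈ 0#) (ι-1 : ι 1 ≈ 1#) (ι-+ : ∀ m n → ι (m ℕ.+ n) ≈ ι m + ι n) where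

      -- The binomial theorem for (1 + v S)^n applied to the sequence c and read at index 0.
      E-binom : ∀ n c v → E (suc n) (λ k → ι (binom n k) * c k) v ≈ T 1# v n c
      E-binom zero    c v = trans (+-cong (trans (*-congʳ ι-1) (*-identityˡ (c 0))) (zeroʳ v)) (+-identityʳ (c 0))
      E-binom (suc n) c v = begin
        E (suc (suc n)) (λ k → ι (binom (suc n) k) * c k) v
          ≈⟨ E-cong (suc (suc n)) v pascal ⟩
        E (suc (suc n)) (λ k → ι (binom n k) * c k + delay (λ k → ι (binom n k) * c (suc k)) k) v
          ≈⟨ E-+ (suc (suc n)) (λ k → ι (binom n k) * c k) (delay (λ k → ι (binom n k) * c (suc k))) v ⟩
        E (suc (suc n)) (λ k → ι (binom n k) * c k) v + E (suc (suc n)) (delay (λ k → ι (binom n k) * c (suc k))) v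
          ≈⟨ +-cong (E-extend (suc n) (λ k → ι (binom n k) * c k) v
                      (trans (*-congʳ (trans (reflexive (≡.cong ι (binom-> n (suc n) ℕₚ.≤-refl))) ι-0)) (zeroˡ _)))
                    (E-delay (suc n) (λ k → ι (binom n k) * c (suc k)) v) ⟩
        E (suc n) (λ k → ι (binom n k) * c k) v + v * E (suc n) (λ k → ι (binom n k) * c (suc k)) v
          ≈⟨ +-cong (trans (E-binom n c v) (sym (*-identityˡ _))) (*-congˡ (E-binom n (c ∘ suc) v)) ⟩
        1# * T 1# v n c + v * T 1# v n (c ∘ suc) ∎
        where
        pascal : ∀ k → ι (binom (suc n) k) * c k ≈ ι (binom n k) * c k + delay (λ k → ι (binom n k) * c (suc k)) k
        pascal zero    = sym (+-identityʳ _)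
        pascal (suc k) = trans (*-congʳ (ι-+ (binom n k) (binom n (suc k)))) (trans (distribʳ (c (suc k)) _ _) (+-comm _ _))

      module _ (t w : Carrier) (t+w≈1 : t + w ≈ 1#) where

        X Y : ℕ → ℕ → Carrier
        X a b = T 1# t a (ι ∘ binom b)
        Y a b = T w t a (ι ∘ rep b)

        -- Pascal in b gives S binom_{b+1} = binom_b + S binom_b; here w is 1 - t. The subtracted
        -- term stands on the left, which keeps the identity within semirings.
        X-rec : ∀ a b → X (suc a) (suc b) + w * X a b ≈ X a (suc b) + X (suc a) b
        X-rec a b = begin
          (1# * X a (suc b) + t * T 1# t a (ι ∘ binom (suc b) ∘ suc)) + w * X a b
            ≈⟨ +-congʳ (+-congˡ (*-congˡ (trans (T-cong 1# t a (λ k → ι-+ (binom b k) (binom b (suc k))))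
                                                (T-+ 1# t a (ι ∘ binom b) (ι ∘ binom b ∘ suc))))) ⟩
          (1# * X a (suc b) + t * (X a b + x)) + w * X a b
            ≈⟨ solve 5 (λ p t q x w → (con 1 ⊗ p ⊕ t ⊗ (q ⊕ x)) ⊕ w ⊗ q := p ⊕ ((t ⊕ w) ⊗ q ⊕ t ⊗ x)) refl _ t _ x w ⟩
          X a (suc b) + ((t + w) * X a b + t * x)
            ≈⟨ +-congˡ (+-congʳ (*-congʳ t+w≈1)) ⟩
          X a (suc b) + (1# * X a b + t * x) ∎
          where x = T 1# t a (ι ∘ binom b ∘ suc)

        -- Here S rep_{b+1} = rep_{b+1} + S rep_b, and w + t S collapses by t + w = 1 to the
        -- recurrence satisfied by `X`.
        Y-rec : ∀ a b → Y (suc a) (suc b) + w * Y a b ≈ Y a (suc b) + Y (suc a) b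
        Y-rec a b = begin
          (w * Y a (suc b) + t * T w t a (ι ∘ rep (suc b) ∘ suc)) + w * Y a b
            ≈⟨ +-congʳ (+-congˡ (*-congˡ (trans (T-cong w t a (λ k → ι-+ (rep (suc b) k) (rep b (suc k))))
                                                (T-+ w t a (ι ∘ rep (suc b)) (ι ∘ rep b ∘ suc))))) ⟩
          (w * Y a (suc b) + t * (Y a (suc b) + y)) + w * Y a b
            ≈⟨ solve 5 (λ w p t y q → (w ⊗ p ⊕ t ⊗ (p ⊕ y)) ⊕ w ⊗ q := (t ⊕ w) ⊗ p ⊕ (w ⊗ q ⊕ t ⊗ y)) refl w _ t y _ ⟩
          (t + w) * Y a (suc b) + (w * Y a b + t * y)
            ≈⟨ +-congʳ (trans (*-congʳ t+w≈1) (*-identityˡ _)) ⟩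
          Y a (suc b) + (w * Y a b + t * y) ∎
          where y = T w t a (ι ∘ rep b ∘ suc)

        X-zeroʳ : ∀ a → X a 0 ≈ ι 1
        X-zeroʳ zero    = refl
        X-zeroʳ (suc a) = trans (+-cong (trans (*-identityˡ _) (X-zeroʳ a))
          (trans (*-congˡ (T-zero 1# t a (λ k → ι-0))) (zeroʳ t))) (+-identityʳ _)

        Y-zeroʳ : ∀ a → Y a 0 ≈ ι 1
        Y-zeroʳ zero    = refl
        Y-zeroʳ (suc a) = trans (+-cong (*-congˡ (Y-zeroʳ a)) (*-congˡ (Y-zeroʳ a)))
          (trans (sym (distribʳ (ι 1) w t)) (trans (*-congʳ (trans (+-comm w t) t+w≈1)) (*-identityˡ (ι 1))))

        -- The recurrence determines both arrays from their values on the two axes, all of which are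
        -- `ι 1`.
        X≈Y : ∀ a b → X a b ≈ Y a b
        X≈Y zero    b       = reflexive (≡.cong ι (≡.sym (rep-zeroʳ b)))
        X≈Y (suc a) zero    = trans (X-zeroʳ (suc a)) (sym (Y-zeroʳ (suc a)))
        X≈Y (suc a) (suc b) = +-cancelʳ (w * X a b) _ _ (begin
          X (suc a) (suc b) + w * X a b  ≈⟨ X-rec a b ⟩
          X a (suc b) + X (suc a) b  ≈⟨ +-cong (X≈Y a (suc b)) (X≈Y (suc a) b) ⟩
          Y a (suc b) + Y (suc a) b  ≈⟨ Y-rec a b ⟨
          Y (suc a) (suc b) + w * Y a b  ≈⟨ +-congˡ (*-congˡ (X≈Y a b)) ⟨
          Y (suc a) (suc b) + w * X a b  ∎)

        -- v plays the part of t / (1 - t); the equation w v = t takes the place of the division.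
        binomial-identity : ∀ v → w * v ≈ t → ∀ a b →
          E (suc a) (λ k → ι (binom a k) * ι (binom b k)) t ≈
          power R₀ w a * E (suc a) (λ k → ι (binom a k) * ι (rep b k)) v
        binomial-identity v wv≈t a b = begin
          E (suc a) (λ k → ι (binom a k) * ι (binom b k)) t  ≈⟨ E-binom a (ι ∘ binom b) t ⟩
          X a b  ≈⟨ X≈Y a b ⟩
          Y a b  ≈⟨ T-scale w v t wv≈t a (ι ∘ rep b) ⟨
          power R₀ w a * T 1# v a (ι ∘ rep b)  ≈⟨ *-congˡ (E-binom a (ι ∘ rep b) v) ⟨
          power R₀ w a * E (suc a) (λ k → ι (binom a k) * ι (rep b k)) v  ∎

-- The Jacobi polynomial with α = 0 and β = B - A

module JacobiExpansion where

  open RealRing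
  open RationalLemmas
  open PolynomialRoots
  open BinomialPolynomials
  open BinomialIdentity
  open MultichainCount using (binom)
  open import Data.Integer.Base using (+_)
  open import Data.Rational.Base using (ℚ; 0ℚ; 1ℚ; ½; _+_; _*_; -_; _-_; _/_; toℚᵘ; +-*-rawRing)
  open import Data.Rational.Properties as ℚₚ using ()
  open import Data.Rational.Unnormalised.Base as ℚᵘ using (mkℚᵘ; *≡*)
  import Data.Rational.Unnormalised.Properties as ℚᵘₚ
  open import Relation.Binary.PropositionalEquality
  open import Tactic.RingSolver using (solve-∀)

  module ℚTrunc = Truncation ℚₚ.+-*-commutativeRing
  module ℝTrunc = Truncation ℝ-commutativeRing

  -- The coefficient inside `jacobi` is local; this copy and `powerSum` unfold to the same terms, so
  -- `jacobi` can be handled through them.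
  jacobiCoefficient : ℕ → ℚ → ℚ → ℕ → ℚ
  jacobiCoefficient n α β k =
    rising (ℕ→ℚ n + α + β + 1ℚ) k * rising (α + ℕ→ℚ k + 1ℚ) (n ∸ k)
      * (((+ 1) / (k ! ℕ.* (n ∸ k) !)) {{k ℕₚ.!* (n ∸ k) !≢0}})

  powerSum : (ℕ → ℚ) → List ℕ → List ℚ
  powerSum c ks = sumOf ℚ[x] (map (λ k → mulPoly +-*-rawRing (c k ∷ []) (power ℚ[x] (- ½ ∷ ½ ∷ []) k)) ks)

  E-powers : ∀ n (g : ℕ → ℚ) v →
    sumOf ℚPoly.R₀ (applyUpTo (λ k → g k * power ℚPoly.R₀ v k) n) ≡ ℚTrunc.E n g v
  E-powers zero    g v = refl
  E-powers (suc n) g v = cong₂ _+_ (ℚₚ.*-identityʳ (g 0)) (trans (pull n (λ k → g (suc k)) (λ k → power ℚPoly.R₀ v k))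
    (cong (v *_) (E-powers n (g ∘ suc) v)))
    where
    pull : ∀ n (g p : ℕ → ℚ) → sumOf ℚPoly.R₀ (applyUpTo (λ k → g k * (v * p k)) n) ≡
           v * sumOf ℚPoly.R₀ (applyUpTo (λ k → g k * p k) n)
    pull zero    g p = sym (ℚₚ.*-zeroʳ v)
    pull (suc n) g p = trans (cong (λ s → g 0 * (v * p 0) + s) (pull n (g ∘ suc) (p ∘ suc)))
      (lemma (g 0) v (p 0) (sumOf ℚPoly.R₀ (applyUpTo (λ k → g (suc k) * p (suc k)) n)))
      where
      lemma : ∀ a v p s → a * (v * p) + v * s ≡ v * (a * p + s)
      lemma = solve-∀ ℚ-ring

  E-cong-< : ∀ n {f g : ℕ → ℚ} x → (∀ k → k ℕ.< n → f k ≡ g k) → ℚTrunc.E n f x ≡ ℚTrunc.E n g x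
  E-cong-< zero    x e = refl
  E-cong-< (suc n) x e = cong₂ (λ u v → u + x * v) (e 0 (s≤s z≤n)) (E-cong-< n x (λ k l → e (suc k) (s≤s l)))

  powerSum-eval : ∀ c ks x → evℚ (powerSum c ks) x ≡ sumOf ℚPoly.R₀ (map (λ k → c k * power ℚPoly.R₀ (½ * (x - 1ℚ)) k) ks)
  powerSum-eval c []       x = refl
  powerSum-eval c (k ∷ ks) x = trans (ℚPoly.eval-add (mulPoly +-*-rawRing (c k ∷ []) basisᵏ) (powerSum c ks) x)
    (cong₂ _+_
      (trans (ℚPoly.eval-mul (c k ∷ []) basisᵏ x) (cong₂ _*_ (ℚPoly.eval-const (c k) x)
        (trans (ℚPoly.eval-power (- ½ ∷ ½ ∷ []) x k) (cong (λ u → power ℚPoly.R₀ u k) (lemma ½ x)))))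
      (powerSum-eval c ks x))
    where
    basisᵏ = power ℚ[x] (- ½ ∷ ½ ∷ []) k
    lemma : ∀ h x → - h + x * (h + x * 0ℚ) ≡ h * (x + - 1ℚ)
    lemma = solve-∀ ℚ-ring

  powerSum-E : ∀ c n x → evℚ (powerSum c (upTo n)) x ≡ ℚTrunc.E n c (½ * (x - 1ℚ))
  powerSum-E c n x = trans (powerSum-eval c (upTo n) x)
    (trans (cong (sumOf ℚPoly.R₀) (map-applyUpTo (λ k → k) (λ k → c k * power ℚPoly.R₀ (½ * (x - 1ℚ)) k) n))
           (E-powers n c (½ * (x - 1ℚ))))

  powerSum-E-cong : ∀ c d n x → (∀ k → k ℕ.< n → c k ≡ d k) →
                    evℚ (powerSum c (upTo n)) x ≡ ℚTrunc.E n d (½ * (x - 1ℚ))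
  powerSum-E-cong c d n x e = trans (powerSum-E c n x) (E-cong-< n (½ * (x - 1ℚ)) e)

  ℕ→ℚ-recip : ∀ N .{{_ : NonZero N}} → ℕ→ℚ N * ((+ 1) / N) ≡ 1ℚ
  ℕ→ℚ-recip (suc n) = ℚₚ.toℚᵘ-injective (begin
    toℚᵘ (ℕ→ℚ (suc n) * ((+ 1) / suc n))  ≈⟨ ℚₚ.toℚᵘ-homo-* (ℕ→ℚ (suc n)) ((+ 1) / suc n) ⟩
    toℚᵘ (ℕ→ℚ (suc n)) ℚᵘ.* toℚᵘ ((+ 1) / suc n)  ≈⟨ ℚᵘₚ.*-cong (toℚᵘ-ℤ→ℚ (+ suc n)) (ℚₚ.toℚᵘ-fromℚᵘ (mkℚᵘ (+ 1) n)) ⟩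
    mkℚᵘ (+ suc n) 0 ℚᵘ.* mkℚᵘ (+ 1) n  ≈⟨ *≡* (cong +_ (lemma n)) ⟩
    mkℚᵘ (+ 1) 0  ∎)
    where
    open ℚᵘₚ.≃-Reasoning
    lemma : ∀ n → suc n ℕ.* 1 ℕ.* 1 ≡ suc (n ℕ.+ 0 ℕ.+ 0)
    lemma n = trans (ℕₚ.*-identityʳ (suc n ℕ.* 1)) (trans (ℕₚ.*-identityʳ (suc n))
      (cong suc (sym (trans (ℕₚ.+-identityʳ (n ℕ.+ 0)) (ℕₚ.+-identityʳ n)))))

  -- (b + 1)_k = (b + k)! / b!, which is C(b + k, k) k!; the induction compares the last factors by
  -- `rep-suc`.
  rising-rep : ∀ b k → rising (ℕ→ℚ b + 1ℚ) k ≡ ℕ→ℚ (rep b k) * ℕ→ℚ (k !)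
  rising-rep b zero    = sym (trans (cong (λ u → ℕ→ℚ u * 1ℚ) (rep-zeroʳ b)) (ℚₚ.*-identityʳ 1ℚ))
  rising-rep b (suc k) = begin
    rising (ℕ→ℚ b + 1ℚ) k * (ℕ→ℚ b + 1ℚ + ℕ→ℚ k)
      ≡⟨ cong₂ _*_ (rising-rep b k) (trans (cong (_+ ℕ→ℚ k) (trans (ℚₚ.+-comm (ℕ→ℚ b) 1ℚ) (sym (ℕ→ℚ-suc b)))) (sym (ℕ→ℚ-+ (suc b) k))) ⟩
    ℕ→ℚ (rep b k) * ℕ→ℚ (k !) * ℕ→ℚ (suc b ℕ.+ k)
      ≡⟨ lemma (ℕ→ℚ (rep b k)) (ℕ→ℚ (k !)) (ℕ→ℚ (suc b ℕ.+ k)) ⟩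
    ℕ→ℚ (suc b ℕ.+ k) * ℕ→ℚ (rep b k) * ℕ→ℚ (k !)
      ≡⟨ cong (_* ℕ→ℚ (k !)) (trans (sym (ℕ→ℚ-* (suc b ℕ.+ k) (rep b k))) (trans (cong ℕ→ℚ (sym (rep-suc b k))) (ℕ→ℚ-* (suc k) (rep b (suc k))))) ⟩
    ℕ→ℚ (suc k) * ℕ→ℚ (rep b (suc k)) * ℕ→ℚ (k !)
      ≡⟨ lemma′ (ℕ→ℚ (suc k)) (ℕ→ℚ (rep b (suc k))) (ℕ→ℚ (k !)) ⟩
    ℕ→ℚ (rep b (suc k)) * (ℕ→ℚ (suc k) * ℕ→ℚ (k !))
      ≡⟨ cong (ℕ→ℚ (rep b (suc k)) *_) (ℕ→ℚ-* (suc k) (k !)) ⟨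
    ℕ→ℚ (rep b (suc k)) * ℕ→ℚ (suc k !) ∎
    where
    open ≡-Reasoning
    lemma : ∀ r f s → r * f * s ≡ s * r * f
    lemma = solve-∀ ℚ-ring
    lemma′ : ∀ s r f → s * r * f ≡ r * (s * f)
    lemma′ = solve-∀ ℚ-ring

  -- With n = a, α = 0 and β = b - a the first base n + α + β + 1 is b + 1, and the second rising
  -- factorial is C(a,k) (a - k)!. Both factorials cancel against the denominator.
  jacobiCoefficient-value : ∀ a b k → k ℕ.≤ a →
    jacobiCoefficient a 0ℚ (ℕ→ℚ b - ℕ→ℚ a) k ≡ ℕ→ℚ (binom a k) * ℕ→ℚ (rep b k)
  jacobiCoefficient-value a b k k≤a = begin
    rising (ℕ→ℚ a + 0ℚ + (ℕ→ℚ b - ℕ→ℚ a) + 1ℚ) k * rising (0ℚ + ℕ→ℚ k + 1ℚ) m * recip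
      ≡⟨ cong₂ (λ x y → rising x k * rising y m * recip) (lemma₁ (ℕ→ℚ a) (ℕ→ℚ b)) (cong (_+ 1ℚ) (ℚₚ.+-identityˡ (ℕ→ℚ k))) ⟩
    rising (ℕ→ℚ b + 1ℚ) k * rising (ℕ→ℚ k + 1ℚ) m * recip
      ≡⟨ cong₂ (λ x y → x * y * recip) (rising-rep b k) (rising-rep k m) ⟩
    (ℕ→ℚ (rep b k) * ℕ→ℚ (k !)) * (ℕ→ℚ (rep k m) * ℕ→ℚ (m !)) * recip
      ≡⟨ lemma₂ (ℕ→ℚ (rep b k)) (ℕ→ℚ (k !)) (ℕ→ℚ (rep k m)) (ℕ→ℚ (m !)) recip ⟩
    ℕ→ℚ (rep k m) * ℕ→ℚ (rep b k) * ((ℕ→ℚ (k !) * ℕ→ℚ (m !)) * recip)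
      ≡⟨ cong₂ (λ x y → x * ℕ→ℚ (rep b k) * y) (cong ℕ→ℚ rep≡binom)
           (trans (cong (_* recip) (sym (ℕ→ℚ-* (k !) (m !)))) (ℕ→ℚ-recip (k ! ℕ.* m !) {{k ℕₚ.!* m !≢0}})) ⟩
    ℕ→ℚ (binom a k) * ℕ→ℚ (rep b k) * 1ℚ
      ≡⟨ ℚₚ.*-identityʳ (ℕ→ℚ (binom a k) * ℕ→ℚ (rep b k)) ⟩
    ℕ→ℚ (binom a k) * ℕ→ℚ (rep b k) ∎
    where
    open ≡-Reasoning
    m = a ∸ k
    recip : ℚ
    recip = ((+ 1) / (k ! ℕ.* m !)) {{k ℕₚ.!* m !≢0}}
    rep≡binom : rep k m ≡ binom a k
    rep≡binom = trans (sym (binom-rep k m)) (cong (λ n → binom n k) (ℕₚ.m+[n∸m]≡n k≤a))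
    lemma₁ : ∀ a b → a + 0ℚ + (b + - a) + 1ℚ ≡ b + 1ℚ
    lemma₁ = solve-∀ ℚ-ring
    lemma₂ : ∀ x f y g r → (x * f) * (y * g) * r ≡ y * x * ((f * g) * r)
    lemma₂ = solve-∀ ℚ-ring

  seq-E : ∀ n (g : ℕ → ℝ) v i → seq (ℝTrunc.E n g v) i ≡ ℚTrunc.E n (λ k → seq (g k) i) (seq v i)
  seq-E zero    g v i = refl
  seq-E (suc n) g v i = cong (λ w → seq (g 0) i + seq v i * w) (seq-E n (g ∘ suc) v i)

  ιℝ : ℕ → ℝ
  ιℝ n = constℝ (ℕ→ℚ n)

  module _ (n : ℕ) (p q : ℕ → ℕ) where

    E-products : ∀ f y v → (∀ i → evℚ f (seq y i) ≡ ℚTrunc.E n (λ k → ℕ→ℚ (p k) * ℕ→ℚ (q k)) (seq v i)) →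
      evℝ (map constℝ f) y ≃ ℝTrunc.E n (λ k → mulℝ (ιℝ (p k)) (ιℝ (q k))) v
    E-products f y v e = ≃-pointwise (evℝ (map constℝ f) y) (ℝTrunc.E n (λ k → mulℝ (ιℝ (p k)) (ιℝ (q k))) v)
      (λ i → trans (evℝ-const f y i) (trans (e i) (sym (seq-E n (λ k → mulℝ (ιℝ (p k)) (ιℝ (q k))) v i))))

  open BinomialTransform ℝ-commutativeRing using (binomial-identity)

  ≃-substitute : ∀ x x′ y y′ c → x ≃ x′ → y ≃ y′ → x′ ≃ mulℝ c y′ → x ≃ mulℝ c y
  ≃-substitute x x′ y y′ c e f g = ≃-trans {x} {x′} {mulℝ c y} e (≃-trans {x′} {mulℝ c y′} {mulℝ c y} g
    (mulℝ-cong {c} {c} {y′} {y} (≃-refl {c}) (≃-sym {y} {y′} f)))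

  t+[1-t]≃1 : ∀ t → addℝ t (addℝ (constℝ 1ℚ) (negℝ t)) ≃ constℝ 1ℚ
  t+[1-t]≃1 t = ≃-pointwise (addℝ t (addℝ (constℝ 1ℚ) (negℝ t))) (constℝ 1ℚ) (λ i → lemma (seq t i))
    where
    lemma : ∀ t → t + (1ℚ + - t) ≡ 1ℚ
    lemma = solve-∀ ℚ-ring

  -- With x = (1 + t) u and u = 1 / (1 - t), one has (1 - t) (x - 1) / 2 = t.
  [1-t][x-1]/2≃t : ∀ t u → mulℝ (addℝ (constℝ 1ℚ) (negℝ t)) u ≃ constℝ 1ℚ →
    mulℝ (addℝ (constℝ 1ℚ) (negℝ t)) (mulℝ (constℝ ½) (addℝ (mulℝ (addℝ (constℝ 1ℚ) t) u) (negℝ (constℝ 1ℚ)))) ≃ t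
  [1-t][x-1]/2≃t t u e = ≃-trans
    {mulℝ (addℝ (constℝ 1ℚ) (negℝ t)) (mulℝ (constℝ ½) (addℝ (mulℝ (addℝ (constℝ 1ℚ) t) u) (negℝ (constℝ 1ℚ))))}
    {addℝ (mulℝ (mulℝ (addℝ (constℝ 1ℚ) (negℝ t)) u) h₁) h₂} {t}
    (≃-pointwise
      (mulℝ (addℝ (constℝ 1ℚ) (negℝ t)) (mulℝ (constℝ ½) (addℝ (mulℝ (addℝ (constℝ 1ℚ) t) u) (negℝ (constℝ 1ℚ)))))
      (addℝ (mulℝ (mulℝ (addℝ (constℝ 1ℚ) (negℝ t)) u) h₁) h₂)
      (λ i → lemma₁ ½ (seq t i) (seq u i)))
    (≃-trans {addℝ (mulℝ (mulℝ (addℝ (constℝ 1ℚ) (negℝ t)) u) h₁) h₂} {addℝ (mulℝ (constℝ 1ℚ) h₁) h₂} {t}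
      (addℝ-congˡ {mulℝ (mulℝ (addℝ (constℝ 1ℚ) (negℝ t)) u) h₁} {mulℝ (constℝ 1ℚ) h₁} h₂
        (mulℝ-congˡ {mulℝ (addℝ (constℝ 1ℚ) (negℝ t)) u} {constℝ 1ℚ} h₁ e))
      (≃-pointwise (addℝ (mulℝ (constℝ 1ℚ) h₁) h₂) t (λ i → trans (lemma₂ ½ (seq t i)) (ℚₚ.*-identityˡ (seq t i)))))
    where
    h₁ = mulℝ (constℝ ½) (addℝ (constℝ 1ℚ) t)
    h₂ = negℝ (mulℝ (constℝ ½) (addℝ (constℝ 1ℚ) (negℝ t)))
    lemma₁ : ∀ h t u → (1ℚ + - t) * (h * ((1ℚ + t) * u + - 1ℚ)) ≡ ((1ℚ + - t) * u) * (h * (1ℚ + t)) + - (h * (1ℚ + - t))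
    lemma₁ = solve-∀ ℚ-ring
    lemma₂ : ∀ h t → 1ℚ * (h * (1ℚ + t)) + - (h * (1ℚ + - t)) ≡ (h + h) * t
    lemma₂ = solve-∀ ℚ-ring

  module _ (a b : ℕ) (J₀ : List ℚ) (t w v y : ℝ) (t+w≃1 : addℝ t w ≃ constℝ 1ℚ) (wv≃t : mulℝ w v ≃ t) where

    real-binomial-identity :
      ℝTrunc.E (suc a) (λ k → mulℝ (ιℝ (binom a k)) (ιℝ (binom b k))) t ≃
      mulℝ (power ℝ-ring w a) (ℝTrunc.E (suc a) (λ k → mulℝ (ιℝ (binom a k)) (ιℝ (rep b k))) v)
    real-binomial-identity = binomial-identity ιℝ (≃-refl {constℝ 0ℚ}) (≃-refl {constℝ 1ℚ})
      (λ m n → ≃-pointwise (ιℝ (m ℕ.+ n)) (addℝ (ιℝ m) (ιℝ n)) (λ _ → ℕ→ℚ-+ m n)) t w t+w≃1 v wv≃t a b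

    expansion-identity :
      evℝ (map constℝ (polyℚ a b)) t ≃ ℝTrunc.E (suc a) (λ k → mulℝ (ιℝ (binom a k)) (ιℝ (binom b k))) t →
      evℝ (map constℝ J₀) y ≃ ℝTrunc.E (suc a) (λ k → mulℝ (ιℝ (binom a k)) (ιℝ (rep b k))) v →
      evℝ (map constℝ (polyℚ a b)) t ≃ mulℝ (power ℝ-ring w a) (evℝ (map constℝ J₀) y)
    expansion-identity e f = ≃-substitute
      (evℝ (map constℝ (polyℚ a b)) t) (ℝTrunc.E (suc a) (λ k → mulℝ (ιℝ (binom a k)) (ιℝ (binom b k))) t)
      (evℝ (map constℝ J₀) y) (ℝTrunc.E (suc a) (λ k → mulℝ (ιℝ (binom a k)) (ιℝ (rep b k))) v)
      (power ℝ-ring w a) e f real-binomial-identity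

  jacobi-eval : ∀ a b x → evℚ (jacobi a 0ℚ (ℕ→ℚ b - ℕ→ℚ a)) x ≡
                ℚTrunc.E (suc a) (λ k → ℕ→ℚ (binom a k) * ℕ→ℚ (rep b k)) (½ * (x - 1ℚ))
  jacobi-eval a b x = powerSum-E-cong (jacobiCoefficient a 0ℚ (ℕ→ℚ b - ℕ→ℚ a)) (λ k → ℕ→ℚ (binom a k) * ℕ→ℚ (rep b k))
    (suc a) x (λ { k (s≤s k≤a) → jacobiCoefficient-value a b k k≤a })

  jacobi-identity : ∀ a b t u → mulℝ (addℝ (constℝ 1ℚ) (negℝ t)) u ≃ constℝ 1ℚ →
    evℝ (map constℝ (polyℚ a b)) t ≃
    mulℝ (power ℝ-ring (addℝ (constℝ 1ℚ) (negℝ t)) a)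
         (evℝ (map constℝ (jacobi a 0ℚ (ℕ→ℚ b - ℕ→ℚ a))) (mulℝ (addℝ (constℝ 1ℚ) t) u))
  jacobi-identity a b t u e = expansion-identity a b (jacobi a 0ℚ (ℕ→ℚ b - ℕ→ℚ a)) t
    (addℝ (constℝ 1ℚ) (negℝ t))
    (mulℝ (constℝ ½) (addℝ (mulℝ (addℝ (constℝ 1ℚ) t) u) (negℝ (constℝ 1ℚ))))
    (mulℝ (addℝ (constℝ 1ℚ) t) u)
    (t+[1-t]≃1 t) ([1-t][x-1]/2≃t t u e)
    (E-products (suc a) (binom a) (binom b) (polyℚ a b) t t (λ i → refl))
    (E-products (suc a) (binom a) (rep b) (jacobi a 0ℚ (ℕ→ℚ b - ℕ→ℚ a)) (mulℝ (addℝ (constℝ 1ℚ) t) u)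
      (mulℝ (constℝ ½) (addℝ (mulℝ (addℝ (constℝ 1ℚ) t) u) (negℝ (constℝ 1ℚ))))
      (λ i → jacobi-eval a b ((1ℚ + seq t i) * seq u i)))

-- Transfer to the numerator of the trapezoidal poset

module Conclusion where

  open WeakChains
  open MultichainCount
  open NumeratorAtOne
  open RealRing
  open RationalLemmas
  open PolynomialRoots
  open BinomialPolynomials
  open NegativeRoots
  open JacobiExpansion
  open import Data.Integer.Base as ℤ using (ℤ; +_)
  open import Data.Nat.Base using (ℕ; zero; suc; _≤_; _<_; _+_; _*_; _∸_; s≤s; z≤n)
  open import Data.Nat.Combinatorics using (_C_)
  open import Data.Product using (_×_; _,_; ∃!)
  open import Data.Rational.Base as ℚ using (0ℚ; 1ℚ; _-_)
  import Data.Rational.Properties as ℚₚ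
  open import Relation.Binary.PropositionalEquality

  coeff-binomials : ∀ a b n → coeff ℤ.+-*-rawRing (applyUpTo (λ k → + ((a C k) * (b C k))) (suc a)) n ≡ h a b n
  coeff-binomials a b n with n ℕₚ.<? suc a
  ... | yes n≤a = trans (ℤPoly.coeff-applyUpTo-< (λ k → + ((a C k) * (b C k))) n≤a)
    (trans (cong +_ (cong₂ _*_ (sym (binom≡C a n)) (sym (binom≡C b n)))) (ℤₚ.pos-* (binom a n) (binom b n)))
  ... | no n≰a = trans (ℤPoly.coeff-applyUpTo-≥ (λ k → + ((a C k) * (b C k))) (ℕₚ.≮⇒≥ n≰a))
    (sym (trans (cong (λ u → + u ℤ.* + binom b n) (binom-> a n (ℕₚ.≮⇒≥ n≰a))) (ℤₚ.*-zeroˡ (+ binom b n))))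

  coeff-ℤ[t]→ℝ[t] : ∀ p n → coeff ℝ-ring (ℤ[t]→ℝ[t] p) n ≡ constℝ (ℤ→ℚ (coeff ℤ.+-*-rawRing p n))
  coeff-ℤ[t]→ℝ[t] []      n       = refl
  coeff-ℤ[t]→ℝ[t] (a ∷ p) zero    = refl
  coeff-ℤ[t]→ℝ[t] (a ∷ p) (suc n) = coeff-ℤ[t]→ℝ[t] p n

  coeff-map-constℝ : ∀ p n → coeff ℝ-ring (map constℝ p) n ≡ constℝ (coeff ℚPoly.R₀ p n)
  coeff-map-constℝ []      n       = refl
  coeff-map-constℝ (a ∷ p) zero    = refl
  coeff-map-constℝ (a ∷ p) (suc n) = coeff-map-constℝ p n

  coeff-polyℚ : ∀ a b n → coeff ℚPoly.R₀ (polyℚ a b) n ≡ hℚ a b n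
  coeff-polyℚ a b n with n ℕₚ.<? suc a
  ... | yes n≤a = ℚPoly.coeff-applyUpTo-< (hℚ a b) n≤a
  ... | no n≰a = trans (ℚPoly.coeff-applyUpTo-≥ (hℚ a b) (ℕₚ.≮⇒≥ n≰a)) (sym (hℚ->′ a b n (ℕₚ.≮⇒≥ n≰a)))
    where
    hℚ->′ : ∀ a b n → a < n → hℚ a b n ≡ 0ℚ
    hℚ->′ a b n a<n = trans (cong (λ u → ℕ→ℚ u ℚ.* ℕ→ℚ (binom b n)) (binom-> a n a<n)) (ℚₚ.*-zeroˡ (ℕ→ℚ (binom b n)))

  realRooted-intro : ∀ f zs → length f ≡ suc (length zs) → constℝ 0ℚ <ℝ coeff ℝ-ring f (length zs) →
    AllPairs _>ℝ_ zs → All (_<ℝ constℝ 0ℚ) zs → All (λ z → evℝ f z ≃ constℝ 0ℚ) zs → RealRootedSimpleNegative f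
  realRooted-intro f zs len 0<lead desc neg roots = record
    { lead          = coeff ℝ-ring f (length zs)
    ; zeros         = zs
    ; lead-nonzero  = inj₂ 0<lead
    ; factorisation = factorisation f zs len (AllPairs.map inj₂ desc) roots
    ; simple        = AllPairs.map inj₂ desc
    ; negative      = neg
    }

  realRooted-resp-coeff : ∀ f g → (∀ n → coeff ℝ-ring f n ≡ coeff ℝ-ring g n) →
    RealRootedSimpleNegative f → RealRootedSimpleNegative g
  realRooted-resp-coeff f g e R = record
    { lead          = lead
    ; zeros         = zeros
    ; lead-nonzero  = lead-nonzero
    ; factorisation = λ n → subst (_≃ coeff ℝ-ring (RawRing._*_ ℝ[t] (lead ∷ [])
        (productOf ℝ[t] (map (λ z → negℝ z ∷ constℝ 1ℚ ∷ []) zeros))) n) (e n) (RealRootedSimpleNegative.factorisation R n)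
    ; simple        = simple
    ; negative      = negative
    }
    where open RealRootedSimpleNegative R using (lead; zeros; lead-nonzero; simple; negative)

  eval-resp-coeff : ∀ f g → (∀ n → coeff ℝ-ring f n ≡ coeff ℝ-ring g n) → ∀ t → evℝ f t ≃ evℝ g t
  eval-resp-coeff f g e t = ℝPoly.eval-cong f g t (λ n → subst (coeff ℝ-ring f n ≃_) (e n) (≃-refl {coeff ℝ-ring f n}))

  module _ (a b : ℕ) (p : List ℤ) (p-coeff : ∀ n → coeff ℤ.+-*-rawRing p n ≡ h a b n) where

    coeff-real : ∀ n → coeff ℝ-ring (ℤ[t]→ℝ[t] p) n ≡ coeff ℝ-ring (polyℝ a b) n
    coeff-real n = trans (coeff-ℤ[t]→ℝ[t] p n) (trans
      (cong constℝ (trans (cong ℤ→ℚ (p-coeff n)) (trans (ℤ→ℚ-* (+ binom a n) (+ binom b n)) (sym (coeff-polyℚ a b n)))))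
      (sym (coeff-map-constℝ (polyℚ a b) n)))

    real-rooted : a ≤ b → RealRootedSimpleNegative (ℤ[t]→ℝ[t] p)
    real-rooted a≤b with distinctNegativeRoots a b a≤b
    ... | zs , len , desc , neg , roots = realRooted-resp-coeff (polyℝ a b) (ℤ[t]→ℝ[t] p) (λ n → sym (coeff-real n))
      (realRooted-intro (polyℝ a b) zs
        (trans (length-map constℝ (polyℚ a b)) (trans (length-applyUpTo (hℚ a b) (suc a)) (cong suc (sym len))))
        (subst (constℝ 0ℚ <ℝ_) (sym lead≡) (positive⇒0< (hℚ a b a) (ℚₚ.<-≤-trans (ℚₚ.positive⁻¹ 1ℚ) (leading-≥1 a b a≤b))))
        desc neg roots)
      where
      lead≡ : coeff ℝ-ring (polyℝ a b) (length zs) ≡ constℝ (hℚ a b a)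
      lead≡ = trans (cong (coeff ℝ-ring (polyℝ a b)) len)
                (trans (coeff-map-constℝ (polyℚ a b) a) (cong constℝ (coeff-polyℚ a b a)))
      positive⇒0< : ∀ c → 0ℚ ℚ.< c → constℝ 0ℚ <ℝ constℝ c
      positive⇒0< c 0<c = positive⇒<ℝ {constℝ 0ℚ} {constℝ c} (positive-cong {constℝ c} {addℝ (constℝ c) (negℝ (constℝ 0ℚ))}
        (≃-pointwise (constℝ c) (addℝ (constℝ c) (negℝ (constℝ 0ℚ))) (λ _ → sym (ℚₚ.+-identityʳ c))) (positive-const 0<c))

    jacobi-real : ∀ t u → mulℝ (addℝ (constℝ 1ℚ) (negℝ t)) u ≃ constℝ 1ℚ →
      eval ℝ-ring (ℤ[t]→ℝ[t] p) t
        ≃ mulℝ (power ℝ-ring (addℝ (constℝ 1ℚ) (negℝ t)) a)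
               (evalℝ (jacobi a 0ℚ (ℕ→ℚ b - ℕ→ℚ a)) (mulℝ (addℝ (constℝ 1ℚ) t) u))
    jacobi-real t u e = ≃-trans {eval ℝ-ring (ℤ[t]→ℝ[t] p) t} {evℝ (polyℝ a b) t}
      {mulℝ (power ℝ-ring (addℝ (constℝ 1ℚ) (negℝ t)) a)
            (evalℝ (jacobi a 0ℚ (ℕ→ℚ b - ℕ→ℚ a)) (mulℝ (addℝ (constℝ 1ℚ) t) u))}
      (eval-resp-coeff (ℤ[t]→ℝ[t] p) (polyℝ a b) coeff-real t) (jacobi-identity a b t u e)

  -- Matching on s = (a + 1) + (B + 1) removes all truncated subtractions from the parameters.
  corollary-suc : ∀ a s B (2≤2r : 2 ≤ 2 * suc a) (2r≤s : 2 * suc a ≤ s) → s ≡ suc a + suc B →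
      let P = trapezoidal (suc a) s 2≤2r 2r≤s in
      ∃! (RawRing._≈_ ℤ[q][t]) (IsNumerator P)
      × (∀ ℍ → IsNumerator P ℍ →
          RawRing._≈_ ℤ[t] (atq=1 ℍ) (applyUpTo (λ k → + ((a C k) * (B C k))) (suc a))
          × RealRootedSimpleNegative (ℤ[t]→ℝ[t] (atq=1 ℍ))
          × (∀ t u → mulℝ (addℝ (constℝ 1ℚ) (negℝ t)) u ≃ constℝ 1ℚ →
              eval ℝ-ring (ℤ[t]→ℝ[t] (atq=1 ℍ)) t
                ≃ mulℝ (power ℝ-ring (addℝ (constℝ 1ℚ) (negℝ t)) a)
                       (evalℝ (jacobi a 0ℚ (ℕ→ℚ B - ℕ→ℚ a)) (mulℝ (addℝ (constℝ 1ℚ) t) u))))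
  corollary-suc a s B 2≤2r 2r≤s refl = numerator-∃! (trapezoidal (suc a) s 2≤2r 2r≤s) (rankT-mono (suc a) s) ,
    λ ℍ isNumerator → let coeffs = numerator-coeff a B 2≤2r 2r≤s ℍ isNumerator in
      (λ n → trans (coeffs n) (sym (coeff-binomials a B n)))
      , real-rooted a B (atq=1 ℍ) coeffs a≤B
      , jacobi-real a B (atq=1 ℍ) coeffs
    where
    -- The hypothesis 2r ≤ s in terms of A and B; it gives the numerator degree exactly A, matching
    -- the number of zeros found.
    a≤B : a ≤ B
    a≤B = ℕₚ.≤-pred (ℕₚ.+-cancelˡ-≤ (suc a) (suc a) (suc B)
      (subst (λ m → suc a + m ≤ suc a + suc B) (ℕₚ.+-identityʳ (suc a)) 2r≤s))

  -- s ≥ 2r > r, so both truncated subtractions in B = s - r - 1 are exact.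
  ∸-split : ∀ a s → 2 * suc a ≤ s → s ≡ suc a + suc (s ∸ suc a ∸ 1)
  ∸-split a s 2r≤s = trans (sym (ℕₚ.m+[n∸m]≡n (ℕₚ.≤-trans (ℕₚ.m≤m+n (suc a) (suc a + 0)) 2r≤s)))
    (cong (λ n → suc a + n) (sym (ℕₚ.m+[n∸m]≡n 1≤)))
    where
    1≤ : 1 ≤ s ∸ suc a
    1≤ = ℕₚ.m<n⇒0<n∸m (ℕₚ.<-≤-trans (ℕₚ.m<m+n (suc a) (s≤s z≤n)) 2r≤s)

open import Data.Integer.Base using (+_)
open import Data.Nat.Base using (ℕ; suc; _≤_; _*_; _∸_)
open import Data.Nat.Combinatorics using (_C_)
open import Data.Product using (∃!)
open import Data.Rational.Base using (0ℚ; 1ℚ; _-_)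

corollary4p8 : (r s : ℕ) (2≤2r : 2 ≤ 2 * r) (2r≤s : 2 * r ≤ s) →
    let T = trapezoidal r s 2≤2r 2r≤s
        A = r ∸ 1
        B = s ∸ r ∸ 1
    in
    ∃! (RawRing._≈_ ℤ[q][t]) (IsNumerator T)
    × (∀ ℍ → IsNumerator T ℍ →
        RawRing._≈_ ℤ[t] (atq=1 ℍ) (applyUpTo (λ k → + ((A C k) * (B C k))) r)
        × RealRootedSimpleNegative (ℤ[t]→ℝ[t] (atq=1 ℍ))
        × (∀ t u → mulℝ (addℝ (constℝ 1ℚ) (negℝ t)) u ≃ constℝ 1ℚ →
            eval ℝ-ring (ℤ[t]→ℝ[t] (atq=1 ℍ)) t
              ≃ mulℝ (power ℝ-ring (addℝ (constℝ 1ℚ) (negℝ t)) A)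
                     (evalℝ (jacobi A 0ℚ (ℕ→ℚ B - ℕ→ℚ A)) (mulℝ (addℝ (constℝ 1ℚ) t) u))))
corollary4p8 (suc a) s 2≤2r 2r≤s =
  Conclusion.corollary-suc a s (s ∸ suc a ∸ 1) 2≤2r 2r≤s (Conclusion.∸-split a s 2r≤s)
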